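{- Let $N$ be a positive integer. Then there are suitable choices of power series $\gamma_N^{a,b}=\gamma_N^{a,b}(q)$ and $\lambda_N^{a,b}=\lambda_N^{a,b}(q)=\lambda_N^{b,a}(q)$ ($a,b\in\mathbb{Z}/N\mathbb{Z}$) which provide a solution to the linear system $$\gamma_N^{a,a}-\lambda_N^{a,a}=\tilde g^{a}_2(q)\quad\forall a\in\mathbb{Z}/N\mathbb{Z},\qquad \gamma_N^{a,b}+\gamma_N^{b,a}-2\lambda_N^{a,b}=0\quad\forall a\ne b\in\mathbb{Z}/N\mathbb{Z},$$ together with $$\gamma_N^{a+b,a}+\gamma_N^{a+b,b}-2\lambda_N^{a,b}=f^{a}_{2}(q)+f^{b}_{2}(q)\quad\forall a,b\in\mathbb{Z}/N\mathbb{Z}.$$ Consequently (with such choices of $\gamma_N^{a,b}$ and $\lambda_N^{a,b}$), for all $r,s\ge1$ and $a,b\in\mathbb{Z}/N\mathbb{Z}$ the power series $E_{r,s}^{a,b}(q)$, $P_{r,s}^{a,b}(q)$ and $E_k^a(q)$ satisfy the double shuffle relation at level $N$: $$P_{r,s}^{a,b}(q)=E_{r,s}^{a,b}(q)+E_{s,r}^{b,a}(q)+\delta_{a,b}E^{a}_{r+s}(q)=\sum_{\substack{i+j=r+s\\ i,j\ge1}}\left(\binom{i-1}{r-1}E_{i,j}^{a+b,b}(q)+\binom{i-1}{s-1}E_{i,j}^{a+b,a}(q)\right).$$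
   Context: Fix $N\ge1$, $\eta=e^{2\pi i/N}$; superscripts $a,b$ are residue classes modulo $N$; $\delta_{x,y}$ is the Kronecker symbol; $\binom00=1$. All series are power series in $q$ with complex coefficients. For $r,s\ge1$: $$\tilde g^a_s(q)=\frac{(-1)^s}{N^s(s-1)!}\sum_{u,v\ge1}\eta^{av}v^{s-1}q^{uv},$$ $$\tilde g^{a,b}_{r,s}(q)=\frac{(-1)^{r+s}}{N^{r+s}(r-1)!(s-1)!}\sum_{\substack{u_1>u_2>0\\ v_1,v_2\ge1}}\eta^{av_1+bv_2}v_1^{r-1}v_2^{s-1}q^{u_1v_1+u_2v_2}.$$ For $k\ge0$: $(\tilde g^a_k)'(q)=\frac{(-1)^k}{N^{k+1}k!}\sum_{n,v\ge1}n\,v^k\eta^{av}q^{nv}$ (for $k\ge 1$ this equals $\frac{q}{Nk}\frac{d}{dq}\tilde g^a_k(q)$). Also $f_2^a(q)=\frac1{N^2}\sum_{n,u\ge1}\eta^{au}n\,q^{nu}$. For $n\ge1$, with $B_n(x)$ the Bernoulli polynomials ($\frac{te^{xt}}{e^t-1}=\sum_{n\ge0}B_n(x)\frac{t^n}{n!}$): $$\beta^a_n=-\frac1{2N\cdot n!}\sum_{l=1}^N\exp\Big(-\frac{2\pi i\,la}{N}\Big)B_n\Big(\frac lN\Big).$$ For $r,s\ge1$: $$\beta_{r,s}^{a,b}(q)=\tilde g^a_r(q)\beta^b_s+\sum_{i+j=r+s,\ i,j\ge1}\beta^{a-b}_i\left[(-1)^s\binom{i-1}{s-1}\tilde g^a_j(q)+(-1)^{i-r}\binom{i-1}{r-1}\tilde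 g^b_j(q)\right],$$ $$\varepsilon_{r,s}^{a,b}(q)=\delta_{r,2}(\tilde g^b_s)'(q)-\delta_{r,1}(\tilde g^b_{s-1})'(q)+\delta_{s,1}\big((\tilde g^a_{r-1})'(q)+\tilde g^a_r(q)\big)+N\delta_{r,1}\delta_{s,1}\gamma_N^{a,b}(q).$$ Finally define $E^a_k(q)=\tilde g^a_k(q)$ if $k>2$ and $E^a_k(q)=0$ if $k\le2$; and for $r,s\ge1$ $$E_{r,s}^{a,b}(q)=\tilde g_{r,s}^{a,b}(q)+\beta_{r,s}^{a,b}(q)+\frac{\varepsilon_{r,s}^{a,b}(q)}{2N},$$ $$P_{r,s}^{a,b}(q)=\tilde g^a_r(q)\tilde g^b_s(q)+\beta^a_r\tilde g^b_s(q)+\beta^b_s\tilde g^a_r(q)+\frac{\delta_{r,2}(\tilde g^b_s)'(q)+\delta_{s,2}(\tilde g^a_r)'(q)}{2N}+\delta_{r,1}\delta_{s,1}\lambda_N^{a,b}(q).$$ Here $\gamma_N^{a,b}$ and $\lambda_N^{a,b}$ are the power series chosen in the claim. -}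

module Defs where

open import Level using (_⊔_)
open import Algebra.Apartness.Bundles using (HeytingField; HeytingCommutativeRing)
open import Algebra.Bundles using (CommutativeRing)
import Algebra.Properties.Semiring.Exp
import Algebra.Properties.Semiring.Mult
import Algebra.Properties.Semiring.Sum
open import Data.Bool.Base using (if_then_else_)
import Data.Fin.Base as Fin
open Fin using (Fin; toℕ)
import Data.Fin.Properties as Fin
import Data.Nat.Base as ℕ
open ℕ using (ℕ; zero; suc; _∸_; _!; NonZero)
import Data.Nat.Properties as ℕ
open import Data.Nat.Combinatorics using (_C_)
open import Data.Nat.DivMod using (_mod_)
open import Data.Product.Base using (proj₁; proj₂)
open import Relation.Binary.PropositionalEquality.Core using (_≢_)
import Relation.Binary.Reasoning.Setoid as SetoidReasoning
open import Relation.Nullary.Decidable.Core using (Dec; does; _×-dec_)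

-- ℤ/Nℤ as Fin N with representatives 0, …, N - 1.
module Residues (N : ℕ) .{{_ : NonZero N}} where

  infixl 6 _+ₙ_ _-ₙ_
  infix  8 -ₙ_

  _+ₙ_ : Fin N → Fin N → Fin N
  a +ₙ b = (toℕ a ℕ.+ toℕ b) mod N

  -ₙ_ : Fin N → Fin N
  -ₙ a = (N ∸ toℕ a) mod N

  _-ₙ_ : Fin N → Fin N → Fin N
  a -ₙ b = a +ₙ (-ₙ b)

module _ {c ℓ₁ ℓ₂} (K : HeytingField c ℓ₁ ℓ₂) where
  open HeytingField K
  open CommutativeRing (HeytingCommutativeRing.commutativeRing heytingCommutativeRing)
    using (semiring)
  open Algebra.Properties.Semiring.Exp semiring using (_^_)
  open Algebra.Properties.Semiring.Mult semiring using (_×_)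

  -- Apartness from 0 is invertibility, so this says that every positive
  -- integer is invertible in K.
  CharacteristicZero : Set ℓ₂
  CharacteristicZero = ∀ n .{{_ : NonZero n}} → (n × 1#) # 0#

  record IsPrimitiveRoot (N : ℕ) (η : Carrier) : Set (ℓ₁ ⊔ ℓ₂) where
    field
      η^N≈1 : η ^ N ≈ 1#
      η^k#1 : ∀ k → 0 ℕ.< k → k ℕ.< N → (η ^ k) # 1#

-- Formal power series over K; f n is the coefficient of the n-th power of
-- the variable.
module Series
  {c ℓ₁ ℓ₂} (K : HeytingField c ℓ₁ ℓ₂) (char0 : CharacteristicZero K)
  where

  open HeytingField K
  open CommutativeRing (HeytingCommutativeRing.commutativeRing heytingCommutativeRing)
    using (semiring)
  open Algebra.Properties.Semiring.Exp semiring using (_^_)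
  open Algebra.Properties.Semiring.Mult semiring using (_×_)
  open Algebra.Properties.Semiring.Sum semiring using (sum; sum-cong-≋)

  fromℕ : ℕ → Carrier
  fromℕ n = n × 1#

  infix 9 1/_
  1/_ : (n : ℕ) .{{_ : NonZero n}} → Carrier
  1/ n = proj₁ (#⇒invertible (char0 n))

  infix 9 1/!_
  1/!_ : ℕ → Carrier
  1/! n = 1/_ (n !) {{n ℕ.!≢0}}

  infix 9 [_]
  [_] : ∀ {p} {P : Set p} → Dec P → Carrier
  [ d ] = if does d then 1# else 0#

  infixl 5 ∑₁-syntax
  ∑₁-syntax : ℕ → (ℕ → Carrier) → Carrier
  ∑₁-syntax n f = sum {n} (λ i → f (suc (toℕ i)))

  -- The index runs over 1, …, n.
  syntax ∑₁-syntax n (λ i → x) = ∑₁[ i ≤ n ] x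

  PowerSeries : Set c
  PowerSeries = ℕ → Carrier

  infix  4 _≋_
  infixl 6 _⊕_ _⊖_
  infixl 7 _⊛_
  infixr 8 _·_
  infixl 7 _⊘_
  infix  9 e^_

  _≋_ : PowerSeries → PowerSeries → Set ℓ₁
  f ≋ g = ∀ n → f n ≈ g n

  0ₛ 1ₛ : PowerSeries
  0ₛ _ = 0#
  1ₛ zero    = 1#
  1ₛ (suc _) = 0#

  _⊕_ _⊖_ _⊛_ : PowerSeries → PowerSeries → PowerSeries
  (f ⊕ g) n = f n + g n
  (f ⊖ g) n = f n - g n
  (f ⊛ g) n = sum {suc n} (λ i → f (toℕ i) * g (n ∸ toℕ i))

  _·_ : Carrier → PowerSeries → PowerSeries
  (x · f) n = x * f n

  -- ∑₊ w F is the sum of F i j over all i, j ≥ 1 with i + j = w.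
  ∑₊ : ℕ → (ℕ → ℕ → PowerSeries) → PowerSeries
  ∑₊ w F n = ∑₁[ i ≤ w ∸ 1 ] F i (w ∸ i) n

  -- The quotient f / h for h with constant term 1.  Its coefficients Q solve
  -- Q n = f n - ∑ h (i + 1) Q (n - (i + 1)), the sum being over i < n; the
  -- k-th approximation below has the right coefficients in degrees < k.
  quotientApprox : PowerSeries → PowerSeries → ℕ → PowerSeries
  quotientApprox f h zero    _ = 0#
  quotientApprox f h (suc k) n =
    f n - sum {n} (λ i → h (suc (toℕ i)) * quotientApprox f h k (n ∸ suc (toℕ i)))

  _⊘_ : PowerSeries → PowerSeries → PowerSeries
  (f ⊘ h) n = quotientApprox f h (suc n) n

  -- e^ x is the series e^{xt} in the variable t.
  e^_ : Carrier → PowerSeries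
  (e^ x) n = x ^ n * 1/! n

  -- The generating function t e^{xt} / (e^t - 1), with the factor t
  -- cancelled: (e^t - 1) / t has coefficients 1 / (n + 1)!.
  bernoulliSeries : Carrier → PowerSeries
  bernoulliSeries x = e^ x ⊘ (λ n → (e^ 1#) (suc n))

  -- Bernoulli polynomials.
  B : ℕ → Carrier → Carrier
  B n x = fromℕ (n !) * bernoulliSeries x n

  module _ where
    open SetoidReasoning (CommutativeRing.setoid
      (HeytingCommutativeRing.commutativeRing heytingCommutativeRing))
    open import Algebra.Properties.Ring (CommutativeRing.ring
      (HeytingCommutativeRing.commutativeRing heytingCommutativeRing))
      using (-0#≈0#)

    x-0≈x : ∀ x → x - 0# ≈ x
    x-0≈x x = trans (+-congˡ -0#≈0#) (+-identityʳ x)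

    fromℕ*1/ : ∀ n .{{_ : NonZero n}} → fromℕ n * 1/ n ≈ 1#
    fromℕ*1/ n = trans (*-congʳ (sym (x-0≈x _)))
                       (proj₂ (proj₂ (#⇒invertible (char0 n))))

    fromℕ*1/! : ∀ n → fromℕ (n !) * 1/! n ≈ 1#
    fromℕ*1/! n = fromℕ*1/ (n !) {{n ℕ.!≢0}}

    quotientApprox-stable : ∀ f h k l n → n ℕ.< k → n ℕ.< l →
      quotientApprox f h k n ≈ quotientApprox f h l n
    quotientApprox-stable f h (suc k) (suc l) n (ℕ.s≤s n≤k) (ℕ.s≤s n≤l) =
      +-congˡ (-‿cong (sum-cong-≋ {n} λ i → *-congˡ
        (quotientApprox-stable f h k l (n ∸ suc (toℕ i))
          (ℕ.<-≤-trans (smaller i) n≤k) (ℕ.<-≤-trans (smaller i) n≤l))))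
      where
      smaller : (i : Fin n) → n ∸ suc (toℕ i) ℕ.< n
      smaller i = ℕ.∸-monoʳ-< {n} {suc (toℕ i)} {0} (ℕ.s≤s ℕ.z≤n) (Fin.toℕ<n i)

    ⊘-correct : ∀ f h → h 0 ≈ 1# → h ⊛ (f ⊘ h) ≋ f
    ⊘-correct f h h0≈1 n = begin
      h 0 * (f n - rest (λ _ → n)) + rest (λ m → suc m)
        ≈⟨ +-cong (trans (*-congʳ h0≈1) (*-identityˡ _)) (sum-cong-≋ {n} λ i →
             *-congˡ (quotientApprox-stable f h _ n (n ∸ suc (toℕ i)) ℕ.≤-refl (smaller i))) ⟩
      (f n - rest (λ _ → n)) + rest (λ _ → n)
        ≈⟨ +-assoc _ _ _ ⟩
      f n + (- rest (λ _ → n) + rest (λ _ → n))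
        ≈⟨ +-congˡ (-‿inverseˡ _) ⟩
      f n + 0#
        ≈⟨ +-identityʳ _ ⟩
      f n ∎
      where
      rest : (ℕ → ℕ) → Carrier
      rest k = sum {n} (λ i →
        h (suc (toℕ i)) * quotientApprox f h (k (n ∸ suc (toℕ i))) (n ∸ suc (toℕ i)))
      smaller : (i : Fin n) → n ∸ suc (toℕ i) ℕ.< n
      smaller i = ℕ.∸-monoʳ-< {n} {suc (toℕ i)} {0} (ℕ.s≤s ℕ.z≤n) (Fin.toℕ<n i)

    1^n≈1 : ∀ n → 1# ^ n ≈ 1#
    1^n≈1 zero    = refl
    1^n≈1 (suc n) = trans (*-identityˡ _) (1^n≈1 n)

    1/0!≈1 : 1/! 0 ≈ 1#
    1/0!≈1 = begin
      1/! 0            ≈⟨ *-identityˡ _ ⟨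
      1# * 1/! 0       ≈⟨ *-congʳ (+-identityʳ 1#) ⟨
      fromℕ 1 * 1/! 0  ≈⟨ fromℕ*1/! 0 ⟩
      1#               ∎

    X· : PowerSeries → PowerSeries
    X· f zero    = 0#
    X· f (suc n) = f n

    -- (e^t - 1) ∑ B_n(x) tⁿ / n! = t e^{xt}
    bernoulli-generatingFunction : ∀ x →
      (e^ 1# ⊖ 1ₛ) ⊛ (λ n → B n x * 1/! n) ≋ X· (e^ x)
    bernoulli-generatingFunction x = λ
      { zero    → trans (+-congʳ (constant≈0 _)) (+-identityˡ _)
      ; (suc n) → begin
          _ ≈⟨ +-cong (constant≈0 _) (sum-cong-≋ {suc n} λ i →
                 *-cong (x-0≈x ((e^ 1#) (suc (toℕ i)))) (B/n! (n ∸ toℕ i))) ⟩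
          0# + ((λ n → (e^ 1#) (suc n)) ⊛ bernoulliSeries x) n
            ≈⟨ +-identityˡ _ ⟩
          ((λ n → (e^ 1#) (suc n)) ⊛ bernoulliSeries x) n
            ≈⟨ ⊘-correct (e^ x) (λ n → (e^ 1#) (suc n)) e₁≈1 n ⟩
          (e^ x) n ∎
      }
      where
      e₁≈1 : (e^ 1#) 1 ≈ 1#
      e₁≈1 = trans (*-cong (1^n≈1 1) 1/0!≈1) (*-identityˡ _)

      constant≈0 : ∀ y → ((e^ 1#) 0 - 1#) * y ≈ 0#
      constant≈0 y = begin
        ((e^ 1#) 0 - 1#) * y
          ≈⟨ *-congʳ (+-congʳ (trans (*-identityˡ _) 1/0!≈1)) ⟩
        (1# - 1#) * y  ≈⟨ *-congʳ (-‿inverseʳ 1#) ⟩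
        0# * y         ≈⟨ zeroˡ y ⟩
        0#             ∎

      B/n! : ∀ n → B n x * 1/! n ≈ bernoulliSeries x n
      B/n! n = begin
        fromℕ (n !) * bernoulliSeries x n * 1/! n
          ≈⟨ *-congʳ (*-comm _ _) ⟩
        bernoulliSeries x n * fromℕ (n !) * 1/! n
          ≈⟨ *-assoc _ _ _ ⟩
        bernoulliSeries x n * (fromℕ (n !) * 1/! n)
          ≈⟨ *-congˡ (fromℕ*1/! n) ⟩
        bernoulliSeries x n * 1#
          ≈⟨ *-identityʳ _ ⟩
        bernoulliSeries x n ∎

-- The base field is any field K of characteristic zero and η any primitive
-- N-th root of unity; the classical objects are those for K = ℂ and
-- η = e^{2πi/N}.  Indices r, s are meant to be ≥ 1.
module DoubleEisenstein
  {c ℓ₁ ℓ₂} (K : HeytingField c ℓ₁ ℓ₂) (char0 : CharacteristicZero K)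
  (N : ℕ) .{{_ : NonZero N}} (η : HeytingField.Carrier K)
  where

  open HeytingField K
  open CommutativeRing (HeytingCommutativeRing.commutativeRing heytingCommutativeRing)
    using (semiring)
  open Algebra.Properties.Semiring.Exp semiring using (_^_)
  open Series K char0 public
  open Residues N public

  -- η^{av}, which depends only on the residue class a as η^N = 1.
  χ : Fin N → ℕ → Carrier
  χ a v = η ^ (toℕ a ℕ.* v)

  sgn : ℕ → Carrier
  sgn n = (- 1#) ^ n

  -- In the q-series below, the coefficient of qⁿ only receives contributions
  -- from summation indices ≤ n, all of which are positive.

  g̃ : ℕ → Fin N → PowerSeries
  g̃ s a n =
    sgn s * (1/ N) ^ s * 1/! (s ∸ 1) *
    (∑₁[ u ≤ n ] ∑₁[ v ≤ n ]
      [ u ℕ.* v ℕ.≟ n ] * (χ a v * fromℕ (v ℕ.^ (s ∸ 1))))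

  g̃₂ : ℕ → ℕ → Fin N → Fin N → PowerSeries
  g̃₂ r s a b n =
    sgn (r ℕ.+ s) * (1/ N) ^ (r ℕ.+ s) * 1/! (r ∸ 1) * 1/! (s ∸ 1) *
    (∑₁[ u₁ ≤ n ] ∑₁[ u₂ ≤ n ] ∑₁[ v₁ ≤ n ] ∑₁[ v₂ ≤ n ]
      [ u₂ ℕ.<? u₁ ×-dec u₁ ℕ.* v₁ ℕ.+ u₂ ℕ.* v₂ ℕ.≟ n ] *
      (χ a v₁ * χ b v₂ * fromℕ (v₁ ℕ.^ (r ∸ 1) ℕ.* v₂ ℕ.^ (s ∸ 1))))

  g̃′ : ℕ → Fin N → PowerSeries
  g̃′ k a n =
    sgn k * (1/ N) ^ suc k * 1/! k *
    (∑₁[ m ≤ n ] ∑₁[ v ≤ n ]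
      [ m ℕ.* v ℕ.≟ n ] * (fromℕ (m ℕ.* v ℕ.^ k) * χ a v))

  f₂ : Fin N → PowerSeries
  f₂ a n =
    (1/ N) ^ 2 *
    (∑₁[ m ≤ n ] ∑₁[ u ≤ n ] [ m ℕ.* u ℕ.≟ n ] * (χ a u * fromℕ m))

  -- χ (-ₙ a) l is exp(-2πi la/N).
  β : ℕ → Fin N → Carrier
  β n a =
    - (1/ 2 * 1/ N * 1/! n *
       (∑₁[ l ≤ N ] χ (-ₙ a) l * B n (fromℕ l * 1/ N)))

  -- The sign (-1)^{i-r} is written (-1)^{i+r}, as i may be less than r.
  β₂ : ℕ → ℕ → Fin N → Fin N → PowerSeries
  β₂ r s a b =
    β s b · g̃ r a ⊕
    ∑₊ (r ℕ.+ s) λ i j →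
      β i (a -ₙ b) ·
        ( (sgn s * fromℕ ((i ∸ 1) C (s ∸ 1))) · g̃ j a
        ⊕ (sgn (i ℕ.+ r) * fromℕ ((i ∸ 1) C (r ∸ 1))) · g̃ j b )

  E₁ : ℕ → Fin N → PowerSeries
  E₁ k a = [ 2 ℕ.<? k ] · g̃ k a

  module _ (γ : Fin N → Fin N → PowerSeries) where

    ε : ℕ → ℕ → Fin N → Fin N → PowerSeries
    ε r s a b =
      [ r ℕ.≟ 2 ] · g̃′ s b
      ⊖ [ r ℕ.≟ 1 ] · g̃′ (s ∸ 1) b
      ⊕ [ s ℕ.≟ 1 ] · (g̃′ (r ∸ 1) a ⊕ g̃ r a)
      ⊕ (fromℕ N * [ r ℕ.≟ 1 ] * [ s ℕ.≟ 1 ]) · γ a b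

    E₂ : ℕ → ℕ → Fin N → Fin N → PowerSeries
    E₂ r s a b = g̃₂ r s a b ⊕ β₂ r s a b ⊕ (1/ 2 * 1/ N) · ε r s a b

  module _ (ƛ : Fin N → Fin N → PowerSeries) where

    P : ℕ → ℕ → Fin N → Fin N → PowerSeries
    P r s a b =
      g̃ r a ⊛ g̃ s b ⊕ β r a · g̃ s b ⊕ β s b · g̃ r a
      ⊕ (1/ 2 * 1/ N) · ([ r ℕ.≟ 2 ] · g̃′ s b ⊕ [ s ℕ.≟ 2 ] · g̃′ r a)
      ⊕ ([ r ℕ.≟ 1 ] * [ s ℕ.≟ 1 ]) · ƛ a b

  record IsSuitable (γ ƛ : Fin N → Fin N → PowerSeries) : Set ℓ₁ where
    field
      symmetric : ∀ a b → ƛ a b ≋ ƛ b a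
      diagonal  : ∀ a → γ a a ⊖ ƛ a a ≋ g̃ 2 a
      stuffle   : ∀ a b → a ≢ b → γ a b ⊕ γ b a ⊖ fromℕ 2 · ƛ a b ≋ 0ₛ
      shuffle   : ∀ a b →
        γ (a +ₙ b) a ⊕ γ (a +ₙ b) b ⊖ fromℕ 2 · ƛ a b ≋ f₂ a ⊕ f₂ b

{-# OPTIONS --safe #-}

-- Put r = k + 1, s = l + 1, ν = -1/N and E k v = ν^{k+1} v^k / k!.  Then
-- g̃_r^a and g̃_{r,s}^{a,b} are sums over lattice points of η^{av} E k v and
-- η^{a v₁ + b v₂} E k v₁ E l v₂.
--
-- Splitting the product g̃_r^a g̃_s^b according to u₁ > u₂, u₁ < u₂, u₁ = u₂ gives
-- the stuffle product.  The diagonal involves the sum of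
-- η^{a v₁ + b v₂} E k v₁ E l v₂ over v₁ + v₂ = v.  For l = 0 this is a twisted
-- power sum, evaluated by telescoping ∑ θ^j B_n((j ± v)/N) over j = 1, …, N; the
-- case of general l follows by induction, since multiplying by v = v₁ + v₂ raises
-- k or l by one.  The result is the part of β_{r,s}^{a,b} + β_{s,r}^{b,a} that
-- comes from the classes a - b and b - a.
--
-- Splitting the product according to v₁ > v₂, v₁ < v₂, v₁ = v₂ gives the shuffle
-- product, and the terms with β then match by two alternating binomial sums.
--
-- For γ = ƛ = 0 both relations hold except at r = s = 1, where the defects are
-- the right-hand sides of the linear system.  So the system expresses exactly
-- that the relations hold there, and it is solved by choosing γ such that
-- E_{1,1} = 0.

module Submission where

open import Algebra.Apartness.Bundles using (HeytingCommutativeRing; HeytingField)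
open import Algebra.Bundles using (CommutativeRing)
import Algebra.Properties.CommutativeSemiring.Exp
import Algebra.Properties.Ring
import Algebra.Properties.Semiring.Mult
import Algebra.Properties.Semiring.Mult.TCOptimised
import Algebra.Properties.Semiring.Sum
import Algebra.Solver.Ring
open import Algebra.Solver.Ring.AlmostCommutativeRing
  using (fromCommutativeRing; _-Raw-AlmostCommutative⟶_)
open import Data.Bool.Base using (T)
open import Data.Fin.Base using (Fin; toℕ)
import Data.Fin.Properties as Fin
open import Data.Integer.Base as ℤ using (ℤ; +_; -[1+_])
import Data.Integer.Properties as ℤ
open import Data.Maybe using (map; is-just; to-witness-T)
import Data.Nat.Base as ℕ
open ℕ using (ℕ; zero; suc; _∸_; _!; NonZero)
open import Data.Nat.Combinatorics
  using (_C_; nCk+nC[k+1]≡[n+1]C[k+1]; nCk≡nC[n∸k]; nCn≡1; k>n⇒nCk≡0)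
open import Data.Nat.DivMod using (_%_; _/_; _mod_; m≡m%n+[m/n]*n; m%n<n)
import Data.Nat.Properties as ℕ
import Data.Nat.Solver
open import Data.Product.Base using (proj₁; proj₂; _,_)
import Data.Sign.Base as Sign
open import Data.Sum.Base using (inj₁; inj₂)
import Data.Vec.Base as Vec
open import Data.Vec.N-ary using (N-ary; _$ⁿ_; curryⁿ; curryⁿ-cong; Eq)
open import Function.Base using (_∘_; flip)
open import Relation.Binary.Definitions using (tri<; tri≈; tri>)
open import Relation.Binary.PropositionalEquality.Core as ≡ using (_≡_; _≢_)
import Relation.Binary.Reasoning.Setoid as SetoidReasoning
open import Relation.Nullary.Decidable.Core using (Dec; yes; no; _×-dec_; dec⇒maybe)
open import Relation.Nullary.Negation using (¬_; contradiction)

open import Defs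

-- The factor 1/2 in β and the terms with 1/(2N) have one origin. Telescoping a twisted power sum
-- leaves an extra endpoint. It is therefore done twice, at -v/N with the inverse root and at v/N
-- with the root itself; the extra endpoints differ, and in the average each has weight one half.
-- The two runs bring in β for the classes a - b and b - a, which β_{r,s}^{a,b} and β_{s,r}^{b,a}
-- supply. The symbol δ_{a,b} comes from B_0 = 1: in degree zero the twisted sum is a geometric sum
-- of N-th roots of unity.
--
-- Identities between powers over factorials, binomials and convolutions are proved by letting both
-- sides satisfy the same first-order recursion and cancelling a positive integer. Equality in K
-- cannot be decided, so every scalar that is cancelled comes with an inverse: a positive integer, a
-- power of η, or η^d - 1 with 0 < d < N. Sums over i + j = m are taken over antidiagonals, which
-- supplies i + j = m as an equation and keeps truncated subtraction out of the algebra.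

module IntegerRingSolver {c ℓ} (R : CommutativeRing c ℓ) where
  open CommutativeRing R
  open import Data.Product.Base using (_×_)
  open Algebra.Properties.Ring ring
  open Algebra.Properties.Semiring.Mult.TCOptimised semiring using (×-homo-+; ×1-homo-*)
    renaming (_×_ to _·_)
  open SetoidReasoning setoid

  private
    ⟦_⟧ : ℤ → Carrier
    ⟦ + n ⟧      = n · 1#
    ⟦ -[1+ n ] ⟧ = - (suc n · 1#)

    suc-· : ∀ n → suc n · 1# ≈ 1# + n · 1#
    suc-· n = ×-homo-+ 1# 1 n

    x+y-x≈y : ∀ x y → x + y - x ≈ y
    x+y-x≈y x y = trans (+-congʳ (+-comm x y)) (trans (+-assoc y x (- x))
      (trans (+-congˡ (-‿inverseʳ x)) (+-identityʳ y)))

    ⊖-homo : ∀ m n → ⟦ m ℤ.⊖ n ⟧ ≈ m · 1# - n · 1#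
    ⊖-homo zero    zero    = sym (-‿inverseʳ 0#)
    ⊖-homo zero    (suc n) = sym (+-identityˡ _)
    ⊖-homo (suc m) zero    = sym (trans (+-congˡ -0#≈0#) (+-identityʳ _))
    ⊖-homo (suc m) (suc n) = begin
      ⟦ suc m ℤ.⊖ suc n ⟧ ≡⟨ ≡.cong ⟦_⟧ (ℤ.[1+m]⊖[1+n]≡m⊖n m n) ⟩
      ⟦ m ℤ.⊖ n ⟧         ≈⟨ ⊖-homo m n ⟩
      m · 1# - n · 1#
        ≈⟨ +-congʳ (x+y-x≈y 1# (m · 1#)) ⟨
      1# + m · 1# - 1# - n · 1#
        ≈⟨ +-assoc _ _ _ ⟩
      1# + m · 1# + (- 1# - n · 1#)
        ≈⟨ +-congˡ (-‿+-comm 1# (n · 1#)) ⟩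
      1# + m · 1# - (1# + n · 1#)
        ≈⟨ +-cong (suc-· m) (-‿cong (suc-· n)) ⟨
      suc m · 1# - suc n · 1# ∎

    +-homo : ∀ i j → ⟦ i ℤ.+ j ⟧ ≈ ⟦ i ⟧ + ⟦ j ⟧
    +-homo (+ m)      (+ n)      = ×-homo-+ 1# m n
    +-homo (+ m)      -[1+ n ]   = ⊖-homo m (suc n)
    +-homo -[1+ m ]   (+ n)      = trans (⊖-homo n (suc m)) (+-comm _ _)
    +-homo -[1+ m ]   -[1+ n ]   = begin
      - (suc (suc (m ℕ.+ n)) · 1#)
        ≡⟨ ≡.cong (λ k → - (suc k · 1#)) (≡.sym (ℕ.+-suc m n)) ⟩
      - ((suc m ℕ.+ suc n) · 1#)       ≈⟨ -‿cong (×-homo-+ 1# (suc m) (suc n)) ⟩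
      - (suc m · 1# + suc n · 1#)      ≈⟨ -‿+-comm _ _ ⟨
      - (suc m · 1#) - suc n · 1#      ∎

    -‿homo : ∀ i → ⟦ ℤ.- i ⟧ ≈ - ⟦ i ⟧
    -‿homo (+ zero)  = sym -0#≈0#
    -‿homo (+ suc n) = refl
    -‿homo -[1+ n ]  = sym (-‿involutive _)

    *-homo : ∀ i j → ⟦ i ℤ.* j ⟧ ≈ ⟦ i ⟧ * ⟦ j ⟧
    *-homo (+ m)    (+ n)    = trans (reflexive (≡.cong ⟦_⟧ (ℤ.+◃n≡+n (m ℕ.* n)))) (×1-homo-* m n)
    *-homo (+ m)    -[1+ n ] = begin
      ⟦ Sign.- ℤ.◃ m ℕ.* suc n ⟧ ≡⟨ ≡.cong ⟦_⟧ (ℤ.-◃n≡-n (m ℕ.* suc n)) ⟩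
      ⟦ ℤ.- (+ (m ℕ.* suc n)) ⟧  ≈⟨ -‿homo (+ (m ℕ.* suc n)) ⟩
      - ((m ℕ.* suc n) · 1#)     ≈⟨ -‿cong (×1-homo-* m (suc n)) ⟩
      - (m · 1# * (suc n · 1#))  ≈⟨ -‿distribʳ-* _ _ ⟩
      m · 1# * - (suc n · 1#)    ∎
    *-homo -[1+ m ] (+ n)    = begin
      ⟦ Sign.- ℤ.◃ suc m ℕ.* n ⟧ ≡⟨ ≡.cong ⟦_⟧ (ℤ.-◃n≡-n (suc m ℕ.* n)) ⟩
      ⟦ ℤ.- (+ (suc m ℕ.* n)) ⟧  ≈⟨ -‿homo (+ (suc m ℕ.* n)) ⟩
      - ((suc m ℕ.* n) · 1#)     ≈⟨ -‿cong (×1-homo-* (suc m) n) ⟩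
      - (suc m · 1# * (n · 1#))  ≈⟨ -‿distribˡ-* _ _ ⟩
      - (suc m · 1#) * (n · 1#)  ∎
    *-homo -[1+ m ] -[1+ n ] = begin
      (suc m ℕ.* suc n) · 1#         ≈⟨ ×1-homo-* (suc m) (suc n) ⟩
      suc m · 1# * (suc n · 1#)      ≈⟨ -‿involutive _ ⟨
      - - (suc m · 1# * (suc n · 1#)) ≈⟨ -‿cong (-‿distribˡ-* _ _) ⟩
      - (- (suc m · 1#) * (suc n · 1#)) ≈⟨ -‿distribʳ-* _ _ ⟩
      - (suc m · 1#) * - (suc n · 1#) ∎

    morphism : ℤ.+-*-rawRing -Raw-AlmostCommutative⟶ fromCommutativeRing R
    morphism = record
      { ⟦_⟧ = ⟦_⟧ ; +-homo = +-homo ; *-homo = *-homo ; -‿homo = -‿homo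
      ; 0-homo = refl ; 1-homo = refl }

  private
    module Solver = Algebra.Solver.Ring ℤ.+-*-rawRing (fromCommutativeRing R) morphism
      (λ i j → map (λ i≡j → reflexive (≡.cong ⟦_⟧ i≡j)) (dec⇒maybe (i ℤ.≟ j)))

  open Solver public using (Polynomial; _:+_; _:*_; _:-_; :-_; _:=_)

  private
    close : ∀ n → N-ary n (Polynomial n) (Polynomial n × Polynomial n) → Polynomial n × Polynomial n
    close n f = f $ⁿ Vec.map Solver.var (Vec.allFin n)

  -- Unlike the solver of the standard library, this one compares normal forms
  -- by evaluating a decision procedure, which avoids unfolding their values.
  solve : ∀ n (f : N-ary n (Polynomial n) (Polynomial n × Polynomial n)) →
    let p = proj₁ (close n f); q = proj₂ (close n f) in
    {_ : T (is-just (Solver.normalise p Solver.≟N Solver.normalise q))} →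
    Eq n _≈_ (curryⁿ (Solver.⟦_⟧ p)) (curryⁿ (Solver.⟦_⟧ q))
  solve n f {equal} = curryⁿ-cong _≈_ (Solver.⟦_⟧ p) (Solver.⟦_⟧ q) λ ρ →
    Solver.prove ρ p q (Solver.⟦_⟧N-cong (to-witness-T (Solver.normalise p Solver.≟N Solver.normalise q) equal) ρ)
    where
    p = proj₁ (close n f)
    q = proj₂ (close n f)

  :0 :1 : ∀ {n} → Polynomial n
  :0 = Solver.con (+ 0)
  :1 = Solver.con (+ 1)

module SeriesCalculus {c ℓ₁ ℓ₂} (K : HeytingField c ℓ₁ ℓ₂) (char0 : CharacteristicZero K) where
  R : CommutativeRing c ℓ₁
  R = HeytingCommutativeRing.commutativeRing (HeytingField.heytingCommutativeRing K)

  open CommutativeRing R public hiding (zero)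
  open Series K char0 public hiding (∑₁-syntax)
  open Algebra.Properties.CommutativeSemiring.Exp commutativeSemiring public
  open Algebra.Properties.Semiring.Mult semiring public using (×-homo-+; ×1-homo-*)
  open Algebra.Properties.Ring ring public
    using (-0#≈0#; -‿distribˡ-*; -‿distribʳ-*; -‿+-comm; -‿involutive; +-cancelʳ; +-cancelˡ; -1*x≈-x)
  open IntegerRingSolver R public
  open SetoidReasoning setoid public

  -- Finite sums

  open Algebra.Properties.Semiring.Sum semiring
    using (sum; sum-cong-≋; ∑-distrib-+; ∑-comm; *-distribˡ-sum)

  []-yes : ∀ {p} {P : Set p} (d : Dec P) → P → [ d ] ≈ 1#
  []-yes (yes _) _ = refl
  []-yes (no ¬p) p = contradiction p ¬p

  []-no : ∀ {p} {P : Set p} (d : Dec P) → ¬ P → [ d ] ≈ 0#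
  []-no (yes p) ¬p = contradiction p ¬p
  []-no (no _)  _  = refl

  []-cong : ∀ {p q} {P : Set p} {Q : Set q} (d : Dec P) (e : Dec Q) →
    (P → Q) → (Q → P) → [ d ] ≈ [ e ]
  []-cong (yes p) e f g = sym ([]-yes e (f p))
  []-cong (no ¬p) e f g = sym ([]-no e (¬p ∘ g))

  []*-cong : ∀ {p} {P : Set p} (d : Dec P) {x y} → (P → x ≈ y) → [ d ] * x ≈ [ d ] * y
  []*-cong (yes p) f = *-congˡ (f p)
  []*-cong (no _)  f = trans (zeroˡ _) (sym (zeroˡ _))

  no*≈0 : ∀ {p} {P : Set p} (d : Dec P) {x} → ¬ P → [ d ] * x ≈ 0#
  no*≈0 d ¬p = trans (*-congʳ ([]-no d ¬p)) (zeroˡ _)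

  yes*≈ : ∀ {p} {P : Set p} (d : Dec P) {x} → P → [ d ] * x ≈ x
  yes*≈ d p = trans (*-congʳ ([]-yes d p)) (*-identityˡ _)

  -- The sums are opaque so that summands can be inferred by unification.
  -- ∑[ i ≤ n ] runs over 1, …, n, and ∑∇ m G is the sum of G i j over i + j = m.
  infixl 5 ∑-syntax
  opaque
    ∑-syntax : ℕ → (ℕ → Carrier) → Carrier
    ∑-syntax = Series.∑₁-syntax K char0

    ∑∇ : ℕ → (ℕ → ℕ → Carrier) → Carrier
    ∑∇ m G = sum {suc m} (λ i → G (toℕ i) (m ∸ toℕ i))

  syntax ∑-syntax n (λ i → x) = ∑[ i ≤ n ] x

  opaque
    unfolding ∑-syntax ∑∇

    ∑-empty : ∀ (f : ℕ → Carrier) → ∑[ i ≤ 0 ] f i ≈ 0#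
    ∑-empty f = refl

    ∑-head : ∀ n (f : ℕ → Carrier) → ∑[ i ≤ suc n ] f i ≈ f 1 + (∑[ i ≤ n ] f (suc i))
    ∑-head n f = refl

    -- Summands are only ever evaluated at positive indices, which are
    -- written suc i.
    ∑-cong< : ∀ n {f g : ℕ → Carrier} → (∀ i → i ℕ.< n → f (suc i) ≈ g (suc i)) →
      ∑[ i ≤ n ] f i ≈ ∑[ i ≤ n ] g i
    ∑-cong< n h = sum-cong-≋ {n} λ i → h (toℕ i) (Fin.toℕ<n i)

    ∑-+ : ∀ n (f g : ℕ → Carrier) → ∑[ i ≤ n ] (f i + g i) ≈ (∑[ i ≤ n ] f i) + (∑[ i ≤ n ] g i)
    ∑-+ n f g = ∑-distrib-+ {n} (λ i → f (suc (toℕ i))) (λ i → g (suc (toℕ i)))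

    ∑-*ˡ : ∀ n x (f : ℕ → Carrier) → x * (∑[ i ≤ n ] f i) ≈ ∑[ i ≤ n ] x * f i
    ∑-*ˡ n x f = *-distribˡ-sum {n} x (λ i → f (suc (toℕ i)))

    ∑-swap : ∀ m n (F : ℕ → ℕ → Carrier) →
      ∑[ i ≤ m ] ∑[ j ≤ n ] F i j ≈ ∑[ j ≤ n ] ∑[ i ≤ m ] F i j
    ∑-swap m n F = ∑-comm {m} {n} λ i j → F (suc (toℕ i)) (suc (toℕ j))

    ∑∇-zero : ∀ (G : ℕ → ℕ → Carrier) → ∑∇ 0 G ≈ G 0 0
    ∑∇-zero G = +-identityʳ _

    ∑∇-head : ∀ m (G : ℕ → ℕ → Carrier) → ∑∇ (suc m) G ≈ G 0 (suc m) + ∑∇ m (λ i j → G (suc i) j)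
    ∑∇-head m G = refl

    ∑∇-cong : ∀ m {G H : ℕ → ℕ → Carrier} → (∀ i j → i ℕ.+ j ≡ m → G i j ≈ H i j) → ∑∇ m G ≈ ∑∇ m H
    ∑∇-cong m h = sum-cong-≋ {suc m} λ i →
      h (toℕ i) (m ∸ toℕ i) (ℕ.m+[n∸m]≡n (ℕ.s≤s⁻¹ (Fin.toℕ<n i)))

    ∑∇-+ : ∀ m (G H : ℕ → ℕ → Carrier) → ∑∇ m (λ i j → G i j + H i j) ≈ ∑∇ m G + ∑∇ m H
    ∑∇-+ m G H = ∑-distrib-+ {suc m} (λ i → G (toℕ i) (m ∸ toℕ i)) (λ i → H (toℕ i) (m ∸ toℕ i))

    ∑∇-*ˡ : ∀ m x (G : ℕ → ℕ → Carrier) → x * ∑∇ m G ≈ ∑∇ m (λ i j → x * G i j)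
    ∑∇-*ˡ m x G = *-distribˡ-sum {suc m} x (λ i → G (toℕ i) (m ∸ toℕ i))

    ∑∇-swap : ∀ m n (F : ℕ → ℕ → ℕ → ℕ → Carrier) →
      ∑∇ m (λ i j → ∑∇ n (λ h t → F i j h t)) ≈ ∑∇ n (λ h t → ∑∇ m (λ i j → F i j h t))
    ∑∇-swap m n F = ∑-comm {suc m} {suc n} λ i j → F (toℕ i) (m ∸ toℕ i) (toℕ j) (n ∸ toℕ j)

    ∑-∑∇-swap : ∀ n m (F : ℕ → ℕ → ℕ → Carrier) →
      ∑[ v ≤ n ] ∑∇ m (λ i j → F v i j) ≈ ∑∇ m (λ i j → ∑[ v ≤ n ] F v i j)
    ∑-∑∇-swap n m F = ∑-comm {n} {suc m} λ v i → F (suc (toℕ v)) (toℕ i) (m ∸ toℕ i)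

    ⊛≈∑∇ : ∀ f g n → (f ⊛ g) n ≈ ∑∇ n (λ i j → f i * g j)
    ⊛≈∑∇ f g n = refl

    -- Both indices drop by one, so the weight r + s becomes the degree k + l and the binomials
    -- `(i ∸ 1) C (r ∸ 1)` become `i C k`.
    ∑₊≈∑∇ : ∀ k l F n → ∑₊ (suc k ℕ.+ suc l) F n ≈ ∑∇ (k ℕ.+ l) (λ i j → F (suc i) (suc j) n)
    ∑₊≈∑∇ k l F n rewrite ℕ.+-suc k l = sum-cong-≋ {suc (k ℕ.+ l)} λ i →
      reflexive (≡.cong (λ j → F (suc (toℕ i)) j n) (ℕ.+-∸-assoc 1 (ℕ.s≤s⁻¹ (Fin.toℕ<n i))))

  ∑-cong : ∀ n {f g : ℕ → Carrier} → (∀ i → f (suc i) ≈ g (suc i)) →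
    ∑[ i ≤ n ] f i ≈ ∑[ i ≤ n ] g i
  ∑-cong n h = ∑-cong< n λ i _ → h i

  ∑-*ʳ : ∀ n (f : ℕ → Carrier) x → (∑[ i ≤ n ] f i) * x ≈ ∑[ i ≤ n ] f i * x
  ∑-*ʳ n f x = trans (*-comm _ _) (trans (∑-*ˡ n x f) (∑-cong n λ _ → *-comm _ _))

  ∑-0 : ∀ n {f : ℕ → Carrier} → (∀ i → i ℕ.< n → f (suc i) ≈ 0#) → ∑[ i ≤ n ] f i ≈ 0#
  ∑-0 n h = trans (∑-cong< n λ i i<n → trans (h i i<n) (sym (zeroˡ 0#)))
    (trans (sym (∑-*ˡ n 0# (λ _ → 0#))) (zeroˡ _))

  ∑-const : ∀ n x → ∑[ i ≤ n ] x ≈ fromℕ n * x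
  ∑-const zero    x = trans (∑-empty _) (sym (zeroˡ x))
  ∑-const (suc n) x = begin
    ∑[ i ≤ suc n ] x      ≈⟨ ∑-head n _ ⟩
    x + (∑[ i ≤ n ] x)    ≈⟨ +-cong (sym (*-identityˡ x)) (∑-const n x) ⟩
    1# * x + fromℕ n * x  ≈⟨ distribʳ x 1# (fromℕ n) ⟨
    fromℕ (suc n) * x     ∎

  ∑-split : ∀ m n (f : ℕ → Carrier) →
    ∑[ i ≤ m ℕ.+ n ] f i ≈ (∑[ i ≤ m ] f i) + (∑[ i ≤ n ] f (m ℕ.+ i))
  ∑-split zero    n f = sym (trans (+-congʳ (∑-empty _)) (+-identityˡ _))
  ∑-split (suc m) n f = begin
    ∑[ i ≤ suc (m ℕ.+ n) ] f i
      ≈⟨ ∑-head _ f ⟩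
    f 1 + (∑[ i ≤ m ℕ.+ n ] f (suc i))
      ≈⟨ +-congˡ (∑-split m n (f ∘ suc)) ⟩
    f 1 + ((∑[ i ≤ m ] f (suc i)) + (∑[ i ≤ n ] f (suc m ℕ.+ i)))
      ≈⟨ +-assoc _ _ _ ⟨
    f 1 + (∑[ i ≤ m ] f (suc i)) + (∑[ i ≤ n ] f (suc m ℕ.+ i))
      ≈⟨ +-congʳ (∑-head m f) ⟨
    (∑[ i ≤ suc m ] f i) + (∑[ i ≤ n ] f (suc m ℕ.+ i)) ∎

  ∑-last : ∀ n (f : ℕ → Carrier) → ∑[ i ≤ suc n ] f i ≈ (∑[ i ≤ n ] f i) + f (suc n)
  ∑-last n f = begin
    ∑[ i ≤ suc n ] f i
      ≡⟨ ≡.cong (λ k → ∑[ i ≤ k ] f i) (ℕ.+-comm 1 n) ⟩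
    ∑[ i ≤ n ℕ.+ 1 ] f i
      ≈⟨ ∑-split n 1 f ⟩
    (∑[ i ≤ n ] f i) + (∑[ i ≤ 1 ] f (n ℕ.+ i))
      ≈⟨ +-congˡ (trans (∑-const′ (λ i → f (n ℕ.+ i))) (reflexive (≡.cong f (ℕ.+-comm n 1)))) ⟩
    (∑[ i ≤ n ] f i) + f (suc n) ∎
    where
    ∑-const′ : ∀ (g : ℕ → Carrier) → ∑[ i ≤ 1 ] g i ≈ g 1
    ∑-const′ g = trans (∑-head 0 g) (trans (+-congˡ (∑-empty _)) (+-identityʳ _))

  ∑-extend : ∀ {m n} (f : ℕ → Carrier) → m ℕ.≤ n → (∀ i → m ℕ.≤ i → f (suc i) ≈ 0#) →
    ∑[ i ≤ m ] f i ≈ ∑[ i ≤ n ] f i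
  ∑-extend {m} {n} f m≤n h = begin
    ∑[ i ≤ m ] f i
      ≈⟨ +-identityʳ _ ⟨
    (∑[ i ≤ m ] f i) + 0#
      ≈⟨ +-congˡ (∑-0 (n ∸ m) λ i _ →
           trans (reflexive (≡.cong f (ℕ.+-suc m i))) (h (m ℕ.+ i) (ℕ.m≤m+n m i))) ⟨
    (∑[ i ≤ m ] f i) + (∑[ i ≤ n ∸ m ] f (m ℕ.+ i))
      ≈⟨ ∑-split m (n ∸ m) f ⟨
    ∑[ i ≤ m ℕ.+ (n ∸ m) ] f i
      ≡⟨ ≡.cong (λ k → ∑[ i ≤ k ] f i) (ℕ.m+[n∸m]≡n m≤n) ⟩
    ∑[ i ≤ n ] f i ∎

  -- An inequality between two summation indices becomes the substitution i = k + i′. The range may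
  -- stay n on both sides because φ vanishes beyond n.
  ∑-shift : ∀ k n (φ : ℕ → Carrier) → (∀ i → n ℕ.≤ i → φ (suc i) ≈ 0#) →
    ∑[ i ≤ n ] [ k ℕ.<? i ] * φ i ≈ ∑[ i ≤ n ] φ (k ℕ.+ i)
  ∑-shift k n φ h = begin
    ∑[ i ≤ n ] F i
      ≈⟨ ∑-extend F (ℕ.m≤n+m n k) (λ i n≤i → trans (*-congˡ (h i n≤i)) (zeroʳ _)) ⟩
    ∑[ i ≤ k ℕ.+ n ] F i
      ≈⟨ ∑-split k n F ⟩
    (∑[ i ≤ k ] F i) + (∑[ i ≤ n ] F (k ℕ.+ i))
      ≈⟨ +-cong (∑-0 k λ i i<k → no*≈0 (k ℕ.<? suc i) (ℕ.≤⇒≯ i<k))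
                (∑-cong n λ i → yes*≈ (k ℕ.<? k ℕ.+ suc i) (ℕ.m<m+n k (ℕ.s≤s ℕ.z≤n))) ⟩
    0# + (∑[ i ≤ n ] φ (k ℕ.+ i))
      ≈⟨ +-identityˡ _ ⟩
    ∑[ i ≤ n ] φ (k ℕ.+ i) ∎
    where
    F : ℕ → Carrier
    F i = [ k ℕ.<? i ] * φ i

  ∑-point : ∀ n k (φ : ℕ → Carrier) → k ℕ.< n → ∑[ i ≤ n ] [ suc k ℕ.≟ i ] * φ i ≈ φ (suc k)
  ∑-point (suc n) zero    φ _ = begin
    ∑[ i ≤ suc n ] [ 1 ℕ.≟ i ] * φ i
      ≈⟨ ∑-head n _ ⟩
    1# * φ 1 + (∑[ i ≤ n ] [ 1 ℕ.≟ suc i ] * φ (suc i))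
      ≈⟨ +-cong (*-identityˡ _) (∑-0 n λ i _ → no*≈0 (1 ℕ.≟ suc (suc i)) λ ()) ⟩
    φ 1 + 0#  ≈⟨ +-identityʳ _ ⟩
    φ 1       ∎
  ∑-point (suc n) (suc k) φ (ℕ.s≤s k<n) = begin
    ∑[ i ≤ suc n ] [ suc (suc k) ℕ.≟ i ] * φ i
      ≈⟨ ∑-head n _ ⟩
    0# * φ 1 + (∑[ i ≤ n ] [ suc k ℕ.≟ i ] * φ (suc i))
      ≈⟨ +-cong (zeroˡ _) (∑-point n k (φ ∘ suc) k<n) ⟩
    0# + φ (suc (suc k))  ≈⟨ +-identityˡ _ ⟩
    φ (suc (suc k))       ∎

  -- For fixed i, passing from j to m = i + j is a shift, which `∑-shift` turns into the constraint
  -- i < m; the sums are then exchanged and the inner one cut at m.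
  ∑-antidiagonals : ∀ n (ψ : ℕ → ℕ → Carrier) →
    (∀ i j → n ℕ.< suc i ℕ.+ suc j → ψ (suc i) (suc j) ≈ 0#) →
    ∑[ i ≤ n ] ∑[ j ≤ n ] ψ i j ≈ ∑[ m ≤ n ] ∑[ i ≤ m ∸ 1 ] ψ i (m ∸ i)
  ∑-antidiagonals n ψ h = begin
    ∑[ i ≤ n ] ∑[ j ≤ n ] ψ i j
      ≈⟨ ∑-cong n (λ i → ∑-cong n λ j →
           reflexive (≡.cong (ψ (suc i)) (≡.sym (ℕ.m+n∸m≡n (suc i) (suc j))))) ⟩
    ∑[ i ≤ n ] ∑[ j ≤ n ] ψ i (i ℕ.+ j ∸ i)
      ≈⟨ ∑-cong< n (λ i i<n → ∑-shift (suc i) n (λ m → ψ (suc i) (m ∸ suc i)) (vanish i i<n)) ⟨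
    ∑[ i ≤ n ] ∑[ m ≤ n ] [ i ℕ.<? m ] * ψ i (m ∸ i)
      ≈⟨ ∑-swap n n (λ i m → [ i ℕ.<? m ] * ψ i (m ∸ i)) ⟩
    ∑[ m ≤ n ] ∑[ i ≤ n ] [ i ℕ.<? m ] * ψ i (m ∸ i)
      ≈⟨ ∑-cong< n (λ m m<n → begin
           ∑[ i ≤ n ] [ i ℕ.<? suc m ] * ψ i (suc m ∸ i)
             ≈⟨ ∑-extend _ (ℕ.<⇒≤ m<n) (λ i m≤i → no*≈0 (suc i ℕ.<? suc m) (ℕ.≤⇒≯ (ℕ.s≤s m≤i))) ⟨
           ∑[ i ≤ m ] [ i ℕ.<? suc m ] * ψ i (suc m ∸ i)
             ≈⟨ ∑-cong< m (λ i i<m → yes*≈ (suc i ℕ.<? suc m) (ℕ.s≤s i<m)) ⟩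
           ∑[ i ≤ m ] ψ i (suc m ∸ i) ∎) ⟩
    ∑[ m ≤ n ] ∑[ i ≤ m ∸ 1 ] ψ i (m ∸ i) ∎
    where
    vanish : ∀ i → i ℕ.< n → ∀ m → n ℕ.≤ m → ψ (suc i) (m ∸ i) ≈ 0#
    -- Since i < n ≤ m, abstracting `m ∸ i` together with its equation and its positivity exposes it
    -- as a successor, the only form of index covered by `h`.
    vanish i i<n m n≤m with m ∸ i | ℕ.m+[n∸m]≡n (ℕ.<⇒≤ i<m) | ℕ.m<n⇒0<n∸m i<m
      where i<m = ℕ.<-≤-trans i<n n≤m
    ... | suc j | ≡.refl | _ = h i j (ℕ.s≤s n≤m)

  ∑∇-*ʳ : ∀ m (G : ℕ → ℕ → Carrier) x → ∑∇ m G * x ≈ ∑∇ m (λ i j → G i j * x)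
  ∑∇-*ʳ m G x = trans (*-comm _ _) (trans (∑∇-*ˡ m x G) (∑∇-cong m λ _ _ _ → *-comm _ _))

  ∑∇-0 : ∀ m {G : ℕ → ℕ → Carrier} → (∀ i j → i ℕ.+ j ≡ m → G i j ≈ 0#) → ∑∇ m G ≈ 0#
  ∑∇-0 m h = trans (∑∇-cong m λ i j e → trans (h i j e) (sym (zeroˡ 0#)))
    (trans (sym (∑∇-*ˡ m 0# (λ _ _ → 0#))) (zeroˡ _))

  ∑∇-last : ∀ m (G : ℕ → ℕ → Carrier) → ∑∇ (suc m) G ≈ ∑∇ m (λ i j → G i (suc j)) + G (suc m) 0
  ∑∇-last zero    G = trans (∑∇-head 0 G) (+-cong (sym (∑∇-zero _)) (∑∇-zero _))
  ∑∇-last (suc m) G = begin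
    ∑∇ (suc (suc m)) G
      ≈⟨ ∑∇-head (suc m) G ⟩
    G 0 (suc (suc m)) + ∑∇ (suc m) (G ∘ suc)
      ≈⟨ +-congˡ (∑∇-last m (G ∘ suc)) ⟩
    G 0 (suc (suc m)) + (∑∇ m (λ i j → G (suc i) (suc j)) + G (suc (suc m)) 0)
      ≈⟨ +-assoc _ _ _ ⟨
    G 0 (suc (suc m)) + ∑∇ m (λ i j → G (suc i) (suc j)) + G (suc (suc m)) 0
      ≈⟨ +-congʳ (∑∇-head m (λ i j → G i (suc j))) ⟨
    ∑∇ (suc m) (λ i j → G i (suc j)) + G (suc (suc m)) 0 ∎

  ∑∇-flip : ∀ m (G : ℕ → ℕ → Carrier) → ∑∇ m G ≈ ∑∇ m (λ i j → G j i)
  ∑∇-flip zero    G = trans (∑∇-zero G) (sym (∑∇-zero _))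
  ∑∇-flip (suc m) G = begin
    ∑∇ (suc m) G                                 ≈⟨ ∑∇-head m G ⟩
    G 0 (suc m) + ∑∇ m (G ∘ suc)                 ≈⟨ +-comm _ _ ⟩
    ∑∇ m (G ∘ suc) + G 0 (suc m)                 ≈⟨ +-congʳ (∑∇-flip m (G ∘ suc)) ⟩
    ∑∇ m (λ i j → G (suc j) i) + G 0 (suc m)     ≈⟨ ∑∇-last m (λ i j → G j i) ⟨
    ∑∇ (suc m) (λ i j → G j i)                   ∎

  -- Exponential series and Bernoulli polynomials

  fromℕ-+ : ∀ m n → fromℕ (m ℕ.+ n) ≈ fromℕ m + fromℕ n
  fromℕ-+ = ×-homo-+ 1#

  fromℕ-* : ∀ m n → fromℕ (m ℕ.* n) ≈ fromℕ m * fromℕ n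
  fromℕ-* = ×1-homo-*

  fromℕ-^ : ∀ m k → fromℕ (m ℕ.^ k) ≈ fromℕ m ^ k
  fromℕ-^ m zero    = +-identityʳ 1#
  fromℕ-^ m (suc k) = trans (fromℕ-* m (m ℕ.^ k)) (*-congˡ (fromℕ-^ m k))

  -- Cancellation by a given inverse: from apartness the field provides inverses, and nothing is
  -- decided about being zero.
  *-cancelˡ-unit : ∀ {u u⁻¹ x y} → u * u⁻¹ ≈ 1# → u * x ≈ u * y → x ≈ y
  *-cancelˡ-unit {u} {u⁻¹} {x} {y} uu⁻¹≈1 ux≈uy = begin
    x              ≈⟨ *-identityˡ x ⟨
    1# * x         ≈⟨ *-congʳ uu⁻¹≈1 ⟨
    u * u⁻¹ * x    ≈⟨ solve 3 (λ u v x → u :* v :* x := v :* (u :* x)) u u⁻¹ x ⟩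
    u⁻¹ * (u * x)  ≈⟨ *-congˡ ux≈uy ⟩
    u⁻¹ * (u * y)  ≈⟨ solve 3 (λ u v x → u :* v :* x := v :* (u :* x)) u u⁻¹ y ⟨
    u * u⁻¹ * y    ≈⟨ *-congʳ uu⁻¹≈1 ⟩
    1# * y         ≈⟨ *-identityˡ y ⟩
    y              ∎

  fromℕ-cancelˡ : ∀ n {x y} → fromℕ (suc n) * x ≈ fromℕ (suc n) * y → x ≈ y
  fromℕ-cancelˡ n = *-cancelˡ-unit (fromℕ*1/ (suc n))

  suc*1/!suc : ∀ n → fromℕ (suc n) * 1/! suc n ≈ 1/! n
  suc*1/!suc n = *-cancelˡ-unit (fromℕ*1/! n) (begin
    fromℕ (n !) * (fromℕ (suc n) * 1/! suc n)
      ≈⟨ solve 3 (λ x y z → x :* (y :* z) := y :* x :* z) _ _ _ ⟩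
    fromℕ (suc n) * fromℕ (n !) * 1/! suc n
      ≈⟨ *-congʳ (fromℕ-* (suc n) (n !)) ⟨
    fromℕ (suc n !) * 1/! suc n
      ≈⟨ fromℕ*1/! (suc n) ⟩
    1#
      ≈⟨ fromℕ*1/! n ⟨
    fromℕ (n !) * 1/! n ∎)

  e-zero : ∀ x → (e^ x) 0 ≈ 1#
  e-zero x = trans (*-identityˡ _) 1/0!≈1

  -- The differential equation of e^{xt} in degree n. Later inductions on the degree use it in place
  -- of factorials.
  e-suc : ∀ x n → fromℕ (suc n) * (e^ x) (suc n) ≈ x * (e^ x) n
  e-suc x n = trans
    (solve 4 (λ n x y z → n :* (x :* y :* z) := x :* (y :* (n :* z))) _ x (x ^ n) _)
    (*-congˡ (*-congˡ (suc*1/!suc n)))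

  e-cong : ∀ {x y} n → x ≈ y → (e^ x) n ≈ (e^ y) n
  e-cong n x≈y = *-congʳ (^-congˡ n x≈y)

  e-scale : ∀ x y n → (e^ (x * y)) n ≈ x ^ n * (e^ y) n
  e-scale x y n = trans (*-congʳ (^-distrib-* x y n)) (*-assoc _ _ _)

  e-0-suc : ∀ {x} n → x ≈ 0# → (e^ x) (suc n) ≈ 0#
  e-0-suc n x≈0 = trans (*-congʳ (trans (*-congʳ x≈0) (zeroˡ _))) (zeroˡ _)

  -- Induction on the degree: multiplying by n + 1 = i + j differentiates the product, and the two
  -- parts of the Leibniz rule give x and y times the previous degree.
  e-+ : ∀ x y n → (e^ (x + y)) n ≈ ∑∇ n (λ i j → (e^ x) i * (e^ y) j)
  e-+ x y zero    = begin
    (e^ (x + y)) 0                         ≈⟨ e-zero (x + y) ⟩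
    1#                                     ≈⟨ *-identityˡ 1# ⟨
    1# * 1#                                ≈⟨ *-cong (e-zero x) (e-zero y) ⟨
    (e^ x) 0 * (e^ y) 0                    ≈⟨ ∑∇-zero _ ⟨
    ∑∇ 0 (λ i j → (e^ x) i * (e^ y) j)     ∎
  e-+ x y (suc n) = fromℕ-cancelˡ n (begin
    fromℕ (suc n) * (e^ (x + y)) (suc n)
      ≈⟨ e-suc (x + y) n ⟩
    (x + y) * (e^ (x + y)) n
      ≈⟨ *-congˡ (e-+ x y n) ⟩
    (x + y) * S
      ≈⟨ distribʳ S x y ⟩
    x * S + y * S
      ≈⟨ +-cong left right ⟨
    ∑∇ (suc n) (λ i j → fromℕ i * (e^ x) i * (e^ y) j) +
    ∑∇ (suc n) (λ i j → fromℕ j * ((e^ x) i * (e^ y) j))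
      ≈⟨ ∑∇-+ (suc n) _ _ ⟨
    ∑∇ (suc n) (λ i j → fromℕ i * (e^ x) i * (e^ y) j + fromℕ j * ((e^ x) i * (e^ y) j))
      ≈⟨ ∑∇-cong (suc n) (λ i j i+j≡1+n → begin
           fromℕ i * (e^ x) i * (e^ y) j + fromℕ j * ((e^ x) i * (e^ y) j)
             ≈⟨ solve 4 (λ i j x y → i :* x :* y :+ j :* (x :* y) := (i :+ j) :* (x :* y)) _ _ _ _ ⟩
           (fromℕ i + fromℕ j) * ((e^ x) i * (e^ y) j)
             ≈⟨ *-congʳ (fromℕ-+ i j) ⟨
           fromℕ (i ℕ.+ j) * ((e^ x) i * (e^ y) j)
             ≡⟨ ≡.cong (λ k → fromℕ k * ((e^ x) i * (e^ y) j)) i+j≡1+n ⟩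
           fromℕ (suc n) * ((e^ x) i * (e^ y) j) ∎) ⟩
    ∑∇ (suc n) (λ i j → fromℕ (suc n) * ((e^ x) i * (e^ y) j))
      ≈⟨ ∑∇-*ˡ (suc n) _ _ ⟨
    fromℕ (suc n) * ∑∇ (suc n) (λ i j → (e^ x) i * (e^ y) j) ∎)
    where
    S : Carrier
    S = ∑∇ n (λ i j → (e^ x) i * (e^ y) j)

    left : ∑∇ (suc n) (λ i j → fromℕ i * (e^ x) i * (e^ y) j) ≈ x * S
    left = begin
      ∑∇ (suc n) (λ i j → fromℕ i * (e^ x) i * (e^ y) j)
        ≈⟨ ∑∇-head n _ ⟩
      0# * (e^ x) 0 * (e^ y) (suc n) + ∑∇ n (λ i j → fromℕ (suc i) * (e^ x) (suc i) * (e^ y) j)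
        ≈⟨ +-cong (trans (*-congʳ (zeroˡ _)) (zeroˡ _))
             (∑∇-cong n λ i j _ → trans (*-congʳ (e-suc x i)) (*-assoc _ _ _)) ⟩
      0# + ∑∇ n (λ i j → x * ((e^ x) i * (e^ y) j))
        ≈⟨ trans (+-identityˡ _) (sym (∑∇-*ˡ n x _)) ⟩
      x * S ∎

    right : ∑∇ (suc n) (λ i j → fromℕ j * ((e^ x) i * (e^ y) j)) ≈ y * S
    right = begin
      ∑∇ (suc n) (λ i j → fromℕ j * ((e^ x) i * (e^ y) j))
        ≈⟨ ∑∇-last n _ ⟩
      ∑∇ n (λ i j → fromℕ (suc j) * ((e^ x) i * (e^ y) (suc j))) + 0# * ((e^ x) (suc n) * (e^ y) 0)
        ≈⟨ +-cong (∑∇-cong n λ i j _ → begin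
             fromℕ (suc j) * ((e^ x) i * (e^ y) (suc j))
               ≈⟨ solve 3 (λ j x y → j :* (x :* y) := x :* (j :* y)) _ _ _ ⟩
             (e^ x) i * (fromℕ (suc j) * (e^ y) (suc j))
               ≈⟨ *-congˡ (e-suc y j) ⟩
             (e^ x) i * (y * (e^ y) j)
               ≈⟨ solve 3 (λ x y z → x :* (y :* z) := y :* (x :* z)) _ _ _ ⟩
             y * ((e^ x) i * (e^ y) j) ∎) (zeroˡ _) ⟩
      ∑∇ n (λ i j → y * ((e^ x) i * (e^ y) j)) + 0#
        ≈⟨ trans (+-identityʳ _) (sym (∑∇-*ˡ n y _)) ⟩
      y * S ∎

  -- Associativity of the Cauchy product: both sides run over the triples with sum n.
  ∑∇-assoc : ∀ n (F : ℕ → ℕ → ℕ → Carrier) →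
    ∑∇ n (λ i j → ∑∇ i (λ a b → F a b j)) ≈ ∑∇ n (λ a j → ∑∇ j (λ b k → F a b k))
  ∑∇-assoc zero    F =
    trans (trans (∑∇-zero _) (∑∇-zero _)) (sym (trans (∑∇-zero _) (∑∇-zero _)))
  ∑∇-assoc (suc n) F = begin
    ∑∇ (suc n) (λ i j → ∑∇ i (λ a b → F a b j))
      ≈⟨ ∑∇-head n _ ⟩
    ∑∇ 0 (λ a b → F a b (suc n)) + ∑∇ n (λ i j → ∑∇ (suc i) (λ a b → F a b j))
      ≈⟨ +-cong (∑∇-zero _) (trans (∑∇-cong n λ i j _ → ∑∇-head i _) (∑∇-+ n _ _)) ⟩
    F 0 0 (suc n) + (∑∇ n (λ i j → F 0 (suc i) j) + ∑∇ n (λ i j → ∑∇ i (λ a b → F (suc a) b j)))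
      ≈⟨ +-assoc _ _ _ ⟨
    F 0 0 (suc n) + ∑∇ n (λ i j → F 0 (suc i) j) + ∑∇ n (λ i j → ∑∇ i (λ a b → F (suc a) b j))
      ≈⟨ +-cong (sym (∑∇-head n (F 0))) (∑∇-assoc n (F ∘ suc)) ⟩
    ∑∇ (suc n) (F 0) + ∑∇ n (λ a j → ∑∇ j (λ b k → F (suc a) b k))
      ≈⟨ ∑∇-head n _ ⟨
    ∑∇ (suc n) (λ a j → ∑∇ j (λ b k → F a b k)) ∎

  -- As h has constant term 1, the coefficient of degree n + 1 of h ⊛ f is f (n + 1) plus terms in
  -- lower coefficients of f, so f is determined degree by degree.
  ⊛-cancelˡ : ∀ h f g → h 0 ≈ 1# → h ⊛ f ≋ h ⊛ g → f ≋ g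
  ⊛-cancelˡ h f g h0≈1 h⊛f≋h⊛g n = below n n ℕ.≤-refl
    where
    leading : ∀ f → (h ⊛ f) 0 ≈ f 0
    leading f = trans (⊛≈∑∇ h f 0) (trans (∑∇-zero _) (trans (*-congʳ h0≈1) (*-identityˡ _)))

    next : ∀ f n → (h ⊛ f) (suc n) ≈ f (suc n) + ∑∇ n (λ i j → h (suc i) * f j)
    next f n = trans (⊛≈∑∇ h f (suc n)) (trans (∑∇-head n _)
      (+-congʳ (trans (*-congʳ h0≈1) (*-identityˡ _))))

    below : ∀ n m → m ℕ.≤ n → f m ≈ g m
    below zero    zero    _ = trans (sym (leading f)) (trans (h⊛f≋h⊛g 0) (leading g))
    below (suc n) m m≤1+n with ℕ.m≤n⇒m<n∨m≡n m≤1+n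
    ... | inj₁ (ℕ.s≤s m≤n) = below n m m≤n
    ... | inj₂ ≡.refl = +-cancelʳ _ _ _ (begin
      f (suc n) + ∑∇ n (λ i j → h (suc i) * f j)
        ≈⟨ next f n ⟨
      (h ⊛ f) (suc n)
        ≈⟨ h⊛f≋h⊛g (suc n) ⟩
      (h ⊛ g) (suc n)
        ≈⟨ next g n ⟩
      g (suc n) + ∑∇ n (λ i j → h (suc i) * g j)
        ≈⟨ +-congˡ (∑∇-cong n λ i j i+j≡n → *-congˡ
             (below n j (ℕ.≤-trans (ℕ.m≤n+m j i) (ℕ.≤-reflexive i+j≡n)))) ⟨
      g (suc n) + ∑∇ n (λ i j → h (suc i) * f j) ∎)

  -- The series (e^t - 1)/t, the denominator of the Bernoulli generating function after cancelling
  -- t.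
  todd : PowerSeries
  todd n = (e^ 1#) (suc n)

  todd-zero : todd 0 ≈ 1#
  todd-zero = trans (*-cong (*-identityˡ 1#) refl) (trans (sym (*-congʳ (+-identityʳ 1#))) (fromℕ*1/! 1))

  todd⊛bernoulliSeries : ∀ x → todd ⊛ bernoulliSeries x ≋ e^ x
  todd⊛bernoulliSeries x = ⊘-correct (e^ x) todd todd-zero

  -- The addition theorem for Bernoulli polynomials: multiplied by `todd`, both sides become
  -- e^{(x+y)t}.
  bernoulliSeries-+ : ∀ x y n →
    bernoulliSeries (x + y) n ≈ ∑∇ n (λ i j → bernoulliSeries x i * (e^ y) j)
  bernoulliSeries-+ x y = ⊛-cancelˡ todd _ _ todd-zero λ n → begin
    (todd ⊛ bernoulliSeries (x + y)) n
      ≈⟨ todd⊛bernoulliSeries (x + y) n ⟩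
    (e^ (x + y)) n
      ≈⟨ e-+ x y n ⟩
    ∑∇ n (λ i j → (e^ x) i * (e^ y) j)
      ≈⟨ ∑∇-cong n (λ i j _ → begin
           (e^ x) i * (e^ y) j
             ≈⟨ *-congʳ (trans (sym (⊛≈∑∇ todd (bernoulliSeries x) i)) (todd⊛bernoulliSeries x i)) ⟨
           ∑∇ i (λ a b → todd a * bernoulliSeries x b) * (e^ y) j
             ≈⟨ ∑∇-*ʳ i _ _ ⟩
           ∑∇ i (λ a b → todd a * bernoulliSeries x b * (e^ y) j) ∎) ⟩
    ∑∇ n (λ i j → ∑∇ i (λ a b → todd a * bernoulliSeries x b * (e^ y) j))
      ≈⟨ ∑∇-assoc n (λ a b k → todd a * bernoulliSeries x b * (e^ y) k) ⟩
    ∑∇ n (λ a j → ∑∇ j (λ b k → todd a * bernoulliSeries x b * (e^ y) k))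
      ≈⟨ ∑∇-cong n (λ a j _ → trans (∑∇-cong j λ _ _ _ → *-assoc _ _ _) (sym (∑∇-*ˡ j _ _))) ⟩
    ∑∇ n (λ a j → todd a * ∑∇ j (λ b k → bernoulliSeries x b * (e^ y) k))
      ≈⟨ ⊛≈∑∇ todd _ n ⟨
    (todd ⊛ λ j → ∑∇ j (λ b k → bernoulliSeries x b * (e^ y) k)) n ∎

  bernoulliSeries-cong : ∀ {x y} → x ≈ y → bernoulliSeries x ≋ bernoulliSeries y
  bernoulliSeries-cong {x} {y} x≈y = ⊛-cancelˡ todd _ _ todd-zero λ n →
    trans (todd⊛bernoulliSeries x n) (trans (e-cong n x≈y) (sym (todd⊛bernoulliSeries y n)))

  bernoulliSeries-zero : ∀ x → bernoulliSeries x 0 ≈ 1#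
  bernoulliSeries-zero x = begin
    bernoulliSeries x 0           ≈⟨ *-identityˡ _ ⟨
    1# * bernoulliSeries x 0      ≈⟨ *-congʳ todd-zero ⟨
    todd 0 * bernoulliSeries x 0  ≈⟨ trans (⊛≈∑∇ todd (bernoulliSeries x) 0) (∑∇-zero _) ⟨
    (todd ⊛ bernoulliSeries x) 0  ≈⟨ todd⊛bernoulliSeries x 0 ⟩
    (e^ x) 0                      ≈⟨ e-zero x ⟩
    1#                            ∎

  -- This is B_n(x+1) - B_n(x) = n x^{n-1}. It is the addition theorem at y = 1 with e^t written as
  -- 1 + t `todd`, where `todd` undoes the division by (e^t - 1)/t.
  bernoulliSeries-difference : ∀ x n →
    bernoulliSeries (x + 1#) (suc n) ≈ (e^ x) n + bernoulliSeries x (suc n)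
  bernoulliSeries-difference x n = begin
    bernoulliSeries (x + 1#) (suc n)
      ≈⟨ bernoulliSeries-+ x 1# (suc n) ⟩
    ∑∇ (suc n) (λ i j → bernoulliSeries x i * (e^ 1#) j)
      ≈⟨ ∑∇-last n _ ⟩
    ∑∇ n (λ i j → bernoulliSeries x i * todd j) + bernoulliSeries x (suc n) * (e^ 1#) 0
      ≈⟨ +-cong (begin
           ∑∇ n (λ i j → bernoulliSeries x i * todd j) ≈⟨ ∑∇-flip n _ ⟩
           ∑∇ n (λ i j → bernoulliSeries x j * todd i) ≈⟨ ∑∇-cong n (λ _ _ _ → *-comm _ _) ⟩
           ∑∇ n (λ i j → todd i * bernoulliSeries x j) ≈⟨ ⊛≈∑∇ todd (bernoulliSeries x) n ⟨
           (todd ⊛ bernoulliSeries x) n                ≈⟨ todd⊛bernoulliSeries x n ⟩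
           (e^ x) n                                    ∎)
         (trans (*-congˡ (e-zero 1#)) (*-identityʳ _)) ⟩
    (e^ x) n + bernoulliSeries x (suc n) ∎

  -- For x = 0 and θ = η^{-a} this is -2N β_n^a.
  twisted : (N : ℕ) .{{_ : NonZero N}} → Carrier → Carrier → PowerSeries
  twisted N θ x n = ∑[ l ≤ N ] θ ^ l * bernoulliSeries (fromℕ l * 1/ N + x) n

  module _ (N : ℕ) .{{_ : NonZero N}} (θ : Carrier) where

    twisted-cong : ∀ {x y} n → x ≈ y → twisted N θ x n ≈ twisted N θ y n
    twisted-cong n x≈y = ∑-cong N λ l → *-congˡ (bernoulliSeries-cong (+-congˡ x≈y) n)

    twisted-expand : ∀ x n → twisted N θ x n ≈ ∑∇ n (λ i j → twisted N θ 0# i * (e^ x) j)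
    twisted-expand x n = begin
      ∑[ l ≤ N ] θ ^ l * bernoulliSeries (fromℕ l * 1/ N + x) n
        ≈⟨ ∑-cong N (λ l → begin
             θ ^ suc l * bernoulliSeries (fromℕ (suc l) * 1/ N + x) n
               ≈⟨ *-congˡ (bernoulliSeries-cong (+-congʳ (sym (+-identityʳ _))) n) ⟩
             θ ^ suc l * bernoulliSeries (fromℕ (suc l) * 1/ N + 0# + x) n
               ≈⟨ *-congˡ (bernoulliSeries-+ _ x n) ⟩
             θ ^ suc l * ∑∇ n (λ i j → bernoulliSeries (fromℕ (suc l) * 1/ N + 0#) i * (e^ x) j)
               ≈⟨ ∑∇-*ˡ n _ _ ⟩
             ∑∇ n (λ i j → θ ^ suc l * (bernoulliSeries (fromℕ (suc l) * 1/ N + 0#) i * (e^ x) j)) ∎) ⟩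
      ∑[ l ≤ N ] ∑∇ n (λ i j → θ ^ l * (bernoulliSeries (fromℕ l * 1/ N + 0#) i * (e^ x) j))
        ≈⟨ ∑-∑∇-swap N n (λ l i j → θ ^ l * (bernoulliSeries (fromℕ l * 1/ N + 0#) i * (e^ x) j)) ⟩
      ∑∇ n (λ i j → ∑[ l ≤ N ] θ ^ l * (bernoulliSeries (fromℕ l * 1/ N + 0#) i * (e^ x) j))
        ≈⟨ ∑∇-cong n (λ i j _ → trans (∑-cong N λ l → sym (*-assoc _ _ _)) (sym (∑-*ʳ N _ _))) ⟩
      ∑∇ n (λ i j → twisted N θ 0# i * (e^ x) j) ∎

    -- Moving the argument by 1/N moves l to l + 1. As θ^N = 1, only the wrap-around from N + 1 to 1
    -- makes a difference: there the arguments differ by 1, and the difference equation leaves a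
    -- single power.
    twisted-shift : θ ^ N ≈ 1# → ∀ x k →
      θ * twisted N θ (1/ N + x) (suc k) ≈ twisted N θ x (suc k) + θ * (e^ (1/ N + x)) k
    -- With the term l = 1 added, both sides are one sum over l = 1, ..., N + 1, split off at its
    -- first and at its last term.
    twisted-shift θ^N≈1 x k = +-cancelˡ (φ 1) _ _ (begin
      φ 1 + θ * twisted N θ (1/ N + x) (suc k)
        ≈⟨ +-congˡ (trans (∑-*ˡ N θ _) (∑-cong N λ l → begin
             θ * (θ ^ suc l * bernoulliSeries (fromℕ (suc l) * 1/ N + (1/ N + x)) (suc k))
               ≈⟨ *-assoc _ _ _ ⟨
             θ ^ suc (suc l) * bernoulliSeries (fromℕ (suc l) * 1/ N + (1/ N + x)) (suc k)
               ≈⟨ *-congˡ (bernoulliSeries-cong (solve 3 (λ l n x → l :* n :+ (n :+ x) := (:1 :+ l) :* n :+ x) _ _ _) (suc k)) ⟩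
             φ (suc (suc l)) ∎)) ⟩
      φ 1 + (∑[ l ≤ N ] φ (suc l))
        ≈⟨ ∑-head N φ ⟨
      ∑[ l ≤ suc N ] φ l
        ≈⟨ ∑-last N φ ⟩
      twisted N θ x (suc k) + θ * θ ^ N * bernoulliSeries (fromℕ (suc N) * 1/ N + x) (suc k)
        ≈⟨ +-congˡ (*-cong (trans (*-congˡ θ^N≈1) (*-identityʳ θ)) (begin
             bernoulliSeries (fromℕ (suc N) * 1/ N + x) (suc k)
               ≈⟨ bernoulliSeries-cong (solve 3 (λ m n x → (:1 :+ m) :* n :+ x := (n :+ x) :+ m :* n) _ _ _) (suc k) ⟩
             bernoulliSeries (1/ N + x + fromℕ N * 1/ N) (suc k)
               ≈⟨ bernoulliSeries-cong (+-congˡ (fromℕ*1/ N)) (suc k) ⟩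
             bernoulliSeries (1/ N + x + 1#) (suc k)
               ≈⟨ bernoulliSeries-difference _ k ⟩
             (e^ (1/ N + x)) k + bernoulliSeries (1/ N + x) (suc k) ∎)) ⟩
      twisted N θ x (suc k) + θ * ((e^ (1/ N + x)) k + bernoulliSeries (1/ N + x) (suc k))
        ≈⟨ solve 4 (λ t θ e b → t :+ θ :* (e :+ b) := θ :* b :+ (t :+ θ :* e)) _ _ _ _ ⟩
      θ * bernoulliSeries (1/ N + x) (suc k) + (twisted N θ x (suc k) + θ * (e^ (1/ N + x)) k)
        ≈⟨ +-congʳ (*-cong (*-identityʳ θ) (bernoulliSeries-cong (+-congʳ
             (trans (*-congʳ (+-identityʳ 1#)) (*-identityˡ _))) (suc k))) ⟨
      φ 1 + (twisted N θ x (suc k) + θ * (e^ (1/ N + x)) k) ∎)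
      where
      φ : ℕ → Carrier
      φ l = θ ^ l * bernoulliSeries (fromℕ l * 1/ N + x) (suc k)

  -- Binomial coefficients

  bin : ℕ → ℕ → Carrier
  bin n k = fromℕ (n C k)

  sign : ℕ → Carrier
  sign n = (- 1#) ^ n

  sign-suc : ∀ n → sign (suc n) ≈ - sign n
  sign-suc n = -1*x≈-x (sign n)

  sign²≈1 : ∀ n → sign n * sign n ≈ 1#
  sign²≈1 zero    = *-identityˡ 1#
  sign²≈1 (suc n) = trans (*-cong (sign-suc n) (sign-suc n))
    (trans (solve 1 (λ x → :- x :* :- x := x :* x) (sign n)) (sign²≈1 n))

  pascal : ∀ n k → bin (suc n) (suc k) ≈ bin n k + bin n (suc k)
  pascal n k = trans (reflexive (≡.cong fromℕ (≡.sym (nCk+nC[k+1]≡[n+1]C[k+1] n k)))) (fromℕ-+ (n C k) _)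

  bin-zero : ∀ n → bin n 0 ≈ 1#
  bin-zero n = +-identityʳ 1#

  bin-> : ∀ {n k} → n ℕ.< k → bin n k ≈ 0#
  bin-> n<k = reflexive (≡.cong fromℕ (k>n⇒nCk≡0 n<k))

  bin-sym : ∀ k l → bin (k ℕ.+ l) k ≈ bin (k ℕ.+ l) l
  bin-sym k l = reflexive (≡.cong fromℕ (≡.trans (nCk≡nC[n∸k] (ℕ.m≤m+n k l))
    (≡.cong ((k ℕ.+ l) C_) (ℕ.m+n∸m≡n k l))))

  -- The rule (k + 1) C(n, k + 1) = (n - k) C(n, k), with the negative term moved to the left so
  -- that no difference n - k occurs.
  bin-absorb : ∀ n k → fromℕ (suc k) * bin n (suc k) + fromℕ k * bin n k ≈ fromℕ n * bin n k
  bin-absorb zero    zero    = trans (+-cong (zeroʳ _) (zeroˡ _)) (trans (+-identityˡ 0#) (sym (zeroˡ _)))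
  bin-absorb zero    (suc k) = trans (+-cong (zeroʳ _) (zeroʳ _)) (trans (+-identityˡ 0#) (sym (zeroˡ _)))
  bin-absorb (suc n) zero    = begin
    fromℕ 1 * bin (suc n) 1 + 0# * bin (suc n) 0
      ≈⟨ +-cong (*-congˡ (pascal n 0)) (zeroˡ _) ⟩
    fromℕ 1 * (bin n 0 + bin n 1) + 0#
      ≈⟨ solve 4 (λ o z b m → o :* (z :+ b) :+ :0 := o :* z :+ (o :* b :+ :0 :* z)) _ _ _ (fromℕ n) ⟩
    fromℕ 1 * bin n 0 + (fromℕ 1 * bin n 1 + 0# * bin n 0)
      ≈⟨ +-cong (*-congʳ (+-identityʳ 1#)) (bin-absorb n 0) ⟩
    1# * bin n 0 + fromℕ n * bin n 0
      ≈⟨ distribʳ _ _ _ ⟨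
    fromℕ (suc n) * bin (suc n) 0 ∎
  bin-absorb (suc n) (suc k) = begin
    (1# + m) * bin (suc n) (suc (suc k)) + m * bin (suc n) (suc k)
      ≈⟨ +-cong (*-congˡ (pascal n (suc k))) (*-congˡ (pascal n k)) ⟩
    (1# + m) * (y + z) + m * (x + y)
      ≈⟨ solve 4 (λ m x y z →
           (:1 :+ m) :* (y :+ z) :+ m :* (x :+ y)
           := y :+ m :* x :+ m :* y :+ ((:1 :+ m) :* z :+ m :* y)) m x y z ⟩
    y + m * x + m * y + ((1# + m) * z + m * y)
      ≈⟨ +-congˡ (bin-absorb n (suc k)) ⟩
    y + m * x + m * y + fromℕ n * y
      ≈⟨ solve 5 (λ k x y n z →
           y :+ (:1 :+ k) :* x :+ (:1 :+ k) :* y :+ n :* y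
           := y :+ n :* y :+ x :+ ((:1 :+ k) :* y :+ k :* x)) (fromℕ k) x y (fromℕ n) z ⟩
    y + fromℕ n * y + x + (fromℕ (suc k) * y + fromℕ k * x)
      ≈⟨ +-congˡ (bin-absorb n k) ⟩
    y + fromℕ n * y + x + fromℕ n * x
      ≈⟨ solve 3 (λ x y n → y :+ n :* y :+ x :+ n :* x := (:1 :+ n) :* (x :+ y)) x y (fromℕ n) ⟩
    fromℕ (suc n) * (x + y)
      ≈⟨ *-congˡ (pascal n k) ⟨
    fromℕ (suc n) * bin (suc n) (suc k) ∎
    where
    m = fromℕ (suc k)
    x = bin n k
    y = bin n (suc k)
    z = bin n (suc (suc k))

  bin-suc-suc : ∀ n k → fromℕ (suc k) * bin (suc n) (suc k) ≈ fromℕ (suc n) * bin n k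
  bin-suc-suc n k = begin
    fromℕ (suc k) * bin (suc n) (suc k)
      ≈⟨ *-congˡ (pascal n k) ⟩
    (1# + fromℕ k) * (bin n k + bin n (suc k))
      ≈⟨ solve 3 (λ k x y → (:1 :+ k) :* (x :+ y) := x :+ ((:1 :+ k) :* y :+ k :* x)) _ _ _ ⟩
    bin n k + (fromℕ (suc k) * bin n (suc k) + fromℕ k * bin n k)
      ≈⟨ +-congˡ (bin-absorb n k) ⟩
    bin n k + fromℕ n * bin n k
      ≈⟨ solve 2 (λ x n → x :+ n :* x := (:1 :+ n) :* x) _ _ ⟩
    fromℕ (suc n) * bin n k ∎

  -- The multiplication rule of divided powers x^i/i!. Induction on i, where `e-suc` removes one
  -- factor on the left and `bin-suc-suc` adjusts the binomial.
  e-* : ∀ x i j → (e^ x) i * (e^ x) j ≈ bin (i ℕ.+ j) i * (e^ x) (i ℕ.+ j)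
  e-* x zero    j = *-congʳ (trans (e-zero x) (sym (bin-zero j)))
  e-* x (suc i) j = fromℕ-cancelˡ i (begin
    fromℕ (suc i) * ((e^ x) (suc i) * (e^ x) j)
      ≈⟨ trans (sym (*-assoc _ _ _)) (trans (*-congʳ (e-suc x i)) (*-assoc _ _ _)) ⟩
    x * ((e^ x) i * (e^ x) j)
      ≈⟨ *-congˡ (e-* x i j) ⟩
    x * (bin (i ℕ.+ j) i * (e^ x) (i ℕ.+ j))
      ≈⟨ solve 3 (λ x b e → x :* (b :* e) := b :* (x :* e)) _ _ _ ⟩
    bin (i ℕ.+ j) i * (x * (e^ x) (i ℕ.+ j))
      ≈⟨ *-congˡ (e-suc x (i ℕ.+ j)) ⟨
    bin (i ℕ.+ j) i * (fromℕ (suc (i ℕ.+ j)) * (e^ x) (suc (i ℕ.+ j)))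
      ≈⟨ solve 3 (λ b n e → b :* (n :* e) := n :* b :* e) _ _ _ ⟩
    fromℕ (suc (i ℕ.+ j)) * bin (i ℕ.+ j) i * (e^ x) (suc (i ℕ.+ j))
      ≈⟨ *-congʳ (bin-suc-suc (i ℕ.+ j) i) ⟨
    fromℕ (suc i) * bin (suc i ℕ.+ j) (suc i) * (e^ x) (suc i ℕ.+ j)
      ≈⟨ *-assoc _ _ _ ⟩
    fromℕ (suc i) * (bin (suc i ℕ.+ j) (suc i) * (e^ x) (suc i ℕ.+ j)) ∎)

  -- For h ≤ m this is, up to sign, the h-th finite difference of φ along an antidiagonal;
  -- `alternating-suc` is one more differencing step.
  alternating : ℕ → ℕ → (ℕ → ℕ → Carrier) → Carrier
  alternating h m φ = ∑∇ m (λ i j → sign i * bin h i * φ i j)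

  alternating-cong : ∀ h m {φ ψ : ℕ → ℕ → Carrier} → (∀ i j → i ℕ.+ j ≡ m → φ i j ≈ ψ i j) →
    alternating h m φ ≈ alternating h m ψ
  alternating-cong h m eq = ∑∇-cong m λ i j i+j≡m → *-congˡ (eq i j i+j≡m)

  alternating-+ : ∀ h m (φ ψ : ℕ → ℕ → Carrier) →
    alternating h m (λ i j → φ i j + ψ i j) ≈ alternating h m φ + alternating h m ψ
  alternating-+ h m φ ψ = trans (∑∇-cong m λ _ _ _ → distribˡ _ _ _) (∑∇-+ m _ _)

  alternating-zero : ∀ m φ → alternating 0 m φ ≈ φ 0 m
  alternating-zero zero    φ = trans (∑∇-zero _)
    (trans (*-congʳ (trans (*-identityˡ _) (+-identityʳ 1#))) (*-identityˡ _))
  alternating-zero (suc m) φ = begin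
    ∑∇ (suc m) (λ i j → sign i * bin 0 i * φ i j)
      ≈⟨ ∑∇-head m _ ⟩
    1# * bin 0 0 * φ 0 (suc m) + ∑∇ m (λ i j → sign (suc i) * 0# * φ (suc i) j)
      ≈⟨ +-cong (trans (*-congʳ (trans (*-identityˡ _) (+-identityʳ 1#))) (*-identityˡ _))
           (∑∇-0 m λ i j _ → trans (*-congʳ (zeroʳ _)) (zeroˡ _)) ⟩
    φ 0 (suc m) + 0#
      ≈⟨ +-identityʳ _ ⟩
    φ 0 (suc m) ∎

  alternating-suc : ∀ h m φ →
    alternating (suc h) (suc m) φ ≈ alternating h (suc m) φ - alternating h m (φ ∘ suc)
  alternating-suc h m φ = begin
    alternating (suc h) (suc m) φ
      ≈⟨ ∑∇-head m _ ⟩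
    sign 0 * bin (suc h) 0 * φ 0 (suc m) +
    ∑∇ m (λ i j → sign (suc i) * bin (suc h) (suc i) * φ (suc i) j)
      ≈⟨ +-congˡ (trans (∑∇-cong m λ i j _ → begin
           sign (suc i) * bin (suc h) (suc i) * φ (suc i) j
             ≈⟨ *-congʳ (*-congˡ (pascal h i)) ⟩
           - 1# * sign i * (bin h i + bin h (suc i)) * φ (suc i) j
             ≈⟨ solve 4 (λ s b b′ p →
                  :- :1 :* s :* (b :+ b′) :* p
                  := :- :1 :* s :* b′ :* p :+ :- :1 :* (s :* b :* p)) _ _ _ _ ⟩
           sign (suc i) * bin h (suc i) * φ (suc i) j + - 1# * (sign i * bin h i * φ (suc i) j) ∎)
           (∑∇-+ m _ _)) ⟩
    sign 0 * bin h 0 * φ 0 (suc m) +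
    (∑∇ m (λ i j → sign (suc i) * bin h (suc i) * φ (suc i) j) +
     ∑∇ m (λ i j → - 1# * (sign i * bin h i * φ (suc i) j)))
      ≈⟨ +-assoc _ _ _ ⟨
    sign 0 * bin h 0 * φ 0 (suc m) +
    ∑∇ m (λ i j → sign (suc i) * bin h (suc i) * φ (suc i) j) +
    ∑∇ m (λ i j → - 1# * (sign i * bin h i * φ (suc i) j))
      ≈⟨ +-cong (∑∇-head m _) (trans (sym (-1*x≈-x _)) (∑∇-*ˡ m (- 1#) _)) ⟨
    alternating h (suc m) φ - alternating h m (φ ∘ suc) ∎

  alternating-extend : ∀ {h m} → h ℕ.≤ m → (φ : ℕ → Carrier) →
    alternating h (suc m) (λ i _ → φ i) ≈ alternating h m (λ i _ → φ i)
  alternating-extend {h} {m} h≤m φ = trans (∑∇-last m _)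
    (trans (+-congˡ (trans (*-congʳ (trans (*-congˡ (bin-> (ℕ.s≤s h≤m))) (zeroʳ _))) (zeroˡ _)))
      (+-identityʳ _))

  -- One step turns C(i, k + 1) into -C(i, k) and constants into zero. After h steps, evaluated at i
  -- = 0, only k = h leaves something, namely the sign (-1)^h.
  alternating-orthogonality : ∀ {h m} k → h ℕ.≤ m →
    alternating h m (λ i _ → bin i k) ≈ sign h * [ h ℕ.≟ k ]
  alternating-orthogonality {zero}  {m} zero    _ = trans (alternating-zero m _)
    (trans (+-identityʳ 1#) (sym (*-identityˡ 1#)))
  alternating-orthogonality {zero}  {m} (suc k) _ = trans (alternating-zero m _)
    (sym (zeroʳ 1#))
  alternating-orthogonality {suc h} {suc m} zero    (ℕ.s≤s h≤m) = begin
    alternating (suc h) (suc m) (λ i _ → bin i 0)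
      ≈⟨ alternating-suc h m _ ⟩
    alternating h (suc m) (λ i _ → bin i 0) - alternating h m (λ i _ → bin (suc i) 0)
      ≈⟨ +-congʳ (alternating-extend h≤m (λ i → bin i 0)) ⟩
    alternating h m (λ i _ → bin i 0) - alternating h m (λ i _ → bin (suc i) 0)
      ≈⟨ -‿inverseʳ _ ⟩
    0#
      ≈⟨ zeroʳ _ ⟨
    sign (suc h) * 0# ∎
  alternating-orthogonality {suc h} {suc m} (suc k) (ℕ.s≤s h≤m) = begin
    alternating (suc h) (suc m) (λ i _ → bin i (suc k))
      ≈⟨ alternating-suc h m _ ⟩
    alternating h (suc m) (λ i _ → bin i (suc k)) - alternating h m (λ i _ → bin (suc i) (suc k))
      ≈⟨ +-cong (alternating-extend h≤m (λ i → bin i (suc k)))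
           (-‿cong (trans (alternating-cong h m λ i _ _ → pascal i k) (alternating-+ h m _ _))) ⟩
    A₊ - (alternating h m (λ i _ → bin i k) + A₊)
      ≈⟨ solve 2 (λ x y → x :- (y :+ x) := :- y) _ _ ⟩
    - alternating h m (λ i _ → bin i k)
      ≈⟨ -‿cong (alternating-orthogonality k h≤m) ⟩
    - (sign h * [ h ℕ.≟ k ])
      ≈⟨ solve 2 (λ x y → :- (x :* y) := :- :1 :* x :* y) _ _ ⟩
    sign (suc h) * [ suc h ℕ.≟ suc k ] ∎
    where
    A₊ = alternating h m (λ i _ → bin i (suc k))

  -- Each step lowers both j and k by one, so the value is C(t, k - h). As h + t = k + l, this is
  -- C(t, l) by symmetry, a form that stays meaningful for k < h. The induction closes by Pascal's
  -- rule.
  alternating-vandermonde : ∀ h t k l → h ℕ.+ t ≡ k ℕ.+ l →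
    alternating h (h ℕ.+ t) (λ _ j → bin j k) ≈ bin t l
  alternating-vandermonde zero    t k l ≡.refl = trans (alternating-zero t _) (bin-sym k l)
  alternating-vandermonde (suc h) t k l 1+h+t≡k+l = begin
    alternating (suc h) (suc (h ℕ.+ t)) (λ _ j → bin j k)
      ≈⟨ alternating-suc h (h ℕ.+ t) _ ⟩
    alternating h (suc (h ℕ.+ t)) (λ _ j → bin j k) - alternating h (h ℕ.+ t) (λ _ j → bin j k)
      ≡⟨ ≡.cong (λ m → alternating h m (λ _ j → bin j k) - alternating h (h ℕ.+ t) (λ _ j → bin j k))
           (≡.sym (ℕ.+-suc h t)) ⟩
    alternating h (h ℕ.+ suc t) (λ _ j → bin j k) - alternating h (h ℕ.+ t) (λ _ j → bin j k)
      ≈⟨ +-congʳ (alternating-vandermonde h (suc t) k l (≡.trans (ℕ.+-suc h t) 1+h+t≡k+l)) ⟩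
    bin (suc t) l - alternating h (h ℕ.+ t) (λ _ j → bin j k)
      ≈⟨ rest l 1+h+t≡k+l ⟩
    bin t l ∎
    where
    rest : ∀ l → suc h ℕ.+ t ≡ k ℕ.+ l →
      bin (suc t) l - alternating h (h ℕ.+ t) (λ _ j → bin j k) ≈ bin t l
    -- Here k = h + t + 1 exceeds every j, so all terms of the subtracted sum vanish, and both
    -- remaining binomials are 1.
    rest zero    eq = trans (+-congˡ (trans (-‿cong (∑∇-0 (h ℕ.+ t) λ i j i+j≡h+t →
      trans (*-congˡ (bin-> (ℕ.≤-trans (ℕ.s≤s (ℕ.≤-trans (ℕ.m≤n+m j i) (ℕ.≤-reflexive i+j≡h+t)))
        (ℕ.≤-reflexive (≡.trans eq (ℕ.+-identityʳ k)))))) (zeroʳ _))) -0#≈0#)) (+-identityʳ _)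
    rest (suc l) eq = begin
      bin (suc t) (suc l) - alternating h (h ℕ.+ t) (λ _ j → bin j k)
        ≈⟨ +-cong (pascal t l) (-‿cong (alternating-vandermonde h t k l
             (ℕ.suc-injective (≡.trans eq (ℕ.+-suc k l))))) ⟩
      bin t l + bin t (suc l) - bin t l
        ≈⟨ solve 2 (λ x y → x :+ y :- x := y) _ _ ⟩
      bin t (suc l) ∎

  -- Lattice sums

  -- The Lambert-type series with general term F u v q^{uv}; in degree n both u and v divide n, so
  -- the range n suffices.
  D : (ℕ → ℕ → Carrier) → PowerSeries
  D F n = ∑[ u ≤ n ] ∑[ v ≤ n ] [ u ℕ.* v ℕ.≟ n ] * F u v

  D-cong : ∀ {F G : ℕ → ℕ → Carrier} n → (∀ u v → F (suc u) (suc v) ≈ G (suc u) (suc v)) → D F n ≈ D G n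
  D-cong n h = ∑-cong n λ u → ∑-cong n λ v → *-congˡ (h u v)

  D-+ : ∀ (F G : ℕ → ℕ → Carrier) n → D (λ u v → F u v + G u v) n ≈ D F n + D G n
  D-+ F G n = trans (∑-cong n λ u → trans (∑-cong n λ v → distribˡ _ _ _) (∑-+ n _ _)) (∑-+ n _ _)

  D-*ˡ : ∀ x (F : ℕ → ℕ → Carrier) n → x * D F n ≈ D (λ u v → x * F u v) n
  D-*ˡ x F n = trans (∑-*ˡ n x _) (∑-cong n λ u → trans (∑-*ˡ n x _) (∑-cong n λ v →
    solve 3 (λ x b f → x :* (b :* f) := b :* (x :* f)) _ _ _))

  D-∑∇ : ∀ m (F : ℕ → ℕ → ℕ → ℕ → Carrier) n →
    D (λ u v → ∑∇ m (λ i j → F i j u v)) n ≈ ∑∇ m (λ i j → D (F i j) n)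
  D-∑∇ m F n = trans (∑-cong n λ u → trans
    (∑-cong n λ v → ∑∇-*ˡ m _ (λ i j → F i j (suc u) (suc v)))
    (∑-∑∇-swap n m (λ v i j → [ suc u ℕ.* v ℕ.≟ n ] * F i j (suc u) v)))
    (∑-∑∇-swap n m (λ u i j → ∑[ v ≤ n ] [ u ℕ.* v ℕ.≟ n ] * F i j u v))

  private
    u<uv : ∀ {n} i v → n ℕ.≤ i → suc i ℕ.* suc v ≢ n
    u<uv i v n≤i eq = ℕ.<⇒≢ (ℕ.<-≤-trans (ℕ.s≤s n≤i) (ℕ.m≤m*n (suc i) (suc v))) (≡.sym eq)

    v<uv : ∀ {n} u i → n ℕ.≤ i → suc u ℕ.* suc i ≢ n
    v<uv u i n≤i eq = u<uv i u n≤i (≡.trans (ℕ.*-comm (suc i) (suc u)) eq)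

  [×-dec] : ∀ {p q} {P : Set p} {Q : Set q} (d : Dec P) (e : Dec Q) → [ d ×-dec e ] ≈ [ d ] * [ e ]
  [×-dec] (yes _) (yes _) = sym (*-identityˡ 1#)
  [×-dec] (yes _) (no _)  = sym (zeroʳ 1#)
  [×-dec] (no _)  _       = sym (zeroˡ _)

  D-zero : ∀ F → D F 0 ≈ 0#
  D-zero F = ∑-empty _

  -- In a product the two factors have degrees m and n - m. A common range n, independent of m,
  -- allows the sum over m to be moved inside.
  D-extend : ∀ {m n} F → m ℕ.≤ n → D F m ≈ ∑[ u ≤ n ] ∑[ v ≤ n ] [ u ℕ.* v ℕ.≟ m ] * F u v
  D-extend {m} {n} F m≤n = begin
    ∑[ u ≤ m ] ∑[ v ≤ m ] [ u ℕ.* v ℕ.≟ m ] * F u v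
      ≈⟨ ∑-cong m (λ u → ∑-extend _ m≤n (λ i m≤i → no*≈0 (suc u ℕ.* suc i ℕ.≟ m) (v<uv u i m≤i))) ⟩
    ∑[ u ≤ m ] ∑[ v ≤ n ] [ u ℕ.* v ℕ.≟ m ] * F u v
      ≈⟨ ∑-extend _ m≤n (λ i m≤i → ∑-0 n λ v _ → no*≈0 (suc i ℕ.* suc v ℕ.≟ m) (u<uv i v m≤i)) ⟩
    ∑[ u ≤ n ] ∑[ v ≤ n ] [ u ℕ.* v ℕ.≟ m ] * F u v ∎

  opaque
    unfolding ∑-syntax

    ⊛≈∑ : ∀ f g n → (f ⊛ g) n ≈ f 0 * g n + (∑[ m ≤ n ] f m * g (n ∸ m))
    ⊛≈∑ f g n = refl

  ∑-*-∑ : ∀ m n (f g : ℕ → Carrier) →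
    (∑[ i ≤ m ] f i) * (∑[ j ≤ n ] g j) ≈ ∑[ i ≤ m ] ∑[ j ≤ n ] f i * g j
  ∑-*-∑ m n f g = trans (∑-*ʳ m f _) (∑-cong m λ i → ∑-*ˡ n _ g)

  quadruple : (ℕ → ℕ → Carrier) → PowerSeries
  quadruple F n = ∑[ u₁ ≤ n ] ∑[ u₂ ≤ n ] ∑[ v₁ ≤ n ] ∑[ v₂ ≤ n ]
    [ u₁ ℕ.* v₁ ℕ.+ u₂ ℕ.* v₂ ℕ.≟ n ] * F v₁ v₂

  quadruple> : (ℕ → ℕ → Carrier) → PowerSeries
  quadruple> F n = ∑[ u₁ ≤ n ] ∑[ u₂ ≤ n ] ∑[ v₁ ≤ n ] ∑[ v₂ ≤ n ]
    [ u₂ ℕ.<? u₁ ×-dec u₁ ℕ.* v₁ ℕ.+ u₂ ℕ.* v₂ ℕ.≟ n ] * F v₁ v₂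

  quadruple>-cong : ∀ {F G : ℕ → ℕ → Carrier} n →
    (∀ u v → F (suc u) (suc v) ≈ G (suc u) (suc v)) → quadruple> F n ≈ quadruple> G n
  quadruple>-cong n h = ∑-cong n λ u₁ → ∑-cong n λ u₂ → ∑-cong n λ v₁ → ∑-cong n λ v₂ → *-congˡ (h v₁ v₂)

  quadruple>-*ˡ : ∀ x (F : ℕ → ℕ → Carrier) n → x * quadruple> F n ≈ quadruple> (λ v₁ v₂ → x * F v₁ v₂) n
  quadruple>-*ˡ x F n = trans (∑-*ˡ n x _) (∑-cong n λ u₁ → trans (∑-*ˡ n x _) (∑-cong n λ u₂ →
    trans (∑-*ˡ n x _) (∑-cong n λ v₁ → trans (∑-*ˡ n x _) (∑-cong n λ v₂ →
      solve 3 (λ x b f → x :* (b :* f) := b :* (x :* f)) _ _ _))))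

  quadruple>-∑∇ : ∀ m (F : ℕ → ℕ → ℕ → ℕ → Carrier) n →
    quadruple> (λ v₁ v₂ → ∑∇ m (λ i j → F i j v₁ v₂)) n ≈ ∑∇ m (λ i j → quadruple> (F i j) n)
  quadruple>-∑∇ m F n =
    trans (∑-cong n λ u₁ → trans (∑-cong n λ u₂ → trans (∑-cong n λ v₁ → trans
      (∑-cong n λ v₂ → ∑∇-*ˡ m _ (λ i j → F i j (suc v₁) (suc v₂)))
      (∑-∑∇-swap n m (λ v₂ i j → t (suc u₁) (suc u₂) (suc v₁) v₂ i j)))
      (∑-∑∇-swap n m (λ v₁ i j → ∑[ v₂ ≤ n ] t (suc u₁) (suc u₂) v₁ v₂ i j)))
      (∑-∑∇-swap n m (λ u₂ i j → ∑[ v₁ ≤ n ] ∑[ v₂ ≤ n ] t (suc u₁) u₂ v₁ v₂ i j)))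
      (∑-∑∇-swap n m (λ u₁ i j → ∑[ u₂ ≤ n ] ∑[ v₁ ≤ n ] ∑[ v₂ ≤ n ] t u₁ u₂ v₁ v₂ i j))
    where
    t : ℕ → ℕ → ℕ → ℕ → ℕ → ℕ → Carrier
    t u₁ u₂ v₁ v₂ i j = [ u₂ ℕ.<? u₁ ×-dec u₁ ℕ.* v₁ ℕ.+ u₂ ℕ.* v₂ ℕ.≟ n ] * F i j v₁ v₂

  private
    -- The sum over the degree m of the first factor collapses to m = p + 1. If p ≥ n there is no
    -- such m, and the condition on the right cannot hold either.
    degrees : ∀ n p q x y → ∑[ m ≤ n ] [ suc p ℕ.≟ m ] * x * ([ suc q ℕ.≟ n ∸ m ] * y) ≈
      [ suc p ℕ.+ suc q ℕ.≟ n ] * (x * y)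
    degrees n p q x y = trans
      (∑-cong n λ m → solve 4 (λ b x b′ y → b :* x :* (b′ :* y) := b :* (b′ :* (x :* y))) _ _ _ _)
      (go (p ℕ.<? n))
      where
      go : Dec (p ℕ.< n) → ∑[ m ≤ n ] [ suc p ℕ.≟ m ] * ([ suc q ℕ.≟ n ∸ m ] * (x * y)) ≈
        [ suc p ℕ.+ suc q ℕ.≟ n ] * (x * y)
      go (yes p<n) = trans (∑-point n p (λ m → [ suc q ℕ.≟ n ∸ m ] * (x * y)) p<n)
        (*-congʳ ([]-cong (suc q ℕ.≟ n ∸ suc p) (suc p ℕ.+ suc q ℕ.≟ n)
          (λ eq → ≡.trans (≡.cong (suc p ℕ.+_) eq) (ℕ.m+[n∸m]≡n p<n))
          (λ eq → ≡.trans (≡.sym (ℕ.m+n∸m≡n (suc p) (suc q))) (≡.cong (_∸ suc p) eq))))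
      go (no p≮n) = trans
        (∑-0 n λ m m<n → no*≈0 (suc p ℕ.≟ suc m) λ eq →
          p≮n (≡.subst (ℕ._< n) (≡.sym (ℕ.suc-injective eq)) m<n))
        (sym (no*≈0 (suc p ℕ.+ suc q ℕ.≟ n) λ eq →
          p≮n (≡.subst (p ℕ.<_) eq (ℕ.m≤m+n (suc p) (suc q)))))

  D-⊛-D : ∀ (f g : ℕ → Carrier) n →
    (D (λ _ → f) ⊛ D (λ _ → g)) n ≈ quadruple (λ v₁ v₂ → f v₁ * g v₂) n
  D-⊛-D f g n = begin
    (D (λ _ → f) ⊛ D (λ _ → g)) n
      ≈⟨ ⊛≈∑ (D (λ _ → f)) (D (λ _ → g)) n ⟩
    D (λ _ → f) 0 * D (λ _ → g) n + (∑[ m ≤ n ] D (λ _ → f) m * D (λ _ → g) (n ∸ m))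
      ≈⟨ trans (+-congʳ (trans (*-congʳ (D-zero _)) (zeroˡ _))) (+-identityˡ _) ⟩
    ∑[ m ≤ n ] D (λ _ → f) m * D (λ _ → g) (n ∸ m)
      ≈⟨ ∑-cong< n (λ m m<n → begin
           D (λ _ → f) (suc m) * D (λ _ → g) (n ∸ suc m)
             ≈⟨ *-cong (D-extend _ m<n) (D-extend _ (ℕ.m∸n≤m n (suc m))) ⟩
           (∑[ u₁ ≤ n ] ∑[ v₁ ≤ n ] F (suc m) u₁ v₁) * (∑[ u₂ ≤ n ] ∑[ v₂ ≤ n ] G (suc m) u₂ v₂)
             ≈⟨ ∑-*-∑ n n _ _ ⟩
           ∑[ u₁ ≤ n ] ∑[ u₂ ≤ n ] (∑[ v₁ ≤ n ] F (suc m) u₁ v₁) * (∑[ v₂ ≤ n ] G (suc m) u₂ v₂)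
             ≈⟨ ∑-cong n (λ u₁ → ∑-cong n λ u₂ → ∑-*-∑ n n _ _) ⟩
           ∑[ u₁ ≤ n ] ∑[ u₂ ≤ n ] ∑[ v₁ ≤ n ] ∑[ v₂ ≤ n ] F (suc m) u₁ v₁ * G (suc m) u₂ v₂ ∎) ⟩
    ∑[ m ≤ n ] ∑[ u₁ ≤ n ] ∑[ u₂ ≤ n ] ∑[ v₁ ≤ n ] ∑[ v₂ ≤ n ] F m u₁ v₁ * G m u₂ v₂
      ≈⟨ trans (∑-swap n n (λ m u₁ → ∑[ u₂ ≤ n ] ∑[ v₁ ≤ n ] ∑[ v₂ ≤ n ] F m u₁ v₁ * G m u₂ v₂))
        (∑-cong n λ u₁ → trans (∑-swap n n (λ m u₂ → ∑[ v₁ ≤ n ] ∑[ v₂ ≤ n ] F m (suc u₁) v₁ * G m u₂ v₂))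
        (∑-cong n λ u₂ → trans (∑-swap n n (λ m v₁ → ∑[ v₂ ≤ n ] F m (suc u₁) v₁ * G m (suc u₂) v₂))
        (∑-cong n λ v₁ → ∑-swap n n (λ m v₂ → F m (suc u₁) (suc v₁) * G m (suc u₂) v₂)))) ⟩
    ∑[ u₁ ≤ n ] ∑[ u₂ ≤ n ] ∑[ v₁ ≤ n ] ∑[ v₂ ≤ n ] ∑[ m ≤ n ] F m u₁ v₁ * G m u₂ v₂
      ≈⟨ ∑-cong n (λ u₁ → ∑-cong n λ u₂ → ∑-cong n λ v₁ → ∑-cong n λ v₂ →
           -- `suc u ℕ.* suc v` computes to the successor of `v ℕ.+ u ℕ.* suc v`, which is the
           -- predecessor that `degrees` asks for.
           degrees n (v₁ ℕ.+ u₁ ℕ.* suc v₁) (v₂ ℕ.+ u₂ ℕ.* suc v₂) (f (suc v₁)) (g (suc v₂))) ⟩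
    quadruple (λ v₁ v₂ → f v₁ * g v₂) n ∎
    where
    F G : ℕ → ℕ → ℕ → Carrier
    F m u v = [ u ℕ.* v ℕ.≟ m ] * f v
    G m u v = [ u ℕ.* v ℕ.≟ n ∸ m ] * g v

  -- The part i < j is written with the names exchanged, so that both off-diagonal parts carry the
  -- constraint used in `quadruple>`.
  ∑-trichotomy : ∀ n (G : ℕ → ℕ → Carrier) → ∑[ i ≤ n ] ∑[ j ≤ n ] G i j ≈
    (∑[ i ≤ n ] ∑[ j ≤ n ] [ j ℕ.<? i ] * G i j) + (∑[ i ≤ n ] ∑[ j ≤ n ] [ j ℕ.<? i ] * G j i)
    + (∑[ i ≤ n ] G i i)
  ∑-trichotomy n G = begin
    ∑[ i ≤ n ] ∑[ j ≤ n ] G i j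
      ≈⟨ ∑-cong n (λ i → ∑-cong n λ j → split (suc i) (suc j)) ⟩
    ∑[ i ≤ n ] ∑[ j ≤ n ] ([ j ℕ.<? i ] * G i j + [ i ℕ.<? j ] * G i j + [ i ℕ.≟ j ] * G i j)
      ≈⟨ ∑-cong n (λ i → trans (∑-+ n _ _) (+-congʳ (∑-+ n _ _))) ⟩
    ∑[ i ≤ n ] ((∑[ j ≤ n ] [ j ℕ.<? i ] * G i j) + (∑[ j ≤ n ] [ i ℕ.<? j ] * G i j)
      + (∑[ j ≤ n ] [ i ℕ.≟ j ] * G i j))
      ≈⟨ trans (∑-+ n _ _) (+-congʳ (∑-+ n _ _)) ⟩
    (∑[ i ≤ n ] ∑[ j ≤ n ] [ j ℕ.<? i ] * G i j) + (∑[ i ≤ n ] ∑[ j ≤ n ] [ i ℕ.<? j ] * G i j)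
      + (∑[ i ≤ n ] ∑[ j ≤ n ] [ i ℕ.≟ j ] * G i j)
      ≈⟨ +-cong (+-congˡ (∑-swap n n (λ i j → [ i ℕ.<? j ] * G i j)))
           (∑-cong< n λ i i<n → ∑-point n i (G (suc i)) i<n) ⟩
    (∑[ i ≤ n ] ∑[ j ≤ n ] [ j ℕ.<? i ] * G i j) + (∑[ i ≤ n ] ∑[ j ≤ n ] [ j ℕ.<? i ] * G j i)
      + (∑[ i ≤ n ] G i i) ∎
    where
    split : ∀ i j → G i j ≈ [ j ℕ.<? i ] * G i j + [ i ℕ.<? j ] * G i j + [ i ℕ.≟ j ] * G i j
    split i j with ℕ.<-cmp i j
    ... | tri< i<j i≢j j≮i = sym (trans (+-cong (+-cong (no*≈0 (j ℕ.<? i) j≮i) (yes*≈ (i ℕ.<? j) i<j))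
            (no*≈0 (i ℕ.≟ j) i≢j)) (trans (+-identityʳ _) (+-identityˡ _)))
    ... | tri≈ i≮j i≡j j≮i = sym (trans (+-cong (+-cong (no*≈0 (j ℕ.<? i) j≮i) (no*≈0 (i ℕ.<? j) i≮j))
            (yes*≈ (i ℕ.≟ j) i≡j)) (trans (+-congʳ (+-identityˡ _)) (+-identityˡ _)))
    ... | tri> i≮j i≢j j<i = sym (trans (+-cong (+-cong (yes*≈ (j ℕ.<? i) j<i) (no*≈0 (i ℕ.<? j) i≮j))
            (no*≈0 (i ℕ.≟ j) i≢j)) (trans (+-identityʳ _) (+-identityʳ _)))

  quadruple>≈ : ∀ F n → quadruple> F n ≈ ∑[ u₁ ≤ n ] ∑[ u₂ ≤ n ] [ u₂ ℕ.<? u₁ ] *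
    (∑[ v₁ ≤ n ] ∑[ v₂ ≤ n ] [ u₁ ℕ.* v₁ ℕ.+ u₂ ℕ.* v₂ ℕ.≟ n ] * F v₁ v₂)
  quadruple>≈ F n = ∑-cong n λ u₁ → ∑-cong n λ u₂ → sym (trans (∑-*ˡ n _ _) (∑-cong n λ v₁ →
    trans (∑-*ˡ n _ _) (∑-cong n λ v₂ → trans (sym (*-assoc _ _ _))
      (*-congʳ (sym ([×-dec] (suc u₂ ℕ.<? suc u₁) (suc u₁ ℕ.* suc v₁ ℕ.+ suc u₂ ℕ.* suc v₂ ℕ.≟ n)))))))

  -- Trichotomy on (u₁, u₂). For u₁ = u₂ = u the exponent is u (v₁ + v₂), and grouping by v = v₁ +
  -- v₂ produces a series of type `D`.
  stuffle : ∀ F n → quadruple F n ≈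
    quadruple> F n + quadruple> (λ v₁ v₂ → F v₂ v₁) n + D (λ _ v → ∑[ t ≤ v ∸ 1 ] F t (v ∸ t)) n
  stuffle F n = trans (∑-trichotomy n G) (+-cong (+-cong (sym (quadruple>≈ F n)) (begin
    ∑[ u₁ ≤ n ] ∑[ u₂ ≤ n ] [ u₂ ℕ.<? u₁ ] * G u₂ u₁
      ≈⟨ ∑-cong n (λ u₁ → ∑-cong n λ u₂ → *-congˡ (trans
           (∑-swap n n (λ v₁ v₂ → [ suc u₂ ℕ.* v₁ ℕ.+ suc u₁ ℕ.* v₂ ℕ.≟ n ] * F v₁ v₂))
           (∑-cong n λ v₁ → ∑-cong n λ v₂ → *-congʳ ([]-cong
             (suc u₂ ℕ.* suc v₂ ℕ.+ suc u₁ ℕ.* suc v₁ ℕ.≟ n) (suc u₁ ℕ.* suc v₁ ℕ.+ suc u₂ ℕ.* suc v₂ ℕ.≟ n)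
             (≡.trans (ℕ.+-comm (suc u₁ ℕ.* suc v₁) _)) (≡.trans (ℕ.+-comm (suc u₂ ℕ.* suc v₂) _)))))) ⟩
    ∑[ u₁ ≤ n ] ∑[ u₂ ≤ n ] [ u₂ ℕ.<? u₁ ] *
      (∑[ v₁ ≤ n ] ∑[ v₂ ≤ n ] [ u₁ ℕ.* v₁ ℕ.+ u₂ ℕ.* v₂ ℕ.≟ n ] * F v₂ v₁)
      ≈⟨ quadruple>≈ (λ v₁ v₂ → F v₂ v₁) n ⟨
    quadruple> (λ v₁ v₂ → F v₂ v₁) n ∎))
    (∑-cong n λ u → trans
      (∑-antidiagonals n (λ v₁ v₂ → [ suc u ℕ.* v₁ ℕ.+ suc u ℕ.* v₂ ℕ.≟ n ] * F v₁ v₂) (vanish u))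
      (∑-cong n λ m → trans (∑-cong< m λ i i<m → *-congʳ ([]-cong
        (suc u ℕ.* suc i ℕ.+ suc u ℕ.* (m ∸ i) ℕ.≟ n) (suc u ℕ.* suc m ℕ.≟ n)
        (≡.trans (≡.sym (combine u i m i<m))) (≡.trans (combine u i m i<m))))
        (sym (∑-*ˡ m _ _)))))
    where
    G : ℕ → ℕ → Carrier
    G u₁ u₂ = ∑[ v₁ ≤ n ] ∑[ v₂ ≤ n ] [ u₁ ℕ.* v₁ ℕ.+ u₂ ℕ.* v₂ ℕ.≟ n ] * F v₁ v₂

    combine : ∀ u i m → i ℕ.< m → suc u ℕ.* suc i ℕ.+ suc u ℕ.* (m ∸ i) ≡ suc u ℕ.* suc m
    combine u i m i<m = ≡.trans (≡.sym (ℕ.*-distribˡ-+ (suc u) (suc i) (m ∸ i)))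
      (≡.cong (λ k → suc u ℕ.* suc k) (ℕ.m+[n∸m]≡n (ℕ.<⇒≤ i<m)))

    vanish : ∀ u i j → n ℕ.< suc i ℕ.+ suc j →
      [ suc u ℕ.* suc i ℕ.+ suc u ℕ.* suc j ℕ.≟ n ] * F (suc i) (suc j) ≈ 0#
    vanish u i j n<i+j = no*≈0 (suc u ℕ.* suc i ℕ.+ suc u ℕ.* suc j ℕ.≟ n) λ eq →
      ℕ.<⇒≢ (ℕ.<-≤-trans n<i+j (ℕ.+-mono-≤ (ℕ.m≤n*m (suc i) (suc u)) (ℕ.m≤n*m (suc j) (suc u)))) (≡.sym eq)

  private
    module _ (F : ℕ → ℕ → Carrier) (n : ℕ) where
      X : ℕ → ℕ → ℕ → ℕ → Carrier
      X u₁ u₂ v₁ v₂ = [ u₁ ℕ.* v₁ ℕ.+ u₂ ℕ.* v₂ ℕ.≟ n ] * F v₁ v₂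

      -- The substitution (u₁, u₂, v₁, v₂) ↦ (u₁ + u₂, u₁, v₂, v₁ - v₂).
      descending : ∑[ u₁ ≤ n ] ∑[ u₂ ≤ n ] ∑[ v₁ ≤ n ] ∑[ v₂ ≤ n ] [ v₂ ℕ.<? v₁ ] * X u₁ u₂ v₁ v₂
        ≈ quadruple> (λ v₁ v₂ → F (v₁ ℕ.+ v₂) v₁) n
      descending = begin
        ∑[ u₁ ≤ n ] ∑[ u₂ ≤ n ] ∑[ v₁ ≤ n ] ∑[ v₂ ≤ n ] [ v₂ ℕ.<? v₁ ] * X u₁ u₂ v₁ v₂
          ≈⟨ ∑-cong n (λ u₁ → ∑-cong n λ u₂ → trans
               (∑-swap n n (λ v₁ v₂ → [ v₂ ℕ.<? v₁ ] * X (suc u₁) (suc u₂) v₁ v₂))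
               (∑-cong n λ v → ∑-shift (suc v) n (λ v₁ → X (suc u₁) (suc u₂) v₁ (suc v)) λ i n≤i →
                 no*≈0 (suc u₁ ℕ.* suc i ℕ.+ suc u₂ ℕ.* suc v ℕ.≟ n) λ eq → ℕ.<⇒≢ (ℕ.<-≤-trans (ℕ.s≤s n≤i)
                   (ℕ.≤-trans (ℕ.m≤n*m (suc i) (suc u₁)) (ℕ.m≤m+n _ (suc u₂ ℕ.* suc v)))) (≡.sym eq))) ⟩
        ∑[ u₁ ≤ n ] ∑[ u₂ ≤ n ] ∑[ v ≤ n ] ∑[ t ≤ n ] X u₁ u₂ (v ℕ.+ t) v
          ≈⟨ ∑-cong n (λ u₁ → ∑-cong n λ u₂ → ∑-cong n λ v → ∑-cong n λ t → *-congʳ ([]-cong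
               (suc u₁ ℕ.* (suc v ℕ.+ suc t) ℕ.+ suc u₂ ℕ.* suc v ℕ.≟ n)
               ((suc u₁ ℕ.+ suc u₂) ℕ.* suc v ℕ.+ suc u₁ ℕ.* suc t ℕ.≟ n)
               (≡.trans (≡.sym (rearrange (suc u₁) (suc u₂) (suc v) (suc t))))
               (≡.trans (rearrange (suc u₁) (suc u₂) (suc v) (suc t))))) ⟩
        ∑[ u₁ ≤ n ] ∑[ u₂ ≤ n ] Y (u₁ ℕ.+ u₂) u₁
          -- `∑-shift` read backwards: u₁ + u₂ becomes an independent variable that is constrained
          -- to exceed u₁.
          ≈⟨ ∑-cong n (λ u₁ → ∑-shift (suc u₁) n (λ u₂ → Y u₂ (suc u₁)) λ i n≤i →
               ∑-0 n λ v _ → ∑-0 n λ t _ →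
                 no*≈0 (suc i ℕ.* suc v ℕ.+ suc u₁ ℕ.* suc t ℕ.≟ n) λ eq → ℕ.<⇒≢ (ℕ.<-≤-trans (ℕ.s≤s n≤i)
                   (ℕ.≤-trans (ℕ.m≤m*n (suc i) (suc v)) (ℕ.m≤m+n _ (suc u₁ ℕ.* suc t)))) (≡.sym eq)) ⟨
        ∑[ u₁ ≤ n ] ∑[ u₂ ≤ n ] [ u₁ ℕ.<? u₂ ] * Y u₂ u₁
          ≈⟨ ∑-swap n n (λ u₁ u₂ → [ u₁ ℕ.<? u₂ ] * Y u₂ u₁) ⟩
        ∑[ u₁ ≤ n ] ∑[ u₂ ≤ n ] [ u₂ ℕ.<? u₁ ] * Y u₁ u₂
          ≈⟨ quadruple>≈ _ n ⟨
        quadruple> (λ v₁ v₂ → F (v₁ ℕ.+ v₂) v₁) n ∎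
        where
        Y : ℕ → ℕ → Carrier
        Y u₁ u₂ = ∑[ v₁ ≤ n ] ∑[ v₂ ≤ n ] [ u₁ ℕ.* v₁ ℕ.+ u₂ ℕ.* v₂ ℕ.≟ n ] * F (v₁ ℕ.+ v₂) v₁

        rearrange : ∀ u₁ u₂ v t → u₁ ℕ.* (v ℕ.+ t) ℕ.+ u₂ ℕ.* v ≡ (u₁ ℕ.+ u₂) ℕ.* v ℕ.+ u₁ ℕ.* t
        rearrange = NatSolver.solve 4 (λ u₁ u₂ v t →
          u₁ NatSolver.:* (v NatSolver.:+ t) NatSolver.:+ u₂ NatSolver.:* v NatSolver.:=
          (u₁ NatSolver.:+ u₂) NatSolver.:* v NatSolver.:+ u₁ NatSolver.:* t) ≡.refl
          where module NatSolver = Data.Nat.Solver.+-*-Solver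

  -- Trichotomy on (v₁, v₂). For v₁ = v₂ = v the exponent is (u₁ + u₂) v, and a given sum u = u₁ +
  -- u₂ arises u - 1 times.
  shuffle : ∀ F n → quadruple F n ≈
    quadruple> (λ v₁ v₂ → F (v₁ ℕ.+ v₂) v₁) n + quadruple> (λ v₁ v₂ → F v₁ (v₁ ℕ.+ v₂)) n
    + D (λ u v → fromℕ (u ∸ 1) * F v v) n
  shuffle F n = begin
    quadruple F n
      ≈⟨ ∑-cong n (λ u₁ → ∑-cong n λ u₂ → ∑-trichotomy n (X F n (suc u₁) (suc u₂))) ⟩
    ∑[ u₁ ≤ n ] ∑[ u₂ ≤ n ] (
      (∑[ v₁ ≤ n ] ∑[ v₂ ≤ n ] [ v₂ ℕ.<? v₁ ] * X F n u₁ u₂ v₁ v₂)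
      + (∑[ v₁ ≤ n ] ∑[ v₂ ≤ n ] [ v₂ ℕ.<? v₁ ] * X F n u₁ u₂ v₂ v₁)
      + (∑[ v ≤ n ] X F n u₁ u₂ v v))
      ≈⟨ trans (∑-cong n λ u₁ → trans (∑-+ n _ _) (+-congʳ (∑-+ n _ _)))
           (trans (∑-+ n _ _) (+-congʳ (∑-+ n _ _))) ⟩
    (∑[ u₁ ≤ n ] ∑[ u₂ ≤ n ] ∑[ v₁ ≤ n ] ∑[ v₂ ≤ n ] [ v₂ ℕ.<? v₁ ] * X F n u₁ u₂ v₁ v₂)
    + (∑[ u₁ ≤ n ] ∑[ u₂ ≤ n ] ∑[ v₁ ≤ n ] ∑[ v₂ ≤ n ] [ v₂ ℕ.<? v₁ ] * X F n u₁ u₂ v₂ v₁)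
    + (∑[ u₁ ≤ n ] ∑[ u₂ ≤ n ] ∑[ v ≤ n ] X F n u₁ u₂ v v)
      ≈⟨ +-cong (+-cong (descending F n) (trans ascending (descending (flip F) n))) diagonal ⟩
    quadruple> (λ v₁ v₂ → F (v₁ ℕ.+ v₂) v₁) n + quadruple> (λ v₁ v₂ → F v₁ (v₁ ℕ.+ v₂)) n
    + D (λ u v → fromℕ (u ∸ 1) * F v v) n ∎
    where
    ascending : ∑[ u₁ ≤ n ] ∑[ u₂ ≤ n ] ∑[ v₁ ≤ n ] ∑[ v₂ ≤ n ] [ v₂ ℕ.<? v₁ ] * X F n u₁ u₂ v₂ v₁
      ≈ ∑[ u₁ ≤ n ] ∑[ u₂ ≤ n ] ∑[ v₁ ≤ n ] ∑[ v₂ ≤ n ] [ v₂ ℕ.<? v₁ ] * X (flip F) n u₁ u₂ v₁ v₂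
    ascending = trans
      (∑-swap n n (λ u₁ u₂ → ∑[ v₁ ≤ n ] ∑[ v₂ ≤ n ] [ v₂ ℕ.<? v₁ ] * X F n u₁ u₂ v₂ v₁))
      (∑-cong n λ u₁ → ∑-cong n λ u₂ → ∑-cong n λ v₁ → ∑-cong n λ v₂ → *-congˡ (*-congʳ ([]-cong
        (suc u₂ ℕ.* suc v₂ ℕ.+ suc u₁ ℕ.* suc v₁ ℕ.≟ n) (suc u₁ ℕ.* suc v₁ ℕ.+ suc u₂ ℕ.* suc v₂ ℕ.≟ n)
        (≡.trans (ℕ.+-comm (suc u₁ ℕ.* suc v₁) _)) (≡.trans (ℕ.+-comm (suc u₂ ℕ.* suc v₂) _)))))

    diagonal : ∑[ u₁ ≤ n ] ∑[ u₂ ≤ n ] ∑[ v ≤ n ] X F n u₁ u₂ v v ≈ D (λ u v → fromℕ (u ∸ 1) * F v v) n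
    diagonal = trans
      (∑-antidiagonals n (λ u₁ u₂ → ∑[ v ≤ n ] X F n u₁ u₂ v v) λ i j n<i+j → ∑-0 n λ v _ →
        no*≈0 (suc i ℕ.* suc v ℕ.+ suc j ℕ.* suc v ℕ.≟ n) λ eq → ℕ.<⇒≢ (ℕ.<-≤-trans n<i+j
          (ℕ.+-mono-≤ (ℕ.m≤m*n (suc i) (suc v)) (ℕ.m≤m*n (suc j) (suc v)))) (≡.sym eq))
      (∑-cong n λ m → begin
        ∑[ i ≤ m ] ∑[ v ≤ n ] X F n i (suc m ∸ i) v v
          ≈⟨ ∑-cong< m (λ i i<m → ∑-cong n λ v → *-congʳ ([]-cong
               (suc i ℕ.* suc v ℕ.+ (m ∸ i) ℕ.* suc v ℕ.≟ n) (suc m ℕ.* suc v ℕ.≟ n)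
               (≡.trans (≡.sym (combine i m v i<m))) (≡.trans (combine i m v i<m)))) ⟩
        ∑[ i ≤ m ] ∑[ v ≤ n ] [ suc m ℕ.* v ℕ.≟ n ] * F v v
          ≈⟨ ∑-const m _ ⟩
        fromℕ m * (∑[ v ≤ n ] [ suc m ℕ.* v ℕ.≟ n ] * F v v)
          ≈⟨ trans (∑-*ˡ n _ _) (∑-cong n λ v →
               solve 3 (λ x b f → x :* (b :* f) := b :* (x :* f)) _ _ _) ⟩
        ∑[ v ≤ n ] [ suc m ℕ.* v ℕ.≟ n ] * (fromℕ m * F v v) ∎)
      where
      combine : ∀ i m v → i ℕ.< m → suc i ℕ.* suc v ℕ.+ (m ∸ i) ℕ.* suc v ≡ suc m ℕ.* suc v
      combine i m v i<m = ≡.trans (≡.sym (ℕ.*-distribʳ-+ (suc v) (suc i) (m ∸ i)))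
        (≡.cong (λ k → suc k ℕ.* suc v) (ℕ.m+[n∸m]≡n (ℕ.<⇒≤ i<m)))

  -- Convolutions of binomial coefficients

  ∑∇-shift : ∀ k l (G : ℕ → ℕ → Carrier) → (∀ i j → i ℕ.< l → G i j ≈ 0#) →
    ∑∇ (k ℕ.+ l) G ≈ ∑∇ k (λ i j → G (i ℕ.+ l) j)
  ∑∇-shift k zero    G _ = trans (reflexive (≡.cong (λ m → ∑∇ m G) (ℕ.+-identityʳ k)))
    (∑∇-cong k λ i j _ → reflexive (≡.cong (λ m → G m j) (≡.sym (ℕ.+-identityʳ i))))
  ∑∇-shift k (suc l) G vanish = begin
    ∑∇ (k ℕ.+ suc l) G
      ≡⟨ ≡.cong (λ m → ∑∇ m G) (ℕ.+-suc k l) ⟩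
    ∑∇ (suc (k ℕ.+ l)) G
      ≈⟨ trans (∑∇-head (k ℕ.+ l) G) (trans (+-congʳ (vanish 0 _ (ℕ.s≤s ℕ.z≤n))) (+-identityˡ _)) ⟩
    ∑∇ (k ℕ.+ l) (G ∘ suc)
      ≈⟨ ∑∇-shift k l (G ∘ suc) (λ i j i<l → vanish (suc i) j (ℕ.s≤s i<l)) ⟩
    ∑∇ k (λ i j → G (suc (i ℕ.+ l)) j)
      ≈⟨ ∑∇-cong k (λ i j _ → reflexive (≡.cong (λ m → G m j) (≡.sym (ℕ.+-suc i l)))) ⟩
    ∑∇ k (λ i j → G (i ℕ.+ suc l) j) ∎

  ∑∇-pick : ∀ k l (G : ℕ → ℕ → Carrier) → ∑∇ (k ℕ.+ l) (λ i j → [ i ℕ.≟ k ] * G i j) ≈ G k l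
  ∑∇-pick zero    zero    G = trans (∑∇-zero _) (*-identityˡ _)
  ∑∇-pick zero    (suc l) G = trans (∑∇-head l _)
    (trans (+-cong (*-identityˡ _) (∑∇-0 l λ _ _ _ → zeroˡ _)) (+-identityʳ _))
  ∑∇-pick (suc k) l       G = trans (∑∇-head (k ℕ.+ l) _)
    (trans (+-cong (zeroˡ _) (∑∇-pick k l (G ∘ suc))) (+-identityˡ _))

  module _ (k l : ℕ) (x y gᶜ gᵇ : ℕ → Carrier) where
    private
      m = k ℕ.+ l

    -- In the application x and y are β of the classes a and b, and gᶜ is g̃ of the class a + b.
    -- After exchanging the sums, the inner sum for fixed s is alternating in i or in j:
    -- orthogonality singles out s = k for gᵇ, and the Vandermonde sum gives the coefficient of gᶜ.
    β-shuffle-half :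
      ∑∇ m (λ i j → bin i k * (y j * gᶜ i + ∑∇ m (λ s t →
        x s * (sign (suc j) * bin s j * gᶜ t + sign (s ℕ.+ i) * bin s i * gᵇ t))))
      ≈ ∑∇ m (λ i j → bin i k * (y j * gᶜ i)) + (x k * gᵇ l - ∑∇ m (λ s t → bin t l * (x s * gᶜ t)))
    β-shuffle-half = begin
      ∑∇ m (λ i j → bin i k * (y j * gᶜ i + ∑∇ m (λ s t →
        x s * (sign (suc j) * bin s j * gᶜ t + sign (s ℕ.+ i) * bin s i * gᵇ t))))
        ≈⟨ trans (∑∇-cong m λ i j _ → trans (distribˡ _ _ _) (+-congˡ (∑∇-*ˡ m _ _))) (∑∇-+ m _ _) ⟩
      ∑∇ m (λ i j → bin i k * (y j * gᶜ i)) + ∑∇ m (λ i j → ∑∇ m (λ s t →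
        bin i k * (x s * (sign (suc j) * bin s j * gᶜ t + sign (s ℕ.+ i) * bin s i * gᵇ t))))
        ≈⟨ +-congˡ (begin
             ∑∇ m (λ i j → ∑∇ m (λ s t →
               bin i k * (x s * (sign (suc j) * bin s j * gᶜ t + sign (s ℕ.+ i) * bin s i * gᵇ t))))
               ≈⟨ ∑∇-swap m m (λ i j s t →
                    bin i k * (x s * (sign (suc j) * bin s j * gᶜ t + sign (s ℕ.+ i) * bin s i * gᵇ t))) ⟩
             ∑∇ m (λ s t → ∑∇ m (λ i j →
               bin i k * (x s * (sign (suc j) * bin s j * gᶜ t + sign (s ℕ.+ i) * bin s i * gᵇ t))))
               ≈⟨ ∑∇-cong m inner ⟩
             ∑∇ m (λ s t → [ s ℕ.≟ k ] * (x s * gᵇ t) + - 1# * (bin t l * (x s * gᶜ t)))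
               ≈⟨ trans (∑∇-+ m _ _) (+-cong (∑∇-pick k l (λ s t → x s * gᵇ t))
                    (trans (sym (∑∇-*ˡ m _ _)) (-1*x≈-x _))) ⟩
             x k * gᵇ l - ∑∇ m (λ s t → bin t l * (x s * gᶜ t)) ∎) ⟩
      ∑∇ m (λ i j → bin i k * (y j * gᶜ i)) + (x k * gᵇ l - ∑∇ m (λ s t → bin t l * (x s * gᶜ t))) ∎
      where
      inner : ∀ s t → s ℕ.+ t ≡ m →
        ∑∇ m (λ i j → bin i k * (x s * (sign (suc j) * bin s j * gᶜ t + sign (s ℕ.+ i) * bin s i * gᵇ t)))
        ≈ [ s ℕ.≟ k ] * (x s * gᵇ t) + - 1# * (bin t l * (x s * gᶜ t))
      inner s t s+t≡m = begin
        ∑∇ m (λ i j → bin i k * (x s * (sign (suc j) * bin s j * gᶜ t + sign (s ℕ.+ i) * bin s i * gᵇ t)))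
          ≈⟨ trans (∑∇-cong m λ i j _ → trans
               (*-congˡ (*-congˡ (+-congˡ (*-congʳ (*-congʳ (^-homo-* (- 1#) s i))))))
               (solve 9 (λ b x σ c g σ′ τ d g′ →
                 b :* (x :* (:- :1 :* σ :* c :* g :+ σ′ :* τ :* d :* g′))
                 := σ′ :* (x :* g′) :* (τ :* d :* b) :+ :- :1 :* (x :* g) :* (σ :* c :* b)) (bin i k) (x s) (sign j) (bin s j) (gᶜ t) (sign s) (sign i) (bin s i) (gᵇ t)))
               (∑∇-+ m _ _) ⟩
        ∑∇ m (λ i j → sign s * (x s * gᵇ t) * (sign i * bin s i * bin i k)) +
        ∑∇ m (λ i j → - 1# * (x s * gᶜ t) * (sign j * bin s j * bin i k))
          ≈⟨ +-cong (sym (∑∇-*ˡ m _ _)) (trans (sym (∑∇-*ˡ m _ _)) (*-congˡ (∑∇-flip m _))) ⟩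
        sign s * (x s * gᵇ t) * alternating s m (λ i _ → bin i k) +
        - 1# * (x s * gᶜ t) * alternating s m (λ _ j → bin j k)
          ≈⟨ +-cong (*-congˡ (alternating-orthogonality k (ℕ.m+n≤o⇒m≤o s (ℕ.≤-reflexive s+t≡m))))
               (*-congˡ (trans (reflexive (≡.cong (λ m → alternating s m (λ _ j → bin j k)) (≡.sym s+t≡m)))
                 (alternating-vandermonde s t k l s+t≡m))) ⟩
        sign s * (x s * gᵇ t) * (sign s * [ s ℕ.≟ k ]) + - 1# * (x s * gᶜ t) * bin t l
          ≈⟨ solve 6 (λ σ x g d g′ b →
               σ :* (x :* g) :* (σ :* d) :+ :- :1 :* (x :* g′) :* b
               := σ :* σ :* (d :* (x :* g)) :+ :- :1 :* (b :* (x :* g′))) _ _ _ _ _ _ ⟩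
        sign s * sign s * ([ s ℕ.≟ k ] * (x s * gᵇ t)) + - 1# * (bin t l * (x s * gᶜ t))
          ≈⟨ +-congʳ (trans (*-congʳ (sign²≈1 s)) (*-identityˡ _)) ⟩
        [ s ℕ.≟ k ] * (x s * gᵇ t) + - 1# * (bin t l * (x s * gᶜ t)) ∎

  β-shuffle : ∀ k l (x y gᵃ gᵇ gᶜ : ℕ → Carrier) → let m = k ℕ.+ l in
    ∑∇ m (λ i j → bin i k * (y j * gᶜ i + ∑∇ m (λ s t →
      x s * (sign (suc j) * bin s j * gᶜ t + sign (s ℕ.+ i) * bin s i * gᵇ t)))) +
    ∑∇ m (λ i j → bin i l * (x j * gᶜ i + ∑∇ m (λ s t →
      y s * (sign (suc j) * bin s j * gᶜ t + sign (s ℕ.+ i) * bin s i * gᵃ t))))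
    ≈ x k * gᵇ l + y l * gᵃ k
  β-shuffle k l x y gᵃ gᵇ gᶜ = begin
    _ ≈⟨ +-cong (β-shuffle-half k l x y gᶜ gᵇ)
           (trans (reflexive (≡.cong half (ℕ.+-comm k l)))
             (trans (β-shuffle-half l k y x gᶜ gᵃ) (reflexive (≡.cong half′ (ℕ.+-comm l k))))) ⟩
    ∑∇ m (λ i j → bin i k * (y j * gᶜ i)) + (x k * gᵇ l - ∑∇ m (λ s t → bin t l * (x s * gᶜ t))) +
    half′ m
      -- Flipped, the leading sum of the second half is the sum subtracted in the first, and
      -- conversely; all terms with gᶜ cancel.
      ≈⟨ +-congˡ (+-cong (∑∇-flip m _) (+-congˡ (-‿cong (∑∇-flip m _)))) ⟩
    A + (x k * gᵇ l - B′) + (B′ + (y l * gᵃ k - A))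
      ≈⟨ solve 4 (λ a p b q → a :+ (p :- b) :+ (b :+ (q :- a)) := p :+ q) A _ B′ _ ⟩
    x k * gᵇ l + y l * gᵃ k ∎
    where
    m = k ℕ.+ l
    A = ∑∇ m (λ i j → bin i k * (y j * gᶜ i))
    B′ = ∑∇ m (λ s t → bin t l * (x s * gᶜ t))

    half half′ : ℕ → Carrier
    half m = ∑∇ m (λ i j → bin i l * (x j * gᶜ i + ∑∇ m (λ s t →
      y s * (sign (suc j) * bin s j * gᶜ t + sign (s ℕ.+ i) * bin s i * gᵃ t))))
    half′ m = ∑∇ m (λ i j → bin i l * (x j * gᶜ i)) +
      (y l * gᵃ k - ∑∇ m (λ s t → bin t k * (y s * gᶜ t)))

  private
    pick-terms : ∀ k m (p q : ℕ → Carrier) →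
      ∑∇ (suc m) (λ i j → bin i k * ([ i ℕ.≟ 1 ] * p (suc j) - [ i ℕ.≟ 0 ] * p j + [ j ℕ.≟ 0 ] * q i))
      ≈ bin 1 k * p (suc m) - bin 0 k * p (suc m) + bin (suc m) k * q (suc m)
    pick-terms k m p q = begin
      ∑∇ (suc m) (λ i j → bin i k * ([ i ℕ.≟ 1 ] * p (suc j) - [ i ℕ.≟ 0 ] * p j + [ j ℕ.≟ 0 ] * q i))
        ≈⟨ ∑∇-cong (suc m) (λ i j _ → solve 7 (λ b d₁ p′ d₀ p e q →
             b :* (d₁ :* p′ :- d₀ :* p :+ e :* q)
             := d₁ :* (b :* p′) :+ d₀ :* (:- (b :* p)) :+ e :* (b :* q)) (bin i k) [ i ℕ.≟ 1 ] (p (suc j)) [ i ℕ.≟ 0 ] (p j) [ j ℕ.≟ 0 ] (q i)) ⟩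
      ∑∇ (suc m) (λ i j → [ i ℕ.≟ 1 ] * (bin i k * p (suc j)) + [ i ℕ.≟ 0 ] * (- (bin i k * p j))
        + [ j ℕ.≟ 0 ] * (bin i k * q i))
        ≈⟨ trans (∑∇-+ (suc m) _ _) (+-congʳ (∑∇-+ (suc m) _ _)) ⟩
      ∑∇ (suc m) (λ i j → [ i ℕ.≟ 1 ] * (bin i k * p (suc j)))
        + ∑∇ (suc m) (λ i j → [ i ℕ.≟ 0 ] * (- (bin i k * p j)))
        + ∑∇ (suc m) (λ i j → [ j ℕ.≟ 0 ] * (bin i k * q i))
        ≈⟨ +-cong (+-cong (∑∇-pick 1 m (λ i j → bin i k * p (suc j)))
             (∑∇-pick 0 (suc m) (λ i j → - (bin i k * p j))))
             (trans (∑∇-flip (suc m) _) (∑∇-pick 0 (suc m) (λ i j → bin j k * q j))) ⟩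
      bin 1 k * p (suc m) - bin 0 k * p (suc m) + bin (suc m) k * q (suc m) ∎

  -- For k = 0 the terms at i = 1 and i = 0 cancel in every positive degree. In degree zero there is
  -- no i = 1, and the surviving -p 0 is the source of the defect at r = s = 1.
  ε-shuffle : ∀ k l (p q : ℕ → Carrier) →
    ∑∇ (k ℕ.+ l) (λ i j → bin i k * ([ i ℕ.≟ 1 ] * p (suc j) - [ i ℕ.≟ 0 ] * p j + [ j ℕ.≟ 0 ] * q i))
    ≈ [ k ℕ.≟ 1 ] * p (suc l) - [ k ℕ.≟ 0 ] * [ l ℕ.≟ 0 ] * p 0 + bin (k ℕ.+ l) k * q (k ℕ.+ l)
  ε-shuffle zero    zero    p q = trans (∑∇-zero _) (trans (*-congʳ (+-identityʳ 1#))
    (trans (solve 3 (λ p p′ q → :1 :* (:0 :* p′ :- :1 :* p :+ :1 :* q) := :0 :* p′ :- :1 :* :1 :* p :+ :1 :* q) (p 0) (p 1) (q 0)) (+-congˡ (*-congʳ (sym (+-identityʳ 1#))))))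
  ε-shuffle zero    (suc l) p q = trans (pick-terms 0 l p q) (+-congʳ
    (solve 4 (λ b p p′ p₀ → b :* p :- b :* p := :0 :* p′ :- :1 :* :0 :* p₀) (bin 0 0) (p (suc l)) (p (suc (suc l))) (p 0)))
  ε-shuffle (suc k) l p q = trans (pick-terms (suc k) (k ℕ.+ l) p q) (+-congʳ (rest k))
    where
    rest : ∀ k → bin 1 (suc k) * p (suc (k ℕ.+ l)) - bin 0 (suc k) * p (suc (k ℕ.+ l)) ≈
      [ suc k ℕ.≟ 1 ] * p (suc l) - [ suc k ℕ.≟ 0 ] * [ l ℕ.≟ 0 ] * p 0
    rest zero    = +-cong (*-congʳ (+-identityʳ 1#))
      (-‿cong (trans (zeroˡ _) (sym (trans (*-congʳ (zeroˡ _)) (zeroˡ _)))))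
    rest (suc k) = +-cong (trans (zeroˡ _) (sym (zeroˡ _)))
      (-‿cong (trans (zeroˡ _) (sym (trans (*-congʳ (zeroˡ _)) (zeroˡ _)))))

-- Twisted convolutions of divided powers

module DividedPowers {c ℓ₁ ℓ₂} (K : HeytingField c ℓ₁ ℓ₂) (char0 : CharacteristicZero K)
  (N : ℕ) .{{_ : NonZero N}} where
  open SeriesCalculus K char0

  -- A power of ν absorbs the factor (-1)^s / N^s of g̃; h is the factor 1/(2N) of β, ε and P.
  ν h : Carrier
  ν = - 1/ N
  h = 1/ 2 * 1/ N

  -- The weight with which v enters g̃ (suc k).
  E : ℕ → ℕ → Carrier
  E k v = ν ^ suc k * (e^ fromℕ v) k

  1/N^≈ : ∀ k → 1/ N ^ k ≈ sign k * ν ^ k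
  1/N^≈ k = trans (^-congˡ k (solve 1 (λ n → n := :- :1 :* :- n) (1/ N))) (^-distrib-* (- 1#) ν k)

  Nν≈-1 : fromℕ N * ν ≈ - 1#
  Nν≈-1 = trans (sym (-‿distribʳ-* _ _)) (-‿cong (fromℕ*1/ N))

  2h≈-ν : h + h ≈ - ν
  2h≈-ν = begin
    1/ 2 * 1/ N + 1/ 2 * 1/ N
      ≈⟨ solve 2 (λ t n → t :* n :+ t :* n := (:1 :+ (:1 :+ :0)) :* t :* n) (1/ 2) (1/ N) ⟩
    fromℕ 2 * 1/ 2 * 1/ N
      ≈⟨ trans (*-congʳ (fromℕ*1/ 2)) (*-identityˡ _) ⟩
    1/ N
      ≈⟨ -‿involutive _ ⟨
    - ν ∎

  E-suc : ∀ k v → fromℕ (suc k) * E (suc k) v ≈ ν * fromℕ v * E k v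
  E-suc k v = begin
    fromℕ (suc k) * (ν ^ suc (suc k) * (e^ fromℕ v) (suc k))
      ≈⟨ solve 4 (λ n c p e → n :* (c :* p :* e) := c :* p :* (n :* e)) _ ν (ν ^ suc k) _ ⟩
    ν * ν ^ suc k * (fromℕ (suc k) * (e^ fromℕ v) (suc k))
      ≈⟨ *-congˡ (e-suc (fromℕ v) k) ⟩
    ν * ν ^ suc k * (fromℕ v * (e^ fromℕ v) k)
      ≈⟨ solve 4 (λ c p v e → c :* p :* (v :* e) := c :* v :* (p :* e)) _ _ _ _ ⟩
    ν * fromℕ v * E k v ∎

  E-zero : ∀ v → E 0 v ≈ ν
  E-zero v = trans (*-cong (*-identityʳ ν) (e-zero (fromℕ v))) (*-identityʳ ν)

  -- In the application w and w′ are η^{a-b} and η^{b-a}, and δ is the Kronecker symbol of a and b.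
  -- The last two hypotheses are the values of geometric sums.
  module PowerSums (w w′ δ : Carrier) (w*w′≈1 : w * w′ ≈ 1#)
    (w^N≈1 : w ^ N ≈ 1#) (w′^N≈1 : w′ ^ N ≈ 1#)
    (twisted-w≈ : twisted N w 0# 0 ≈ fromℕ N * δ)
    (twisted-w′≈ : twisted N w′ 0# 0 ≈ fromℕ N * δ)
    where

    private
      -- Values at -v/N for the root w′ and at v/N for the root w. A step in v is a shift by 1/N, so
      -- `twisted-shift` makes both telescope.
      U V : ℕ → ℕ → Carrier
      U k v = twisted N w′ (ν * fromℕ v) (suc k)
      V k v = twisted N w (1/ N * fromℕ v) (suc k)

    U-telescope : ∀ k v →
      U k 0 ≈ w ^ v * U k v + (∑[ t ≤ v ] w ^ (t ∸ 1) * (e^ (ν * fromℕ (t ∸ 1))) k)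
    U-telescope k zero    = sym (trans (+-cong (*-identityˡ _) (∑-empty _)) (+-identityʳ _))
    U-telescope k (suc v) = begin
      U k 0
        ≈⟨ U-telescope k v ⟩
      w ^ v * U k v + Σ
        ≈⟨ +-congʳ (*-congˡ step) ⟩
      w ^ v * (w * U k (suc v) + (e^ (ν * fromℕ v)) k) + Σ
        ≈⟨ solve 5 (λ p w u e s → p :* (w :* u :+ e) :+ s := w :* p :* u :+ (s :+ p :* e)) _ _ _ _ _ ⟩
      w ^ suc v * U k (suc v) + (Σ + w ^ v * (e^ (ν * fromℕ v)) k)
        ≈⟨ +-congˡ (∑-last v _) ⟨
      w ^ suc v * U k (suc v) + (∑[ t ≤ suc v ] w ^ (t ∸ 1) * (e^ (ν * fromℕ (t ∸ 1))) k) ∎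
      where
      Σ = ∑[ t ≤ v ] w ^ (t ∸ 1) * (e^ (ν * fromℕ (t ∸ 1))) k

      arg : 1/ N + ν * fromℕ (suc v) ≈ ν * fromℕ v
      arg = solve 2 (λ n v → n :+ :- n :* (:1 :+ v) := :- n :* v) (1/ N) (fromℕ v)

      shifted : w′ * U k v ≈ U k (suc v) + w′ * (e^ (ν * fromℕ v)) k
      shifted = begin
        w′ * U k v
          ≈⟨ *-congˡ (twisted-cong N w′ (suc k) arg) ⟨
        w′ * twisted N w′ (1/ N + ν * fromℕ (suc v)) (suc k)
          ≈⟨ twisted-shift N w′ w′^N≈1 (ν * fromℕ (suc v)) k ⟩
        U k (suc v) + w′ * (e^ (1/ N + ν * fromℕ (suc v))) k
          ≈⟨ +-congˡ (*-congˡ (e-cong k arg)) ⟩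
        U k (suc v) + w′ * (e^ (ν * fromℕ v)) k ∎

      step : U k v ≈ w * U k (suc v) + (e^ (ν * fromℕ v)) k
      step = begin
        U k v
          ≈⟨ trans (*-congʳ w*w′≈1) (*-identityˡ _) ⟨
        w * w′ * U k v
          ≈⟨ trans (*-assoc _ _ _) (*-congˡ shifted) ⟩
        w * (U k (suc v) + w′ * (e^ (ν * fromℕ v)) k)
          ≈⟨ trans (distribˡ _ _ _) (+-congˡ (sym (*-assoc _ _ _))) ⟩
        w * U k (suc v) + w * w′ * (e^ (ν * fromℕ v)) k
          ≈⟨ +-congˡ (trans (*-congʳ w*w′≈1) (*-identityˡ _)) ⟩
        w * U k (suc v) + (e^ (ν * fromℕ v)) k ∎

    V-telescope : ∀ k v →
      w ^ v * V k v ≈ V k 0 + (∑[ t ≤ v ] w ^ t * (e^ (1/ N * fromℕ t)) k)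
    V-telescope k zero    = trans (*-identityˡ _) (sym (trans (+-congˡ (∑-empty _)) (+-identityʳ _)))
    V-telescope k (suc v) = begin
      w * w ^ v * V k (suc v)
        ≈⟨ solve 3 (λ w p x → w :* p :* x := p :* (w :* x)) _ _ _ ⟩
      w ^ v * (w * V k (suc v))
        ≈⟨ *-congˡ shifted ⟩
      w ^ v * (V k v + w * (e^ (1/ N * fromℕ (suc v))) k)
        ≈⟨ solve 4 (λ p x w e → p :* (x :+ w :* e) := p :* x :+ w :* p :* e) _ _ _ _ ⟩
      w ^ v * V k v + w ^ suc v * (e^ (1/ N * fromℕ (suc v))) k
        ≈⟨ +-congʳ (V-telescope k v) ⟩
      V k 0 + (∑[ t ≤ v ] w ^ t * (e^ (1/ N * fromℕ t)) k) + w ^ suc v * (e^ (1/ N * fromℕ (suc v))) k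
        ≈⟨ trans (+-congˡ (∑-last v _)) (sym (+-assoc _ _ _)) ⟨
      V k 0 + (∑[ t ≤ suc v ] w ^ t * (e^ (1/ N * fromℕ t)) k) ∎
      where
      arg : 1/ N + 1/ N * fromℕ v ≈ 1/ N * fromℕ (suc v)
      arg = solve 2 (λ n v → n :+ n :* v := n :* (:1 :+ v)) (1/ N) (fromℕ v)

      shifted : w * V k (suc v) ≈ V k v + w * (e^ (1/ N * fromℕ (suc v))) k
      shifted = begin
        w * V k (suc v)
          ≈⟨ *-congˡ (twisted-cong N w (suc k) arg) ⟨
        w * twisted N w (1/ N + 1/ N * fromℕ v) (suc k)
          ≈⟨ twisted-shift N w w^N≈1 (1/ N * fromℕ v) k ⟩
        V k v + w * (e^ (1/ N + 1/ N * fromℕ v)) k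
          ≈⟨ +-congˡ (*-congˡ (e-cong k arg)) ⟩
        V k v + w * (e^ (1/ N * fromℕ (suc v))) k ∎

    κ : ℕ → Carrier
    κ i = twisted N w′ 0# i + sign i * twisted N w 0# i

    -- The powers of -1/N and 1/N differ by (-1)^j, and since i + j = k + 1 the factor -(-1)^k
    -- (-1)^j is (-1)^i. Hence the coefficients `κ` do not depend on k.
    U-signV : ∀ k v → U k v - sign k * V k v ≈ ∑∇ (suc k) (λ i j → κ i * (ν ^ j * (e^ fromℕ v) j))
    U-signV k v = begin
      U k v - sign k * V k v
        ≈⟨ +-cong (twisted-expand N w′ _ (suc k)) (-‿cong (*-congˡ (twisted-expand N w _ (suc k)))) ⟩
      ∑∇ (suc k) (λ i j → twisted N w′ 0# i * (e^ (ν * fromℕ v)) j) -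
      sign k * ∑∇ (suc k) (λ i j → twisted N w 0# i * (e^ (1/ N * fromℕ v)) j)
        ≈⟨ +-congˡ (trans (-‿distribˡ-* _ _) (∑∇-*ˡ (suc k) _ _)) ⟩
      ∑∇ (suc k) (λ i j → twisted N w′ 0# i * (e^ (ν * fromℕ v)) j) +
      ∑∇ (suc k) (λ i j → - sign k * (twisted N w 0# i * (e^ (1/ N * fromℕ v)) j))
        ≈⟨ ∑∇-+ (suc k) _ _ ⟨
      ∑∇ (suc k) (λ i j → twisted N w′ 0# i * (e^ (ν * fromℕ v)) j +
        - sign k * (twisted N w 0# i * (e^ (1/ N * fromℕ v)) j))
        ≈⟨ ∑∇-cong (suc k) (λ i j i+j≡1+k → begin
             twisted N w′ 0# i * (e^ (ν * fromℕ v)) j +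
             - sign k * (twisted N w 0# i * (e^ (1/ N * fromℕ v)) j)
               ≈⟨ +-cong (*-congˡ (e-scale ν (fromℕ v) j))
                    (*-congˡ (*-congˡ (trans (e-scale (1/ N) (fromℕ v) j) (*-congʳ (1/N^≈ j))))) ⟩
             twisted N w′ 0# i * (ν ^ j * (e^ fromℕ v) j) +
             - sign k * (twisted N w 0# i * (sign j * ν ^ j * (e^ fromℕ v) j))
               ≈⟨ solve 6 (λ u u′ s s′ p e →
                    u :* (p :* e) :+ :- s :* (u′ :* (s′ :* p :* e))
                    := (u :+ (:- s :* s′) :* u′) :* (p :* e)) _ _ _ _ _ _ ⟩
             (twisted N w′ 0# i + - sign k * sign j * twisted N w 0# i) * (ν ^ j * (e^ fromℕ v) j)
               ≈⟨ *-congʳ (+-congˡ (*-congʳ (begin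
                    - sign k * sign j
                      ≈⟨ *-congʳ (sign-suc k) ⟨
                    sign (suc k) * sign j
                      ≡⟨ ≡.cong (λ n → sign n * sign j) i+j≡1+k ⟨
                    sign (i ℕ.+ j) * sign j
                      ≈⟨ trans (*-congʳ (^-homo-* (- 1#) i j)) (*-assoc _ _ _) ⟩
                    sign i * (sign j * sign j)
                      ≈⟨ trans (*-congˡ (sign²≈1 j)) (*-identityʳ _) ⟩
                    sign i ∎))) ⟩
             κ i * (ν ^ j * (e^ fromℕ v) j) ∎) ⟩
      ∑∇ (suc k) (λ i j → κ i * (ν ^ j * (e^ fromℕ v) j)) ∎

    -- κ̂ i is β_{i+1} for the class of w plus (-1)^{i+1} β_{i+1} for that of w′.
    κ̂ : ℕ → Carrier
    κ̂ i = - (h * κ (suc i))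

    private
      S : ℕ → ℕ → Carrier
      S k v = ∑[ t ≤ v ] w ^ t * (e^ fromℕ t) k

    e-0 : ∀ {x} k → x ≈ 0# → (e^ x) k ≈ [ k ℕ.≟ 0 ]
    e-0 {x} zero _   = e-zero x
    e-0 (suc k) x≈0 = e-0-suc k x≈0

    -- Both telescopings contain the powers for t = 1, ..., v; `U` adds t = 0 and `V` adds t = v +
    -- 1. As 2h = -ν, the common part gets the full factor while the endpoints keep the weight h;
    -- they later match the terms δ_{s,1} g̃_r in ε. The expansion term of index zero, with κ 0 =
    -- 2Nδ, becomes the term with δ.
    powerSum : ∀ k v → let W = w ^ suc v in
      ν * ν ^ suc k * S k v ≈
      W * (δ * E (suc k) (suc v))
      + (- (W * ∑∇ k (λ i j → κ̂ i * E j (suc v))) + ν * κ̂ k)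
      + h * (W * E k (suc v) + [ k ℕ.≟ 0 ] * ν)
    powerSum k v = sym (begin
      W * (δ * E (suc k) (suc v))
      + (- (W * ∑∇ k (λ i j → κ̂ i * E j (suc v))) + ν * κ̂ k)
      + h * (W * E k (suc v) + z * ν)
        ≈⟨ +-congʳ (+-congˡ (+-congʳ (-‿cong (*-congˡ ∑κ̂E)))) ⟩
      W * (δ * E (suc k) (suc v)) + (- (W * (- (h * ν) * Q)) + ν * κ̂ k)
      + h * (W * E k (suc v) + z * ν)
        ≈⟨ solve 11 (λ W δ c p e′ e h q κ z x →
             W :* (δ :* (c :* p :* e′)) :+ (:- (W :* (:- (h :* c) :* q)) :+ c :* :- (h :* κ))
               :+ h :* (W :* (c :* x :* e) :+ z :* c)
             := W :* (δ :* (c :* p :* e′)) :- h :* c :* (κ :- W :* q) :+ h :* c :* (x :* (W :* e) :+ z))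
             W δ ν (ν ^ suc k) ((e^ fromℕ (suc v)) (suc k)) ((e^ fromℕ (suc v)) k) h Q (κ (suc k)) z (ν ^ k) ⟩
      W * (δ * E (suc k) (suc v)) - h * ν * (κ (suc k) - W * Q) + h * ν * (y + z)
        ≈⟨ +-congʳ (+-congˡ (-‿cong (*-congˡ key))) ⟩
      W * (δ * (ν * ν ^ suc k * e′)) - h * ν * (x + x + y + z + W * (κ 0 * q)) + h * ν * (y + z)
        ≈⟨ +-congʳ (+-congˡ (-‿cong (*-congˡ (+-congˡ (*-congˡ (*-congʳ κ0≈)))))) ⟩
      W * (δ * (ν * ν ^ suc k * e′)) - h * ν * (x + x + y + z + W * ((fromℕ N * δ + fromℕ N * δ) * q)) + h * ν * (y + z)
        ≈⟨ solve 10 (λ W δ c p e′ h x y z n →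
             W :* (δ :* (c :* p :* e′)) :- h :* c :* (x :+ x :+ y :+ z :+ W :* ((n :* δ :+ n :* δ) :* (p :* e′))) :+ h :* c :* (y :+ z)
             := W :* (δ :* (c :* p :* e′)) :- (h :+ h) :* c :* x :- (h :+ h) :* (n :* c) :* (W :* (δ :* (p :* e′))))
             W δ ν (ν ^ suc k) e′ h x y z (fromℕ N) ⟩
      W * (δ * (ν * ν ^ suc k * e′)) - (h + h) * ν * x - (h + h) * (fromℕ N * ν) * (W * (δ * q))
        ≈⟨ +-cong (+-congˡ (-‿cong (*-congʳ (*-congʳ 2h≈-ν)))) (-‿cong (*-congʳ (*-cong 2h≈-ν Nν≈-1))) ⟩
      W * (δ * (ν * ν ^ suc k * e′)) - (- ν * ν * x) - (- ν * - 1# * (W * (δ * q)))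
        ≈⟨ solve 7 (λ W δ c p e′ x s →
             W :* (δ :* (c :* p :* e′)) :- (:- c :* c :* (x :* s)) :- (:- c :* :- :1 :* (W :* (δ :* (p :* e′))))
             := c :* (c :* x) :* s) W δ ν (ν ^ suc k) e′ (ν ^ k) (S k v) ⟩
      ν * ν ^ suc k * S k v ∎)
      where
      W = w ^ suc v
      e′ = (e^ fromℕ (suc v)) (suc k)
      x = ν ^ k * S k v
      y = ν ^ k * (W * (e^ fromℕ (suc v)) k)
      z = [ k ℕ.≟ 0 ]
      q = ν ^ suc k * e′
      Q = ∑∇ k (λ i j → κ (suc i) * (ν ^ j * (e^ fromℕ (suc v)) j))
      s = sign k

      ∑κ̂E : ∑∇ k (λ i j → κ̂ i * E j (suc v)) ≈ - (h * ν) * Q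
      ∑κ̂E = trans (∑∇-cong k λ i j _ →
        solve 5 (λ h κ c p e → :- (h :* κ) :* (c :* p :* e) := :- (h :* c) :* (κ :* (p :* e))) h (κ (suc i)) ν (ν ^ j) ((e^ fromℕ (suc v)) j)) (sym (∑∇-*ˡ k _ _))

      κ0≈ : κ 0 ≈ fromℕ N * δ + fromℕ N * δ
      κ0≈ = +-cong twisted-w′≈ (trans (*-identityˡ _) twisted-w≈)

      U₀ : U k 0 ≈ W * U k (suc v) + (z + x)
      U₀ = begin
        U k 0
          ≈⟨ U-telescope k (suc v) ⟩
        W * U k (suc v) + (∑[ t ≤ suc v ] w ^ (t ∸ 1) * (e^ (ν * fromℕ (t ∸ 1))) k)
          ≈⟨ +-congˡ (∑-head v _) ⟩
        W * U k (suc v) + (1# * (e^ (ν * 0#)) k + (∑[ t ≤ v ] w ^ t * (e^ (ν * fromℕ t)) k))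
          ≈⟨ +-congˡ (+-cong (trans (*-identityˡ _) (e-0 k (zeroʳ ν))) (trans (∑-cong v λ t → begin
               w ^ suc t * (e^ (ν * fromℕ (suc t))) k
                 ≈⟨ *-congˡ (e-scale ν _ k) ⟩
               w ^ suc t * (ν ^ k * (e^ fromℕ (suc t)) k)
                 ≈⟨ solve 3 (λ x y z → x :* (y :* z) := y :* (x :* z)) _ _ _ ⟩
               ν ^ k * (w ^ suc t * (e^ fromℕ (suc t)) k) ∎) (sym (∑-*ˡ v _ _)))) ⟩
        W * U k (suc v) + (z + x) ∎

      V₁ : s * (W * V k (suc v)) ≈ s * V k 0 + (x + y)
      V₁ = begin
        s * (W * V k (suc v))
          ≈⟨ *-congˡ (trans (V-telescope k (suc v)) (+-congˡ (∑-last v _))) ⟩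
        s * (V k 0 + ((∑[ t ≤ v ] w ^ t * (e^ (1/ N * fromℕ t)) k) + W * (e^ (1/ N * fromℕ (suc v))) k))
          ≈⟨ solve 4 (λ s v a b → s :* (v :+ (a :+ b)) := s :* v :+ (s :* a :+ s :* b)) _ _ _ _ ⟩
        s * V k 0 + (s * (∑[ t ≤ v ] w ^ t * (e^ (1/ N * fromℕ t)) k) + s * (W * (e^ (1/ N * fromℕ (suc v))) k))
          ≈⟨ +-congˡ (+-cong (trans (∑-*ˡ v s _) (trans (∑-cong v λ t → unsign (w ^ suc t) (fromℕ (suc t))) (sym (∑-*ˡ v _ _))))
               (unsign W (fromℕ (suc v)))) ⟩
        s * V k 0 + (x + y) ∎
        where
        unsign : ∀ a u → s * (a * (e^ (1/ N * u)) k) ≈ ν ^ k * (a * (e^ u) k)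
        unsign a u = begin
          s * (a * (e^ (1/ N * u)) k)
            ≈⟨ *-congˡ (*-congˡ (trans (e-scale (1/ N) u k) (*-congʳ (1/N^≈ k)))) ⟩
          s * (a * (s * ν ^ k * (e^ u) k))
            ≈⟨ solve 4 (λ s a p e → s :* (a :* (s :* p :* e)) := s :* s :* (p :* (a :* e))) _ _ _ _ ⟩
          s * s * (ν ^ k * (a * (e^ u) k))
            ≈⟨ trans (*-congʳ (sign²≈1 k)) (*-identityˡ _) ⟩
          ν ^ k * (a * (e^ u) k) ∎

      key : κ (suc k) - W * Q ≈ x + x + y + z + W * (κ 0 * q)
      key = begin
        κ (suc k) - W * Q
          ≈⟨ +-congʳ (+-cong (twisted-cong N w′ (suc k) (zeroʳ ν))
               (trans (*-cong (sym (sign-suc k)) (twisted-cong N w (suc k) (zeroʳ (1/ N)))) refl)) ⟨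
        U k 0 + - s * V k 0 - W * Q
          -- The missing term of index zero is added and subtracted, which completes `Q` to the full
          -- expansion in `U-signV`.
          ≈⟨ solve 7 (λ u s v w q κ p → u :+ :- s :* v :- w :* q
               := u :+ :- s :* v :- w :* (κ :* p :+ q) :+ w :* (κ :* p)) _ _ _ _ _ (κ 0) q ⟩
        U k 0 + - s * V k 0 - W * (κ 0 * q + Q) + W * (κ 0 * q)
          ≈⟨ +-congʳ (+-congˡ (-‿cong (*-congˡ (trans (U-signV k (suc v)) (∑∇-head k _))))) ⟨
        U k 0 + - s * V k 0 - W * (U k (suc v) - s * V k (suc v)) + W * (κ 0 * q)
          ≈⟨ +-congʳ (+-congʳ (+-congʳ U₀)) ⟩
        W * U k (suc v) + (z + x) + - s * V k 0 - W * (U k (suc v) - s * V k (suc v)) + W * (κ 0 * q)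
          ≈⟨ solve 8 (λ w u z x s v₀ v₁ t →
               w :* u :+ (z :+ x) :+ :- s :* v₀ :- w :* (u :- s :* v₁) :+ t
               := z :+ x :- s :* v₀ :+ s :* (w :* v₁) :+ t) _ _ _ _ _ _ _ _ ⟩
        z + x - s * V k 0 + s * (W * V k (suc v)) + W * (κ 0 * q)
          ≈⟨ +-congʳ (+-congˡ V₁) ⟩
        z + x - s * V k 0 + (s * V k 0 + (x + y)) + W * (κ 0 * q)
          ≈⟨ solve 5 (λ z x v y t → z :+ x :- v :+ (v :+ (x :+ y)) :+ t := x :+ x :+ y :+ z :+ t) _ _ _ _ _ ⟩
        x + x + y + z + W * (κ 0 * q) ∎

    convolution : ℕ → ℕ → ℕ → Carrier
    convolution k l v = ∑[ t ≤ v ] w ^ t * (E k t * E l (suc v ∸ t))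

    private
      -- This is the bracket in the definition of β_{r,s}^{a,b}: after multiplication by η^{bv} the
      -- factor W turns into η^{av}, so the first summand belongs to g̃^a and the second to g̃^b.
      coeff : ℕ → ℕ → Carrier → ℕ → Carrier
      coeff k l W i = sign (suc l) * bin i l * W + sign (i ℕ.+ k) * bin i k

      rhs : ℕ → ℕ → ℕ → ℕ → Carrier
      rhs m k l v = let W = w ^ suc v in
        W * (δ * E (suc m) (suc v))
        + ∑∇ m (λ i j → κ̂ i * (coeff k l W i * E j (suc v)))
        + h * ([ l ℕ.≟ 0 ] * (W * E k (suc v)) + [ k ℕ.≟ 0 ] * E l (suc v))

    ∑∇-end : ∀ m (G : ℕ → ℕ → Carrier) → (∀ i j → i ℕ.< m → G i j ≈ 0#) → ∑∇ m G ≈ G m 0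
    ∑∇-end zero    G _ = ∑∇-zero G
    ∑∇-end (suc m) G h = trans (∑∇-last m G) (trans (+-congʳ (∑∇-0 m λ i j i+j≡m →
      h i (suc j) (ℕ.s≤s (ℕ.m+n≤o⇒m≤o i (ℕ.≤-reflexive i+j≡m))))) (+-identityˡ _))

    -- `E 0` is constant, so the convolution is a power sum. In degree k the binomial C(i, k)
    -- survives only at i = k, which reduces the second part of `coeff` to the single term ν κ̂ k.
    convolution-zero : ∀ k v → convolution k 0 v ≈ rhs k k 0 v
    convolution-zero k v = begin
      ∑[ t ≤ v ] w ^ t * (E k t * E 0 (suc v ∸ t))
        ≈⟨ ∑-cong v (λ t → trans (*-congˡ (*-congˡ (E-zero (v ∸ t))))
             (solve 4 (λ x p e c → x :* (p :* e :* c) := c :* p :* (x :* e)) _ _ _ _)) ⟩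
      ∑[ t ≤ v ] ν * ν ^ suc k * (w ^ t * (e^ fromℕ t) k)
        ≈⟨ ∑-*ˡ v _ _ ⟨
      ν * ν ^ suc k * (∑[ t ≤ v ] w ^ t * (e^ fromℕ t) k)
        ≈⟨ powerSum k v ⟩
      W * (δ * E (suc k) (suc v))
      + (- (W * ∑∇ k (λ i j → κ̂ i * E j (suc v))) + ν * κ̂ k)
      + h * (W * E k (suc v) + [ k ℕ.≟ 0 ] * ν)
        ≈⟨ +-cong (+-congˡ sums) (*-congˡ (+-cong (*-identityˡ _) (*-congˡ (E-zero (suc v))))) ⟨
      rhs k k 0 v ∎
      where
      W = w ^ suc v
      sums : ∑∇ k (λ i j → κ̂ i * (coeff k 0 W i * E j (suc v))) ≈
        - (W * ∑∇ k (λ i j → κ̂ i * E j (suc v))) + ν * κ̂ k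
      sums = begin
        ∑∇ k (λ i j → κ̂ i * (coeff k 0 W i * E j (suc v)))
          ≈⟨ ∑∇-cong k (λ i j _ → trans
               (*-congˡ (*-congʳ (+-congʳ (*-congʳ (*-cong (*-identityʳ (- 1#)) (bin-zero i))))))
               (solve 5 (λ κ W s b e →
                  κ :* ((:- :1 :* :1 :* W :+ s :* b) :* e)
                  := :- W :* (κ :* e) :+ κ :* (s :* b :* e)) _ _ _ _ _)) ⟩
        ∑∇ k (λ i j → - W * (κ̂ i * E j (suc v)) + κ̂ i * (sign (i ℕ.+ k) * bin i k * E j (suc v)))
          ≈⟨ ∑∇-+ k _ _ ⟩
        ∑∇ k (λ i j → - W * (κ̂ i * E j (suc v))) +
        ∑∇ k (λ i j → κ̂ i * (sign (i ℕ.+ k) * bin i k * E j (suc v)))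
          ≈⟨ +-cong (trans (sym (∑∇-*ˡ k _ _)) (sym (-‿distribˡ-* _ _)))
               (∑∇-end k _ λ i j i<k → trans (*-congˡ (trans (*-congʳ (trans (*-congˡ (bin-> i<k))
                 (zeroʳ _))) (zeroˡ _))) (zeroʳ _)) ⟩
        - (W * ∑∇ k (λ i j → κ̂ i * E j (suc v))) + κ̂ k * (sign (k ℕ.+ k) * bin k k * E 0 (suc v))
          ≈⟨ +-congˡ (trans (*-congˡ (*-cong (trans (*-cong
               (trans (^-homo-* (- 1#) k k) (sign²≈1 k))
               (trans (reflexive (≡.cong fromℕ (nCn≡1 k))) (+-identityʳ 1#)))
               (*-identityˡ 1#)) (E-zero (suc v))))
               (solve 2 (λ x y → x :* (:1 :* y) := y :* x) _ _)) ⟩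
        - (W * ∑∇ k (λ i j → κ̂ i * E j (suc v))) + ν * κ̂ k ∎

    convolution-suc : ∀ k l v → ν * fromℕ (suc v) * convolution k l v ≈
      fromℕ (suc k) * convolution (suc k) l v + fromℕ (suc l) * convolution k (suc l) v
    convolution-suc k l v = begin
      ν * fromℕ (suc v) * convolution k l v
        ≈⟨ ∑-*ˡ v _ _ ⟩
      ∑[ t ≤ v ] ν * fromℕ (suc v) * (w ^ t * (E k t * E l (suc v ∸ t)))
        ≈⟨ ∑-cong< v (λ t t<v → begin
             ν * fromℕ (suc v) * (w ^ suc t * (E k (suc t) * E l (v ∸ t)))
               ≈⟨ *-congʳ (*-congˡ (trans (reflexive (≡.cong fromℕ (≡.sym
                    (≡.cong suc (ℕ.m+[n∸m]≡n (ℕ.<⇒≤ t<v)))))) (fromℕ-+ (suc t) (v ∸ t)))) ⟩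
             ν * (fromℕ (suc t) + fromℕ (v ∸ t)) * (w ^ suc t * (E k (suc t) * E l (v ∸ t)))
               ≈⟨ solve 6 (λ c t u x a b → c :* (t :+ u) :* (x :* (a :* b))
                    := x :* ((c :* t :* a) :* b) :+ x :* (a :* (c :* u :* b))) ν _ _ _ _ _ ⟩
             w ^ suc t * (ν * fromℕ (suc t) * E k (suc t) * E l (v ∸ t)) +
             w ^ suc t * (E k (suc t) * (ν * fromℕ (v ∸ t) * E l (v ∸ t)))
               ≈⟨ +-cong (*-congˡ (*-congʳ (E-suc k (suc t)))) (*-congˡ (*-congˡ (E-suc l (v ∸ t)))) ⟨
             w ^ suc t * (fromℕ (suc k) * E (suc k) (suc t) * E l (v ∸ t)) +
             w ^ suc t * (E k (suc t) * (fromℕ (suc l) * E (suc l) (v ∸ t)))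
               ≈⟨ solve 7 (λ x m a′ b n a b′ →
                    x :* (m :* a′ :* b) :+ x :* (a :* (n :* b′))
                    := m :* (x :* (a′ :* b)) :+ n :* (x :* (a :* b′))) _ _ _ _ _ _ _ ⟩
             fromℕ (suc k) * (w ^ suc t * (E (suc k) (suc t) * E l (v ∸ t))) +
             fromℕ (suc l) * (w ^ suc t * (E k (suc t) * E (suc l) (v ∸ t))) ∎) ⟩
      ∑[ t ≤ v ] (fromℕ (suc k) * (w ^ t * (E (suc k) t * E l (suc v ∸ t))) +
                  fromℕ (suc l) * (w ^ t * (E k t * E (suc l) (suc v ∸ t))))
        ≈⟨ trans (∑-+ v _ _) (+-cong (sym (∑-*ˡ v _ _)) (sym (∑-*ˡ v _ _))) ⟩
      fromℕ (suc k) * convolution (suc k) l v + fromℕ (suc l) * convolution k (suc l) v ∎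

    -- Multiplying `E j` by v raises j and brings in the new j as a factor. Since i + j = k + l + 1,
    -- `core` distributes j C(i, l) over C(i, l) and C(i, l + 1); its minus sign matches the change
    -- of sign in `coeff` when k or l grows.
    rhs-suc : ∀ k l v → ν * fromℕ (suc v) * rhs (k ℕ.+ l) k l v ≈
      fromℕ (suc k) * rhs (suc (k ℕ.+ l)) (suc k) l v +
      fromℕ (suc l) * rhs (suc (k ℕ.+ l)) k (suc l) v
    rhs-suc k l v = begin
      X * (W * (δ * E (suc m) v⁺) + G m k l + h * (b * (W * E k v⁺) + a * E l v⁺))
        ≈⟨ solve 10 (λ X W d e g h b x a y →
             X :* (W :* (d :* e) :+ g :+ h :* (b :* (W :* x) :+ a :* y))
             := W :* (d :* (X :* e)) :+ X :* g :+ h :* (b :* (W :* (X :* x)) :+ a :* (X :* y))) X W δ _ _ h b _ a _ ⟩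
      W * (δ * (X * E (suc m) v⁺)) + X * G m k l
        + h * (b * (W * (X * E k v⁺)) + a * (X * E l v⁺))
        ≈⟨ +-cong (+-cong (*-congˡ (*-congˡ (trans (sym (E-suc (suc m) v⁺)) (*-congʳ degrees)))) G-suc)
             (*-congˡ (+-cong (*-congˡ (*-congˡ (sym (E-suc k v⁺)))) (*-congˡ (sym (E-suc l v⁺))))) ⟩
      W * (δ * ((K′ + L) * E (suc (suc m)) v⁺)) + (K′ * G (suc m) (suc k) l + L * G (suc m) k (suc l))
        + h * (b * (W * (K′ * E (suc k) v⁺)) + a * (L * E (suc l) v⁺))
        ≈⟨ solve 14 (λ W d K L e g g′ h b x a y x₀ y₀ →
             W :* (d :* ((K :+ L) :* e)) :+ (K :* g :+ L :* g′)
               :+ h :* (b :* (W :* (K :* x)) :+ a :* (L :* y))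
             := K :* (W :* (d :* e) :+ g :+ h :* (b :* (W :* x) :+ :0 :* y₀))
               :+ L :* (W :* (d :* e) :+ g′ :+ h :* (:0 :* x₀ :+ a :* y))) W δ K′ L _ _ _ h b _ a _ _ _ ⟩
      K′ * rhs (suc m) (suc k) l v + L * rhs (suc m) k (suc l) v ∎
      where
      m = k ℕ.+ l
      v⁺ = suc v
      W = w ^ v⁺
      X = ν * fromℕ v⁺
      K′ = fromℕ (suc k)
      L = fromℕ (suc l)
      a = [ k ℕ.≟ 0 ]
      b = [ l ℕ.≟ 0 ]

      G : ℕ → ℕ → ℕ → Carrier
      G m k l = ∑∇ m (λ i j → κ̂ i * (coeff k l W i * E j v⁺))

      degrees : fromℕ (suc (suc m)) ≈ K′ + L
      degrees = trans (reflexive (≡.cong fromℕ (≡.cong suc (≡.sym (ℕ.+-suc k l))))) (fromℕ-+ (suc k) (suc l))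

      core : ∀ k l i j → i ℕ.+ j ≡ suc (k ℕ.+ l) →
        fromℕ j * bin i l ≈ fromℕ (suc k) * bin i l - fromℕ (suc l) * bin i (suc l)
      core k l i j i+j≡1+k+l = begin
        fromℕ j * bin i l
          ≈⟨ solve 3 (λ i j b → j :* b := (i :+ j) :* b :- i :* b) (fromℕ i) (fromℕ j) (bin i l) ⟩
        (fromℕ i + fromℕ j) * bin i l - fromℕ i * bin i l
          ≈⟨ +-cong (*-congʳ (trans (sym (fromℕ-+ i j)) (trans (reflexive (≡.cong fromℕ i+j≡1+k+l))
               (fromℕ-+ (suc k) l)))) (-‿cong (sym (bin-absorb i l))) ⟩
        (fromℕ (suc k) + fromℕ l) * bin i l - (fromℕ (suc l) * bin i (suc l) + fromℕ l * bin i l)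
          ≈⟨ solve 5 (λ k l b l′ b′ → (k :+ l) :* b :- (l′ :* b′ :+ l :* b) := k :* b :- l′ :* b′) _ _ _ _ _ ⟩
        fromℕ (suc k) * bin i l - fromℕ (suc l) * bin i (suc l) ∎

      G-suc : X * G m k l ≈ K′ * G (suc m) (suc k) l + L * G (suc m) k (suc l)
      G-suc = begin
        X * G m k l
          ≈⟨ ∑∇-*ˡ m _ _ ⟩
        ∑∇ m (λ i j → X * (κ̂ i * (coeff k l W i * E j v⁺)))
          ≈⟨ ∑∇-cong m (λ i j _ → trans
               (solve 4 (λ X a b e → X :* (a :* (b :* e)) := a :* (b :* (X :* e))) _ _ _ _)
               (*-congˡ (*-congˡ (sym (E-suc j v⁺))))) ⟩
        ∑∇ m (λ i j → κ̂ i * (coeff k l W i * (fromℕ (suc j) * E (suc j) v⁺)))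
          -- The range grows from degree m to m + 1 by a term with j = 0, which vanishes through the
          -- factor j.
          ≈⟨ trans (∑∇-last m (λ i j → κ̂ i * (coeff k l W i * (fromℕ j * E j v⁺))))
               (trans (+-congˡ (solve 3 (λ x y e → x :* (y :* (:0 :* e)) := :0) _ _ _)) (+-identityʳ _)) ⟨
        ∑∇ (suc m) (λ i j → κ̂ i * (coeff k l W i * (fromℕ j * E j v⁺)))
          ≈⟨ ∑∇-cong (suc m) (λ i j i+j≡1+m → begin
               κ̂ i * (coeff k l W i * (fromℕ j * E j v⁺))
                 ≈⟨ solve 8 (λ κ s b W t b′ j e →
                      κ :* ((s :* b :* W :+ t :* b′) :* (j :* e))
                      := κ :* ((s :* (j :* b) :* W :+ t :* (j :* b′)) :* e)) _ _ _ _ _ _ _ _ ⟩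
               κ̂ i * ((sign (suc l) * (fromℕ j * bin i l) * W + sign (i ℕ.+ k) * (fromℕ j * bin i k)) * E j v⁺)
                 ≈⟨ *-congˡ (*-congʳ (+-cong
                      (*-congʳ (*-congˡ (core k l i j i+j≡1+m)))
                      (*-congˡ (core l k i j (≡.trans i+j≡1+m (≡.cong suc (ℕ.+-comm k l))))))) ⟩
               κ̂ i * ((sign (suc l) * (K′ * bin i l - L * bin i (suc l)) * W
                 + sign (i ℕ.+ k) * (L * bin i k - K′ * bin i (suc k))) * E j v⁺)
                 ≈⟨ solve 11 (λ κ s K b L b₁ W t c c₁ e →
                      κ :* ((s :* (K :* b :- L :* b₁) :* W :+ t :* (L :* c :- K :* c₁)) :* e)
                      := K :* (κ :* ((s :* b :* W :+ (:- :1 :* t) :* c₁) :* e))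
                         :+ L :* (κ :* (((:- :1 :* s) :* b₁ :* W :+ t :* c) :* e))) _ _ _ _ _ _ _ _ _ _ _ ⟩
               K′ * (κ̂ i * ((sign (suc l) * bin i l * W + sign (suc (i ℕ.+ k)) * bin i (suc k)) * E j v⁺)) +
               L * (κ̂ i * (coeff k (suc l) W i * E j v⁺))
                 ≈⟨ +-congʳ (*-congˡ (*-congˡ (*-congʳ (+-congˡ (*-congʳ
                      (reflexive (≡.cong sign (≡.sym (ℕ.+-suc i k))))))))) ⟩
               K′ * (κ̂ i * (coeff (suc k) l W i * E j v⁺)) +
               L * (κ̂ i * (coeff k (suc l) W i * E j v⁺)) ∎) ⟩
        ∑∇ (suc m) (λ i j → K′ * (κ̂ i * (coeff (suc k) l W i * E j v⁺)) +
                            L * (κ̂ i * (coeff k (suc l) W i * E j v⁺)))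
          ≈⟨ trans (∑∇-+ (suc m) _ _) (+-cong (sym (∑∇-*ˡ (suc m) _ _)) (sym (∑∇-*ˡ (suc m) _ _))) ⟩
        K′ * G (suc m) (suc k) l + L * G (suc m) k (suc l) ∎

    -- The recursion obtains (k, l + 1) from (k, l) and (k + 1, l), so the induction on l is over
    -- all k at once. The factor l + 1 is cancelled in characteristic zero.
    convolution≈ : ∀ k l v → let W = w ^ suc v in
      convolution k l v ≈
      W * (δ * E (suc (k ℕ.+ l)) (suc v))
      + ∑∇ (k ℕ.+ l) (λ i j → κ̂ i *
          ((sign (suc l) * bin i l * W + sign (i ℕ.+ k) * bin i k) * E j (suc v)))
      + h * ([ l ℕ.≟ 0 ] * (W * E k (suc v)) + [ k ℕ.≟ 0 ] * E l (suc v))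
    convolution≈ k zero    v = trans (convolution-zero k v)
      (reflexive (≡.cong (λ m → rhs m k 0 v) (≡.sym (ℕ.+-identityʳ k))))
    convolution≈ k (suc l) v = fromℕ-cancelˡ l (+-cancelˡ (fromℕ (suc k) * convolution (suc k) l v) _ _ (begin
      fromℕ (suc k) * convolution (suc k) l v + fromℕ (suc l) * convolution k (suc l) v
        ≈⟨ convolution-suc k l v ⟨
      ν * fromℕ (suc v) * convolution k l v
        ≈⟨ *-congˡ (convolution≈ k l v) ⟩
      ν * fromℕ (suc v) * rhs (k ℕ.+ l) k l v
        ≈⟨ rhs-suc k l v ⟩
      fromℕ (suc k) * rhs (suc (k ℕ.+ l)) (suc k) l v + fromℕ (suc l) * rhs (suc (k ℕ.+ l)) k (suc l) v
        ≈⟨ +-cong (*-congˡ (sym (convolution≈ (suc k) l v)))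
             (*-congˡ (reflexive (≡.cong (λ m → rhs m k (suc l) v) (≡.sym (ℕ.+-suc k l))))) ⟩
      fromℕ (suc k) * convolution (suc k) l v + fromℕ (suc l) * rhs (k ℕ.+ suc l) k (suc l) v ∎))

-- Residue classes and roots of unity

module DoubleShuffle {c ℓ₁ ℓ₂} (K : HeytingField c ℓ₁ ℓ₂) (char0 : CharacteristicZero K)
  (N : ℕ) .{{_ : NonZero N}} (η : HeytingField.Carrier K) (root : IsPrimitiveRoot K N η)
  where
  open SeriesCalculus K char0
  open DividedPowers K char0 N
  open DoubleEisenstein K char0 N η using
    (χ; g̃; g̃₂; g̃′; f₂; β; β₂; E₁; E₂; P; IsSuitable; _+ₙ_; -ₙ_; _-ₙ_)
  open import Data.Product.Base using (_×_)
  open HeytingField K using (_#_; #⇒invertible; #-irrefl)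
  open IsPrimitiveRoot root

  ω : Fin N → Carrier
  ω a = η ^ toℕ a

  χ≈ω^ : ∀ a v → χ a v ≈ ω a ^ v
  χ≈ω^ a v = sym (^-assocʳ η (toℕ a) v)

  η^N* : ∀ m → η ^ (m ℕ.* N) ≈ 1#
  η^N* m = trans (reflexive (≡.cong (η ^_) (ℕ.*-comm m N))) (trans (sym (^-assocʳ η N m))
    (trans (^-congˡ m η^N≈1) (1^n≈1 m)))

  ω-mod : ∀ m → ω (m mod N) ≈ η ^ m
  ω-mod m = begin
    η ^ toℕ (m mod N)                ≡⟨ ≡.cong (η ^_) (Fin.toℕ-fromℕ< (m%n<n m N)) ⟩
    η ^ (m % N)                      ≈⟨ *-identityʳ _ ⟨
    η ^ (m % N) * 1#                 ≈⟨ *-congˡ (η^N* (m / N)) ⟨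
    η ^ (m % N) * η ^ (m / N ℕ.* N)  ≈⟨ ^-homo-* η (m % N) (m / N ℕ.* N) ⟨
    η ^ (m % N ℕ.+ m / N ℕ.* N)      ≡⟨ ≡.cong (η ^_) (m≡m%n+[m/n]*n m N) ⟨
    η ^ m                            ∎

  ω-+ : ∀ a b → ω (a +ₙ b) ≈ ω a * ω b
  ω-+ a b = trans (ω-mod (toℕ a ℕ.+ toℕ b)) (^-homo-* η (toℕ a) (toℕ b))

  ω-neg : ∀ a → ω (-ₙ a) * ω a ≈ 1#
  ω-neg a = begin
    ω (-ₙ a) * ω a           ≈⟨ *-congʳ (ω-mod (N ∸ toℕ a)) ⟩
    η ^ (N ∸ toℕ a) * ω a    ≈⟨ ^-homo-* η (N ∸ toℕ a) (toℕ a) ⟨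
    η ^ (N ∸ toℕ a ℕ.+ toℕ a)  ≡⟨ ≡.cong (η ^_) (ℕ.m∸n+n≡m (ℕ.<⇒≤ (Fin.toℕ<n a))) ⟩
    η ^ N                    ≈⟨ η^N≈1 ⟩
    1#                       ∎

  ω-sub : ∀ a b → ω (a -ₙ b) * ω b ≈ ω a
  ω-sub a b = begin
    ω (a -ₙ b) * ω b         ≈⟨ *-congʳ (ω-+ a (-ₙ b)) ⟩
    ω a * ω (-ₙ b) * ω b     ≈⟨ trans (*-assoc _ _ _) (trans (*-congˡ (ω-neg b)) (*-identityʳ _)) ⟩
    ω a                      ∎

  ω-cancelʳ : ∀ b {x y} → x * ω b ≈ y * ω b → x ≈ y
  ω-cancelʳ b eq = *-cancelˡ-unit (trans (*-comm _ _) (ω-neg b))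
    (trans (*-comm _ _) (trans eq (*-comm _ _)))

  ω-sub-inverse : ∀ a b → ω (a -ₙ b) * ω (b -ₙ a) ≈ 1#
  ω-sub-inverse a b = ω-cancelʳ a (begin
    ω (a -ₙ b) * ω (b -ₙ a) * ω a    ≈⟨ trans (*-assoc _ _ _) (*-congˡ (ω-sub b a)) ⟩
    ω (a -ₙ b) * ω b                 ≈⟨ trans (ω-sub a b) (sym (*-identityˡ _)) ⟩
    1# * ω a                         ∎)

  ω-+-cancelʳ : ∀ a b → ω ((a +ₙ b) -ₙ b) ≈ ω a
  ω-+-cancelʳ a b = ω-cancelʳ b (trans (ω-sub (a +ₙ b) b) (ω-+ a b))

  ω-+-cancelˡ : ∀ a b → ω ((a +ₙ b) -ₙ a) ≈ ω b
  ω-+-cancelˡ a b = ω-cancelʳ a (trans (ω-sub (a +ₙ b) a) (trans (ω-+ a b) (*-comm _ _)))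

  ω^N≈1 : ∀ a → ω a ^ N ≈ 1#
  ω^N≈1 a = trans (^-assocʳ η (toℕ a) N) (η^N* (toℕ a))

  ω-distinct : ∀ a b → toℕ a ℕ.< toℕ b → ¬ ω a ≈ ω b
  ω-distinct a b a<b ωa≈ωb = #-irrefl (ω-cancelʳ a (begin
    η ^ (toℕ b ∸ toℕ a) * ω a      ≈⟨ ^-homo-* η (toℕ b ∸ toℕ a) (toℕ a) ⟨
    η ^ (toℕ b ∸ toℕ a ℕ.+ toℕ a)  ≡⟨ ≡.cong (η ^_) (ℕ.m∸n+n≡m (ℕ.<⇒≤ a<b)) ⟩
    ω b                            ≈⟨ trans (sym ωa≈ωb) (sym (*-identityˡ _)) ⟩
    1# * ω a                       ∎))
    (η^k#1 (toℕ b ∸ toℕ a) (ℕ.m<n⇒0<n∸m a<b) (ℕ.≤-<-trans (ℕ.m∸n≤m (toℕ b) (toℕ a)) (Fin.toℕ<n b)))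

  -- Primitivity allows identities in ℤ/Nℤ to be checked on powers of η, without computing
  -- remainders.
  ω-injective : ∀ {a b} → ω a ≈ ω b → a ≡ b
  ω-injective {a} {b} ωa≈ωb with ℕ.<-cmp (toℕ a) (toℕ b)
  ... | tri< a<b _ _ = contradiction ωa≈ωb (ω-distinct a b a<b)
  ... | tri≈ _ a≡b _ = Fin.toℕ-injective a≡b
  ... | tri> _ _ b<a = contradiction (sym ωa≈ωb) (ω-distinct b a b<a)

  -- The representative of a - b is positive, since otherwise a = b; primitivity then gives
  -- apartness from 1, which provides the inverse used in `geometric≈0`.
  ω-sub#1 : ∀ {a b} → a ≢ b → ω (a -ₙ b) # 1#
  ω-sub#1 {a} {b} a≢b = η^k#1 (toℕ (a -ₙ b)) (ℕ.n≢0⇒n>0 λ d≡0 → a≢b (ω-injective (begin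
    ω a               ≈⟨ ω-sub a b ⟨
    ω (a -ₙ b) * ω b  ≡⟨ ≡.cong (λ k → η ^ k * ω b) d≡0 ⟩
    1# * ω b          ≈⟨ *-identityˡ _ ⟩
    ω b               ∎))) (Fin.toℕ<n (a -ₙ b))

  geometric≈0 : ∀ {z} → z ^ N ≈ 1# → z # 1# → ∑[ l ≤ N ] z ^ l ≈ 0#
  geometric≈0 {z} z^N≈1 z#1 = *-cancelˡ-unit (proj₂ (proj₂ (#⇒invertible z#1))) (begin
    (z - 1#) * Σ
      ≈⟨ solve 2 (λ z s → (z :- :1) :* s := z :* :1 :+ z :* s :- (s :+ z :* :1)) z Σ ⟩
    z * 1# + z * Σ - (Σ + z * 1#)
      ≈⟨ +-cong (+-congˡ (∑-*ˡ N z _)) (-‿cong (+-congˡ (*-congˡ (sym z^N≈1)))) ⟩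
    z * 1# + (∑[ l ≤ N ] z ^ suc l) - (Σ + z * z ^ N)
      ≈⟨ +-cong (∑-head N (z ^_)) (-‿cong (∑-last N (z ^_))) ⟨
    (∑[ l ≤ suc N ] z ^ l) - (∑[ l ≤ suc N ] z ^ l)
      ≈⟨ -‿inverseʳ _ ⟩
    0#
      ≈⟨ zeroʳ _ ⟨
    (z - 1#) * 0# ∎)
    where
    Σ = ∑[ l ≤ N ] z ^ l

  -- B_0 = 1, so only a geometric sum remains. This is the origin of δ_{a,b} in the stuffle
  -- relation.
  twisted-constant : ∀ a b → twisted N (ω (a -ₙ b)) 0# 0 ≈ fromℕ N * [ a Fin.≟ b ]
  twisted-constant a b = trans
    (∑-cong N λ l → trans (*-congˡ (bernoulliSeries-zero (fromℕ (suc l) * 1/ N + 0#))) (*-identityʳ (ω (a -ₙ b) ^ suc l))) powers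
    where
    powers : ∑[ l ≤ N ] ω (a -ₙ b) ^ l ≈ fromℕ N * [ a Fin.≟ b ]
    powers with a Fin.≟ b
    ... | yes ≡.refl = trans (∑-cong N λ l → trans (^-congˡ (suc l)
            (ω-cancelʳ a (trans (ω-sub a a) (sym (*-identityˡ _))))) (1^n≈1 (suc l)))
            (∑-const N 1#)
    ... | no a≢b = trans (geometric≈0 (ω^N≈1 (a -ₙ b)) (ω-sub#1 a≢b)) (sym (zeroʳ _))

  -- The q-series in terms of divided powers

  private
    sign*1/N^ : ∀ k → sign k * 1/ N ^ k ≈ ν ^ k
    sign*1/N^ k = trans (*-congˡ (1/N^≈ k)) (trans (sym (*-assoc _ _ _))
      (trans (*-congʳ (sign²≈1 k)) (*-identityˡ _)))

    _≡e^_ : ∀ v k → fromℕ (v ℕ.^ k) * 1/! k ≈ (e^ fromℕ v) k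
    v ≡e^ k = *-congʳ (fromℕ-^ v k)

  opaque
    unfolding ∑-syntax

    -- The definitions use transparent sums. This equation and the next four hold by computation
    -- once the sums are unfolded and pass to the opaque ones.
    g̃-unfold : ∀ s a n → g̃ s a n ≈
      sign s * 1/ N ^ s * 1/! (s ∸ 1) * D (λ u v → χ a v * fromℕ (v ℕ.^ (s ∸ 1))) n
    g̃-unfold s a n = refl

    g̃₂-unfold : ∀ r s a b n → g̃₂ r s a b n ≈
      sign (r ℕ.+ s) * 1/ N ^ (r ℕ.+ s) * 1/! (r ∸ 1) * 1/! (s ∸ 1) *
      (∑[ u₁ ≤ n ] ∑[ u₂ ≤ n ] ∑[ v₁ ≤ n ] ∑[ v₂ ≤ n ]
        [ u₂ ℕ.<? u₁ ×-dec u₁ ℕ.* v₁ ℕ.+ u₂ ℕ.* v₂ ℕ.≟ n ] *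
        (χ a v₁ * χ b v₂ * fromℕ (v₁ ℕ.^ (r ∸ 1) ℕ.* v₂ ℕ.^ (s ∸ 1))))
    g̃₂-unfold r s a b n = refl

    g̃′-unfold : ∀ k a n → g̃′ k a n ≈
      sign k * 1/ N ^ suc k * 1/! k * D (λ m v → fromℕ (m ℕ.* v ℕ.^ k) * χ a v) n
    g̃′-unfold k a n = refl

    f₂-unfold : ∀ a n → f₂ a n ≈ 1/ N ^ 2 * D (λ m u → χ a u * fromℕ m) n
    f₂-unfold a n = refl

    β-unfold : ∀ n a → β n a ≈
      - (1/ 2 * 1/ N * 1/! n * (∑[ l ≤ N ] χ (-ₙ a) l * B n (fromℕ l * 1/ N)))
    β-unfold n a = refl

  g̃≈D : ∀ k a n → g̃ (suc k) a n ≈ D (λ u v → χ a v * E k v) n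
  g̃≈D k a n = trans (g̃-unfold (suc k) a n) (trans (D-*ˡ _ _ n) (D-cong n λ u v → begin
    sign (suc k) * 1/ N ^ suc k * 1/! k * (χ a (suc v) * fromℕ (suc v ℕ.^ k))
      ≈⟨ *-congʳ (*-congʳ (sign*1/N^ (suc k))) ⟩
    ν ^ suc k * 1/! k * (χ a (suc v) * fromℕ (suc v ℕ.^ k))
      ≈⟨ solve 4 (λ p i x v → p :* i :* (x :* v) := x :* (p :* (v :* i))) _ _ _ _ ⟩
    χ a (suc v) * (ν ^ suc k * (fromℕ (suc v ℕ.^ k) * 1/! k))
      ≈⟨ *-congˡ (*-congˡ (suc v ≡e^ k)) ⟩
    χ a (suc v) * E k (suc v) ∎))

  g̃₂≈∑ : ∀ k l a b n → g̃₂ (suc k) (suc l) a b n ≈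
    ∑[ u₁ ≤ n ] ∑[ u₂ ≤ n ] ∑[ v₁ ≤ n ] ∑[ v₂ ≤ n ]
      [ u₂ ℕ.<? u₁ ×-dec u₁ ℕ.* v₁ ℕ.+ u₂ ℕ.* v₂ ℕ.≟ n ] *
      (χ a v₁ * χ b v₂ * (E k v₁ * E l v₂))
  g̃₂≈∑ k l a b n = trans (g̃₂-unfold (suc k) (suc l) a b n)
    (trans (∑-*ˡ n _ _) (∑-cong n λ u₁ → trans (∑-*ˡ n _ _) (∑-cong n λ u₂ →
     trans (∑-*ˡ n _ _) (∑-cong n λ v₁ → trans (∑-*ˡ n _ _) (∑-cong n λ v₂ → begin
      sign (suc k ℕ.+ suc l) * 1/ N ^ (suc k ℕ.+ suc l) * 1/! k * 1/! l *
        (_ * (χ a (suc v₁) * χ b (suc v₂) * fromℕ (suc v₁ ℕ.^ k ℕ.* suc v₂ ℕ.^ l)))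
        ≈⟨ *-cong (*-congʳ (*-congʳ (trans (sign*1/N^ (suc k ℕ.+ suc l)) (^-homo-* ν (suc k) (suc l)))))
             (*-congˡ (*-congˡ (fromℕ-* (suc v₁ ℕ.^ k) (suc v₂ ℕ.^ l)))) ⟩
      ν ^ suc k * ν ^ suc l * 1/! k * 1/! l *
        (_ * (χ a (suc v₁) * χ b (suc v₂) * (fromℕ (suc v₁ ℕ.^ k) * fromℕ (suc v₂ ℕ.^ l))))
        ≈⟨ solve 9 (λ p q i j b x y v w →
             p :* q :* i :* j :* (b :* (x :* y :* (v :* w)))
             := b :* (x :* y :* (p :* (v :* i) :* (q :* (w :* j))))) _ _ _ _ _ _ _ _ _ ⟩
      _ * (χ a (suc v₁) * χ b (suc v₂) *
        (ν ^ suc k * (fromℕ (suc v₁ ℕ.^ k) * 1/! k) * (ν ^ suc l * (fromℕ (suc v₂ ℕ.^ l) * 1/! l))))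
        ≈⟨ *-congˡ (*-congˡ (*-cong (*-congˡ (suc v₁ ≡e^ k)) (*-congˡ (suc v₂ ≡e^ l)))) ⟩
      _ * (χ a (suc v₁) * χ b (suc v₂) * (E k (suc v₁) * E l (suc v₂))) ∎)))))

  -- The sign (-1)^k is one short of the exponent k + 1 of 1/N, hence the minus.
  g̃′≈D : ∀ k a n → g̃′ k a n ≈ - D (λ u v → fromℕ u * (χ a v * E k v)) n
  g̃′≈D k a n = trans (trans (g̃′-unfold k a n) (D-*ˡ _ _ n))
    (trans (D-cong n λ u v → begin
      sign k * (1/ N * 1/ N ^ k) * 1/! k * (fromℕ (suc u ℕ.* suc v ℕ.^ k) * χ a (suc v))
        ≈⟨ *-congˡ (*-congʳ (fromℕ-* (suc u) (suc v ℕ.^ k))) ⟩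
      sign k * (1/ N * 1/ N ^ k) * 1/! k * (fromℕ (suc u) * fromℕ (suc v ℕ.^ k) * χ a (suc v))
        ≈⟨ solve 7 (λ s n p i u v x →
             s :* (n :* p) :* i :* (u :* v :* x)
             := :- :1 :* (u :* (x :* (:- n :* (s :* p) :* (v :* i))))) _ _ _ _ _ _ _ ⟩
      - 1# * (fromℕ (suc u) * (χ a (suc v) * (ν * (sign k * 1/ N ^ k) * (fromℕ (suc v ℕ.^ k) * 1/! k))))
        ≈⟨ *-congˡ (*-congˡ (*-congˡ (*-cong (*-congˡ (sign*1/N^ k)) (suc v ≡e^ k)))) ⟩
      - 1# * (fromℕ (suc u) * (χ a (suc v) * E k (suc v))) ∎)
    (trans (sym (D-*ˡ (- 1#) _ n)) (-1*x≈-x _)))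

  -- The terms of ε left over at r = s = 1 are g̃′ of index 0; this identifies them with the f₂ of
  -- the linear system.
  g̃′₀≈Nf₂ : ∀ a n → g̃′ 0 a n ≈ fromℕ N * f₂ a n
  g̃′₀≈Nf₂ a n = begin
    g̃′ 0 a n
      ≈⟨ g̃′-unfold 0 a n ⟩
    1# * (1/ N * 1#) * 1/! 0 * D (λ m v → fromℕ (m ℕ.* 1) * χ a v) n
      ≈⟨ *-cong (*-congˡ 1/0!≈1) (D-cong n λ u v →
           trans (*-comm _ _) (*-congˡ (reflexive (≡.cong fromℕ (ℕ.*-identityʳ (suc u)))))) ⟩
    1# * (1/ N * 1#) * 1# * D (λ m v → χ a v * fromℕ m) n
      ≈⟨ solve 2 (λ n d → :1 :* (n :* :1) :* :1 :* d := :1 :* (n :* d)) _ _ ⟩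
    1# * (1/ N * D (λ m v → χ a v * fromℕ m) n)
      ≈⟨ *-congʳ (fromℕ*1/ N) ⟨
    fromℕ N * 1/ N * (1/ N * D (λ m v → χ a v * fromℕ m) n)
      ≈⟨ solve 3 (λ m n d → m :* n :* (n :* d) := m :* (n :* (n :* :1) :* d)) _ _ _ ⟩
    fromℕ N * (1/ N ^ 2 * D (λ m v → χ a v * fromℕ m) n)
      ≈⟨ *-congˡ (f₂-unfold a n) ⟨
    fromℕ N * f₂ a n ∎

  -- The n! inside `B` cancels `1/!`. An arbitrary inverse θ of ω a is allowed, so that ω (b -ₙ a)
  -- can serve for the class a - b.
  β≈twisted : ∀ i a {θ} → θ * ω a ≈ 1# → β (suc i) a ≈ - (h * twisted N θ 0# (suc i))
  β≈twisted i a {θ} θ*ωa≈1 = trans (β-unfold (suc i) a) (-‿cong (begin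
    1/ 2 * 1/ N * 1/! suc i * (∑[ l ≤ N ] χ (-ₙ a) l * B (suc i) (fromℕ l * 1/ N))
      ≈⟨ trans (*-assoc _ _ _) (*-congˡ (∑-*ˡ N _ _)) ⟩
    h * (∑[ l ≤ N ] 1/! suc i * (χ (-ₙ a) l * B (suc i) (fromℕ l * 1/ N)))
      ≈⟨ *-congˡ (∑-cong N λ l → begin
           1/! suc i * (χ (-ₙ a) (suc l) * (fromℕ (suc i !) * bernoulliSeries (fromℕ (suc l) * 1/ N) (suc i)))
             ≈⟨ solve 4 (λ i x n b → i :* (x :* (n :* b)) := n :* i :* (x :* b)) _ _ _ _ ⟩
           fromℕ (suc i !) * 1/! suc i * (χ (-ₙ a) (suc l) * bernoulliSeries (fromℕ (suc l) * 1/ N) (suc i))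
             ≈⟨ trans (*-congʳ (fromℕ*1/! (suc i))) (*-identityˡ _) ⟩
           χ (-ₙ a) (suc l) * bernoulliSeries (fromℕ (suc l) * 1/ N) (suc i)
             ≈⟨ *-cong (trans (χ≈ω^ (-ₙ a) (suc l)) (^-congˡ (suc l)
                  (ω-cancelʳ a (trans (ω-neg a) (sym θ*ωa≈1)))))
                  (bernoulliSeries-cong (sym (+-identityʳ _)) (suc i)) ⟩
           θ ^ suc l * bernoulliSeries (fromℕ (suc l) * 1/ N + 0#) (suc i) ∎) ⟩
    h * twisted N θ 0# (suc i) ∎))

  β-cong : ∀ i {a b} → ω a ≈ ω b → β (suc i) a ≈ β (suc i) b
  β-cong i {a} {b} ωa≈ωb = trans (β≈twisted i a (trans (*-congˡ ωa≈ωb) (ω-neg b)))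
    (sym (β≈twisted i b (ω-neg b)))

  -- Products of the series g̃

  module _ (k l : ℕ) (a b : Fin N) where

    weight : ℕ → ℕ → Carrier
    weight v₁ v₂ = χ a v₁ * E k v₁ * (χ b v₂ * E l v₂)

    product≈quadruple : ∀ n → (g̃ (suc k) a ⊛ g̃ (suc l) b) n ≈ quadruple weight n
    product≈quadruple n = begin
      (g̃ (suc k) a ⊛ g̃ (suc l) b) n
        ≈⟨ ⊛≈∑∇ (g̃ (suc k) a) (g̃ (suc l) b) n ⟩
      ∑∇ n (λ i j → g̃ (suc k) a i * g̃ (suc l) b j)
        ≈⟨ ∑∇-cong n (λ i j _ → *-cong (g̃≈D k a i) (g̃≈D l b j)) ⟩
      ∑∇ n (λ i j → D (λ _ v → χ a v * E k v) i * D (λ _ v → χ b v * E l v) j)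
        ≈⟨ ⊛≈∑∇ (D (λ _ v → χ a v * E k v)) (D (λ _ v → χ b v * E l v)) n ⟨
      (D (λ _ v → χ a v * E k v) ⊛ D (λ _ v → χ b v * E l v)) n
        ≈⟨ D-⊛-D _ _ n ⟩
      quadruple weight n ∎

    private
      w w′ δ : Carrier
      w  = ω (a -ₙ b)
      w′ = ω (b -ₙ a)
      δ  = [ a Fin.≟ b ]

      open PowerSums w w′ δ (ω-sub-inverse a b) (ω^N≈1 (a -ₙ b)) (ω^N≈1 (b -ₙ a))
        (twisted-constant a b)
        (trans (twisted-constant b a) (*-congˡ ([]-cong (b Fin.≟ a) (a Fin.≟ b) ≡.sym ≡.sym)))

    symmetrized : ℕ → Carrier
    symmetrized i = β (suc i) (a -ₙ b) + sign (suc i) * β (suc i) (b -ₙ a)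

    private
      κ̂≈symmetrized : ∀ i → κ̂ i ≈ symmetrized i
      κ̂≈symmetrized i = begin
        - (h * (twisted N w′ 0# (suc i) + sign (suc i) * twisted N w 0# (suc i)))
          ≈⟨ solve 4 (λ h u s v → :- (h :* (u :+ s :* v)) := :- (h :* u) :+ s :* :- (h :* v)) _ _ _ _ ⟩
        - (h * twisted N w′ 0# (suc i)) + sign (suc i) * - (h * twisted N w 0# (suc i))
          ≈⟨ +-cong (β≈twisted i (a -ₙ b) (ω-sub-inverse b a))
               (*-congˡ (β≈twisted i (b -ₙ a) (ω-sub-inverse a b))) ⟨
        symmetrized i ∎

      -- As a v₁ + b v₂ = b (v₁ + v₂) + (a - b) v₁, a fixed sum v₁ + v₂ lets a constant factor come
      -- out, and only the class a - b is left inside.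
      diagonal≈convolution : ∀ v → ∑[ t ≤ v ] weight t (suc v ∸ t) ≈ χ b (suc v) * convolution k l v
      diagonal≈convolution v = trans (∑-cong< v λ t t<v → begin
        χ a (suc t) * E k (suc t) * (χ b (v ∸ t) * E l (v ∸ t))
          ≈⟨ solve 4 (λ x e y f → x :* e :* (y :* f) := x :* y :* (e :* f)) _ _ _ _ ⟩
        χ a (suc t) * χ b (v ∸ t) * (E k (suc t) * E l (v ∸ t))
          ≈⟨ *-congʳ (begin
               χ a (suc t) * χ b (v ∸ t)
                 ≈⟨ *-cong (trans (χ≈ω^ a (suc t)) (trans (^-congˡ (suc t) (sym (ω-sub a b)))
                      (^-distrib-* w (ω b) (suc t)))) (χ≈ω^ b (v ∸ t)) ⟩
               w ^ suc t * ω b ^ suc t * ω b ^ (v ∸ t)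
                 ≈⟨ trans (*-assoc _ _ _) (*-congˡ (sym (^-homo-* (ω b) (suc t) (v ∸ t)))) ⟩
               w ^ suc t * ω b ^ (suc t ℕ.+ (v ∸ t))
                 ≡⟨ ≡.cong (λ m → w ^ suc t * ω b ^ suc m) (ℕ.m+[n∸m]≡n (ℕ.<⇒≤ t<v)) ⟩
               w ^ suc t * ω b ^ suc v
                 ≈⟨ trans (*-comm _ _) (*-congʳ (sym (χ≈ω^ b (suc v)))) ⟩
               χ b (suc v) * w ^ suc t ∎) ⟩
        χ b (suc v) * w ^ suc t * (E k (suc t) * E l (v ∸ t))
          ≈⟨ *-assoc _ _ _ ⟩
        χ b (suc v) * (w ^ suc t * (E k (suc t) * E l (v ∸ t))) ∎) (sym (∑-*ˡ v _ _))

      χ-twist : ∀ v → w ^ v * χ b v ≈ χ a v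
      χ-twist v = begin
        w ^ v * χ b v    ≈⟨ *-congˡ (χ≈ω^ b v) ⟩
        w ^ v * ω b ^ v  ≈⟨ ^-distrib-* w (ω b) v ⟨
        (w * ω b) ^ v    ≈⟨ ^-congˡ v (ω-sub a b) ⟩
        ω a ^ v          ≈⟨ χ≈ω^ a v ⟨
        χ a v            ∎

      m = k ℕ.+ l
      A B′ : ℕ → ℕ → Carrier
      A j v = χ a v * E j v
      B′ j v = χ b v * E j v

      diagonal≈ : ∀ v → ∑[ t ≤ v ] weight t (suc v ∸ t) ≈
        δ * A (suc m) (suc v)
        + ∑∇ m (λ i j → symmetrized i * (sign (suc l) * bin i l * A j (suc v) + sign (i ℕ.+ k) * bin i k * B′ j (suc v)))
        + h * ([ l ℕ.≟ 0 ] * A k (suc v) + [ k ℕ.≟ 0 ] * B′ l (suc v))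
      diagonal≈ v = begin
        ∑[ t ≤ v ] weight t (suc v ∸ t)
          ≈⟨ diagonal≈convolution v ⟩
        y * convolution k l v
          ≈⟨ *-congˡ (convolution≈ k l v) ⟩
        y * (W * (δ * E (suc m) v⁺) + Σ + h * ([ l ℕ.≟ 0 ] * (W * E k v⁺) + [ k ℕ.≟ 0 ] * E l v⁺))
          ≈⟨ solve 10 (λ y W d e s h b x a z →
               y :* (W :* (d :* e) :+ s :+ h :* (b :* (W :* x) :+ a :* z))
               := d :* (W :* y :* e) :+ y :* s :+ h :* (b :* (W :* y :* x) :+ a :* (y :* z))) y W δ _ Σ h [ l ℕ.≟ 0 ] _ [ k ℕ.≟ 0 ] _ ⟩
        δ * (W * y * E (suc m) v⁺) + y * Σ
          + h * ([ l ℕ.≟ 0 ] * (W * y * E k v⁺) + [ k ℕ.≟ 0 ] * (y * E l v⁺))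
          ≈⟨ +-cong (+-cong (*-congˡ (*-congʳ (χ-twist v⁺))) (trans (∑∇-*ˡ m _ _) (∑∇-cong m λ i j _ → begin
               y * (κ̂ i * ((sign (suc l) * bin i l * W + sign (i ℕ.+ k) * bin i k) * E j v⁺))
                 ≈⟨ *-congˡ (*-congʳ (κ̂≈symmetrized i)) ⟩
               y * (symmetrized i * ((sign (suc l) * bin i l * W + sign (i ℕ.+ k) * bin i k) * E j v⁺))
                 ≈⟨ solve 6 (λ y κ c W d e → y :* (κ :* ((c :* W :+ d) :* e))
                      := κ :* (c :* (W :* y :* e) :+ d :* (y :* e))) y (symmetrized i)
                      (sign (suc l) * bin i l) W (sign (i ℕ.+ k) * bin i k) (E j v⁺) ⟩
               symmetrized i * (sign (suc l) * bin i l * (W * y * E j v⁺) + sign (i ℕ.+ k) * bin i k * (y * E j v⁺))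
                 ≈⟨ *-congˡ (+-congʳ (*-congˡ (*-congʳ (χ-twist v⁺)))) ⟩
               symmetrized i * (sign (suc l) * bin i l * A j v⁺ + sign (i ℕ.+ k) * bin i k * B′ j v⁺) ∎)))
             (*-congˡ (+-congʳ (*-congˡ (*-congʳ (χ-twist v⁺))))) ⟩
        δ * A (suc m) v⁺
        + ∑∇ m (λ i j → symmetrized i * (sign (suc l) * bin i l * A j v⁺ + sign (i ℕ.+ k) * bin i k * B′ j v⁺))
        + h * ([ l ℕ.≟ 0 ] * A k v⁺ + [ k ℕ.≟ 0 ] * B′ l v⁺) ∎
        where
        v⁺ = suc v
        W = w ^ v⁺
        y = χ b v⁺
        Σ = ∑∇ m (λ i j → κ̂ i * ((sign (suc l) * bin i l * W + sign (i ℕ.+ k) * bin i k) * E j v⁺))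

      D-linear : ∀ x y (f g : ℕ → ℕ → Carrier) n →
        D (λ u v → x * f u v + y * g u v) n ≈ x * D f n + y * D g n
      D-linear x y f g n = trans (D-+ _ _ n) (+-cong (sym (D-*ˡ x f n)) (sym (D-*ˡ y g n)))

    stuffle-product : ∀ n → (g̃ (suc k) a ⊛ g̃ (suc l) b) n ≈
      g̃₂ (suc k) (suc l) a b n + g̃₂ (suc l) (suc k) b a n +
      ( [ a Fin.≟ b ] * g̃ (suc (suc m)) a n
      + ∑∇ m (λ i j → symmetrized i *
          (sign (suc l) * bin i l * g̃ (suc j) a n + sign (i ℕ.+ k) * bin i k * g̃ (suc j) b n))
      + h * ([ l ℕ.≟ 0 ] * g̃ (suc k) a n + [ k ℕ.≟ 0 ] * g̃ (suc l) b n))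
    stuffle-product n = trans (product≈quadruple n) (trans (stuffle weight n) (+-cong
      (+-cong
        (trans (quadruple>-cong n λ u v →
          solve 4 (λ x e y f → x :* e :* (y :* f) := x :* y :* (e :* f)) _ _ _ _)
          (sym (g̃₂≈∑ k l a b n)))
        (trans (quadruple>-cong n λ u v →
          solve 4 (λ x e y f → x :* e :* (y :* f) := y :* x :* (f :* e)) _ _ _ _)
          (sym (g̃₂≈∑ l k b a n))))
      (begin
        D (λ _ v → ∑[ t ≤ v ∸ 1 ] weight t (v ∸ t)) n
          ≈⟨ D-cong n (λ u v → diagonal≈ v) ⟩
        D (λ _ v → δ * A (suc m) v
          + ∑∇ m (λ i j → symmetrized i * (c₁ i * A j v + c₂ i * B′ j v))
          + h * ([ l ℕ.≟ 0 ] * A k v + [ k ℕ.≟ 0 ] * B′ l v)) n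
          ≈⟨ trans (D-+ _ _ n) (+-congʳ (D-+ _ _ n)) ⟩
        D (λ _ v → δ * A (suc m) v) n
          + D (λ _ v → ∑∇ m (λ i j → symmetrized i * (c₁ i * A j v + c₂ i * B′ j v))) n
          + D (λ _ v → h * ([ l ℕ.≟ 0 ] * A k v + [ k ℕ.≟ 0 ] * B′ l v)) n
          ≈⟨ +-cong (+-cong (sym (D-*ˡ _ _ n))
               (trans (D-∑∇ m _ n) (∑∇-cong m λ i j _ → trans (sym (D-*ˡ _ _ n)) (*-congˡ (D-linear _ _ _ _ n)))))
               (trans (sym (D-*ˡ _ _ n)) (*-congˡ (D-linear _ _ _ _ n))) ⟩
        δ * D (λ _ → A (suc m)) n
          + ∑∇ m (λ i j → symmetrized i * (c₁ i * D (λ _ → A j) n + c₂ i * D (λ _ → B′ j) n))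
          + h * ([ l ℕ.≟ 0 ] * D (λ _ → A k) n + [ k ℕ.≟ 0 ] * D (λ _ → B′ l) n)
          ≈⟨ +-cong (+-cong (*-congˡ (g̃≈D (suc m) a n))
               (∑∇-cong m λ i j _ → *-congˡ (+-cong (*-congˡ (g̃≈D j a n)) (*-congˡ (g̃≈D j b n)))))
               (*-congˡ (+-cong (*-congˡ (g̃≈D k a n)) (*-congˡ (g̃≈D l b n)))) ⟨
        δ * g̃ (suc (suc m)) a n
          + ∑∇ m (λ i j → symmetrized i * (c₁ i * g̃ (suc j) a n + c₂ i * g̃ (suc j) b n))
          + h * ([ l ℕ.≟ 0 ] * g̃ (suc k) a n + [ k ℕ.≟ 0 ] * g̃ (suc l) b n) ∎)))
      where
      c₁ c₂ : ℕ → Carrier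
      c₁ i = sign (suc l) * bin i l
      c₂ i = sign (i ℕ.+ k) * bin i k

  -- Each weight carries one ν more than its degree, so the product has one to spare. It is the
  -- factor -2h in the diagonal term of `shuffle-product`.
  E-* : ∀ k l v → E k v * E l v ≈ bin (k ℕ.+ l) k * (ν * E (k ℕ.+ l) v)
  E-* k l v = begin
    ν ^ suc k * (e^ fromℕ v) k * (ν ^ suc l * (e^ fromℕ v) l)
      ≈⟨ solve 4 (λ p e q f → p :* e :* (q :* f) := p :* q :* (e :* f)) _ _ _ _ ⟩
    ν ^ suc k * ν ^ suc l * ((e^ fromℕ v) k * (e^ fromℕ v) l)
      ≈⟨ *-cong (trans (sym (^-homo-* ν (suc k) (suc l))) (reflexive (≡.cong (λ m → ν ^ suc m) (ℕ.+-suc k l))))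
           (e-* (fromℕ v) k l) ⟩
    ν * ν ^ suc (k ℕ.+ l) * (bin (k ℕ.+ l) k * (e^ fromℕ v) (k ℕ.+ l))
      ≈⟨ solve 4 (λ c p b e → c :* p :* (b :* e) := b :* (c :* (p :* e))) _ _ _ _ ⟩
    bin (k ℕ.+ l) k * (ν * E (k ℕ.+ l) v) ∎

  -- The binomial theorem for v₁ + v₂, after which the two powers of v₁ merge by `E-*`. Since C(i,
  -- l) = 0 for i < l, the sum may be extended down to i = 0.
  E-+-* : ∀ k l v₁ v₂ → E k (v₁ ℕ.+ v₂) * E l v₁ ≈
    ∑∇ (k ℕ.+ l) (λ i j → bin i l * (E i v₁ * E j v₂))
  E-+-* k l v₁ v₂ = begin
    ν ^ suc k * (e^ fromℕ (v₁ ℕ.+ v₂)) k * E l v₁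
      ≈⟨ *-congʳ (*-congˡ (trans (e-cong k (fromℕ-+ v₁ v₂)) (e-+ (fromℕ v₁) (fromℕ v₂) k))) ⟩
    ν ^ suc k * ∑∇ k (λ i j → (e^ fromℕ v₁) i * (e^ fromℕ v₂) j) * E l v₁
      ≈⟨ trans (*-congʳ (∑∇-*ˡ k _ _)) (∑∇-*ʳ k _ _) ⟩
    ∑∇ k (λ i j → ν ^ suc k * ((e^ fromℕ v₁) i * (e^ fromℕ v₂) j) * E l v₁)
      ≈⟨ ∑∇-cong k (λ i j i+j≡k → begin
           ν ^ suc k * ((e^ fromℕ v₁) i * (e^ fromℕ v₂) j) * E l v₁
             ≈⟨ *-congʳ (*-congʳ (*-congˡ (trans (reflexive (≡.cong (ν ^_) (≡.sym i+j≡k))) (^-homo-* ν i j)))) ⟩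
           ν * (ν ^ i * ν ^ j) * ((e^ fromℕ v₁) i * (e^ fromℕ v₂) j) * E l v₁
             ≈⟨ solve 6 (λ c p q e f g → c :* (p :* q) :* (e :* f) :* g := c :* p :* e :* g :* (q :* f)) _ _ _ _ _ _ ⟩
           E i v₁ * E l v₁ * (ν ^ j * (e^ fromℕ v₂) j)
             ≈⟨ *-congʳ (trans (E-* i l v₁) (*-congʳ (bin-sym i l))) ⟩
           bin (i ℕ.+ l) l * (ν * E (i ℕ.+ l) v₁) * (ν ^ j * (e^ fromℕ v₂) j)
             ≈⟨ solve 5 (λ b c e p f → b :* (c :* e) :* (p :* f) := b :* (e :* (c :* p :* f))) _ _ _ _ _ ⟩
           bin (i ℕ.+ l) l * (E (i ℕ.+ l) v₁ * E j v₂) ∎) ⟩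
    ∑∇ k (λ i j → bin (i ℕ.+ l) l * (E (i ℕ.+ l) v₁ * E j v₂))
      ≈⟨ ∑∇-shift k l _ (λ i j i<l → trans (*-congʳ (bin-> i<l)) (zeroˡ _)) ⟨
    ∑∇ (k ℕ.+ l) (λ i j → bin i l * (E i v₁ * E j v₂)) ∎

  χ-+ₙ : ∀ a b v → χ (a +ₙ b) v ≈ χ a v * χ b v
  χ-+ₙ a b v = begin
    χ (a +ₙ b) v       ≈⟨ trans (χ≈ω^ (a +ₙ b) v) (^-congˡ v (ω-+ a b)) ⟩
    (ω a * ω b) ^ v    ≈⟨ ^-distrib-* (ω a) (ω b) v ⟩
    ω a ^ v * ω b ^ v  ≈⟨ *-cong (χ≈ω^ a v) (χ≈ω^ b v) ⟨
    χ a v * χ b v      ∎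

  χ-+ : ∀ a v₁ v₂ → χ a (v₁ ℕ.+ v₂) ≈ χ a v₁ * χ a v₂
  χ-+ a v₁ v₂ = trans (χ≈ω^ a (v₁ ℕ.+ v₂)) (trans (^-homo-* (ω a) v₁ v₂)
    (sym (*-cong (χ≈ω^ a v₁) (χ≈ω^ a v₂))))

  private
    -- The class a sits on v₁ + v₂ and b on v₁, so v₁ carries the class a + b and v₂ the class a.
    shuffled : ∀ k l a b n →
      quadruple> (λ v₁ v₂ → weight k l a b (v₁ ℕ.+ v₂) v₁) n ≈
      ∑∇ (k ℕ.+ l) (λ i j → bin i l * g̃₂ (suc i) (suc j) (a +ₙ b) a n)
    shuffled k l a b n = begin
      quadruple> (λ v₁ v₂ → weight k l a b (v₁ ℕ.+ v₂) v₁) n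
        ≈⟨ quadruple>-cong n (λ u v → term (suc u) (suc v)) ⟩
      quadruple> (λ v₁ v₂ → ∑∇ (k ℕ.+ l) (λ i j → bin i l * (χ (a +ₙ b) v₁ * χ a v₂ * (E i v₁ * E j v₂)))) n
        ≈⟨ trans (quadruple>-∑∇ (k ℕ.+ l) _ n) (∑∇-cong (k ℕ.+ l) λ i j _ →
             trans (sym (quadruple>-*ˡ _ _ n)) (*-congˡ (sym (g̃₂≈∑ i j (a +ₙ b) a n)))) ⟩
      ∑∇ (k ℕ.+ l) (λ i j → bin i l * g̃₂ (suc i) (suc j) (a +ₙ b) a n) ∎
      where
      term : ∀ v₁ v₂ → weight k l a b (v₁ ℕ.+ v₂) v₁ ≈
        ∑∇ (k ℕ.+ l) (λ i j → bin i l * (χ (a +ₙ b) v₁ * χ a v₂ * (E i v₁ * E j v₂)))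
      term v₁ v₂ = begin
        χ a (v₁ ℕ.+ v₂) * E k (v₁ ℕ.+ v₂) * (χ b v₁ * E l v₁)
          ≈⟨ *-congʳ (*-congʳ (χ-+ a v₁ v₂)) ⟩
        χ a v₁ * χ a v₂ * E k (v₁ ℕ.+ v₂) * (χ b v₁ * E l v₁)
          ≈⟨ solve 5 (λ x y e z f → x :* y :* e :* (z :* f) := x :* z :* y :* (e :* f)) _ _ _ _ _ ⟩
        χ a v₁ * χ b v₁ * χ a v₂ * (E k (v₁ ℕ.+ v₂) * E l v₁)
          ≈⟨ *-cong (*-congʳ (sym (χ-+ₙ a b v₁))) (E-+-* k l v₁ v₂) ⟩
        χ (a +ₙ b) v₁ * χ a v₂ * ∑∇ (k ℕ.+ l) (λ i j → bin i l * (E i v₁ * E j v₂))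
          ≈⟨ trans (∑∇-*ˡ (k ℕ.+ l) _ _) (∑∇-cong (k ℕ.+ l) λ i j _ →
               solve 3 (λ x b e → x :* (b :* e) := b :* (x :* e)) _ _ _) ⟩
        ∑∇ (k ℕ.+ l) (λ i j → bin i l * (χ (a +ₙ b) v₁ * χ a v₂ * (E i v₁ * E j v₂))) ∎

  -- The diagonal multiplicity u - 1 splits into u, which gives g̃′, and -1, which gives g̃. This is
  -- the combination that ε carries with δ_{s,1}.
  shuffle-product : ∀ k l a b n → (g̃ (suc k) a ⊛ g̃ (suc l) b) n ≈
    ∑∇ (k ℕ.+ l) (λ i j → bin i k * g̃₂ (suc i) (suc j) (a +ₙ b) b n) +
    ∑∇ (k ℕ.+ l) (λ i j → bin i l * g̃₂ (suc i) (suc j) (a +ₙ b) a n) +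
    bin (k ℕ.+ l) k * ((h + h) * (g̃′ (k ℕ.+ l) (a +ₙ b) n + g̃ (suc (k ℕ.+ l)) (a +ₙ b) n))
  shuffle-product k l a b n = trans (product≈quadruple k l a b n) (trans (shuffle (weight k l a b) n) (+-cong
    (trans (+-comm _ _) (+-cong (begin
      quadruple> (λ v₁ v₂ → weight k l a b v₁ (v₁ ℕ.+ v₂)) n
        ≈⟨ quadruple>-cong n (λ u v → *-comm _ _) ⟩
      quadruple> (λ v₁ v₂ → weight l k b a (v₁ ℕ.+ v₂) v₁) n
        ≈⟨ shuffled l k b a n ⟩
      ∑∇ (l ℕ.+ k) (λ i j → bin i k * g̃₂ (suc i) (suc j) (b +ₙ a) b n)
        ≡⟨ ≡.cong₂ (λ m d → ∑∇ m (λ i j → bin i k * g̃₂ (suc i) (suc j) d b n)) (ℕ.+-comm l k)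
             (ω-injective {b +ₙ a} {a +ₙ b} (trans (ω-+ b a) (trans (*-comm _ _) (sym (ω-+ a b))))) ⟩
      ∑∇ (k ℕ.+ l) (λ i j → bin i k * g̃₂ (suc i) (suc j) (a +ₙ b) b n) ∎) (shuffled k l a b n)))
    (begin
      D (λ u v → fromℕ (u ∸ 1) * weight k l a b v v) n
        ≈⟨ D-cong n (λ u v → term u (suc v)) ⟩
      D (λ u v → bin m k * - ν * (- 1# * (fromℕ u * G v) + G v)) n
        ≈⟨ trans (sym (D-*ˡ _ _ n)) (*-congˡ (trans (D-+ _ _ n) (+-cong
             (trans (sym (D-*ˡ _ _ n)) (trans (-1*x≈-x _) (sym (g̃′≈D m (a +ₙ b) n))))
             (sym (g̃≈D m (a +ₙ b) n))))) ⟩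
      bin m k * - ν * (g̃′ m (a +ₙ b) n + g̃ (suc m) (a +ₙ b) n)
        ≈⟨ trans (*-assoc _ _ _) (*-congˡ (*-congʳ (sym 2h≈-ν))) ⟩
      bin m k * ((h + h) * (g̃′ m (a +ₙ b) n + g̃ (suc m) (a +ₙ b) n)) ∎)))
    where
    m = k ℕ.+ l
    G : ℕ → Carrier
    G v = χ (a +ₙ b) v * E m v

    term : ∀ u v → fromℕ u * weight k l a b v v ≈ bin m k * - ν * (- 1# * (fromℕ (suc u) * G v) + G v)
    term u v = begin
      fromℕ u * (χ a v * E k v * (χ b v * E l v))
        ≈⟨ solve 5 (λ u x e y f → u :* (x :* e :* (y :* f)) := u :* (x :* y :* (e :* f))) _ _ _ _ _ ⟩
      fromℕ u * (χ a v * χ b v * (E k v * E l v))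
        ≈⟨ *-congˡ (*-cong (sym (χ-+ₙ a b v)) (E-* k l v)) ⟩
      fromℕ u * (χ (a +ₙ b) v * (bin m k * (ν * E m v)))
        ≈⟨ solve 5 (λ u x b c e → u :* (x :* (b :* (c :* e)))
             := b :* :- c :* (:- :1 :* ((:1 :+ u) :* (x :* e)) :+ x :* e)) _ _ _ _ _ ⟩
      bin m k * - ν * (- 1# * (fromℕ (suc u) * G v) + G v) ∎

  -- The double shuffle relations

  -- The degree m is an argument of its own, so that k + l can be replaced by an equal number
  -- without touching the binomials.
  βSum : ℕ → ℕ → Fin N → Fin N → ℕ → ℕ → Carrier
  βSum k l a b n m = ∑∇ m (λ i j → β (suc i) (a -ₙ b) *
    (sign (suc l) * bin i l * g̃ (suc j) a n + sign (i ℕ.+ k) * bin i k * g̃ (suc j) b n))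

  β₂≈ : ∀ k l a b n → β₂ (suc k) (suc l) a b n ≈
    β (suc l) b * g̃ (suc k) a n + βSum k l a b n (k ℕ.+ l)
  β₂≈ k l a b n = +-congˡ (trans (∑₊≈∑∇ k l F n) (∑∇-cong (k ℕ.+ l) λ i j _ →
    *-congˡ (+-congˡ (*-congʳ (*-congʳ (trans (reflexive (≡.cong (λ m → sign (suc m)) (ℕ.+-suc i k)))
      (solve 1 (λ s → :- :1 :* (:- :1 :* s) := s) _)))))))
    where
    F : ℕ → ℕ → PowerSeries
    F i j = β i (a -ₙ b) · ((sign (suc l) * fromℕ ((i ∸ 1) C l)) · g̃ j a
      ⊕ (sign (i ℕ.+ suc k) * fromℕ ((i ∸ 1) C k)) · g̃ j b)

  -- Exchanging (k, a) with (l, b) multiplies the bracket by (-1)^{i+1}, so both sums share one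
  -- bracket and their β combine to `symmetrized`.
  βSum-symmetrized : ∀ k l a b n →
    βSum k l a b n (k ℕ.+ l) + βSum l k b a n (l ℕ.+ k) ≈
    ∑∇ (k ℕ.+ l) (λ i j → symmetrized k l a b i *
      (sign (suc l) * bin i l * g̃ (suc j) a n + sign (i ℕ.+ k) * bin i k * g̃ (suc j) b n))
  βSum-symmetrized k l a b n = begin
    βSum k l a b n (k ℕ.+ l) + βSum l k b a n (l ℕ.+ k)
      ≈⟨ +-congˡ (reflexive (≡.cong (βSum l k b a n) (ℕ.+-comm l k))) ⟩
    βSum k l a b n (k ℕ.+ l) + βSum l k b a n (k ℕ.+ l)
      ≈⟨ ∑∇-+ (k ℕ.+ l) _ _ ⟨
    ∑∇ (k ℕ.+ l) (λ i j →
      β (suc i) (a -ₙ b) * (sign (suc l) * bin i l * g̃ (suc j) a n + sign (i ℕ.+ k) * bin i k * g̃ (suc j) b n) +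
      β (suc i) (b -ₙ a) * (sign (suc k) * bin i k * g̃ (suc j) b n + sign (i ℕ.+ l) * bin i l * g̃ (suc j) a n))
      ≈⟨ ∑∇-cong (k ℕ.+ l) (λ i j _ → term (β (suc i) (a -ₙ b)) (β (suc i) (b -ₙ a))
           (bin i l) (bin i k) (g̃ (suc j) a n) (g̃ (suc j) b n) i) ⟩
    ∑∇ (k ℕ.+ l) (λ i j → symmetrized k l a b i *
      (sign (suc l) * bin i l * g̃ (suc j) a n + sign (i ℕ.+ k) * bin i k * g̃ (suc j) b n)) ∎
    where
    term : ∀ x y u v g g′ i →
      x * (sign (suc l) * u * g + sign (i ℕ.+ k) * v * g′) +
      y * (sign (suc k) * v * g′ + sign (i ℕ.+ l) * u * g) ≈
      (x + sign (suc i) * y) * (sign (suc l) * u * g + sign (i ℕ.+ k) * v * g′)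
    term x y u v g g′ i = begin
      x * (sign (suc l) * u * g + sign (i ℕ.+ k) * v * g′) +
      y * (sign (suc k) * v * g′ + sign (i ℕ.+ l) * u * g)
        ≈⟨ +-congˡ (*-congˡ (+-cong (*-congʳ (*-congʳ (trans (sym (*-identityˡ _)) (*-congʳ (sym (sign²≈1 i))))))
             (*-congʳ (*-congʳ (^-homo-* (- 1#) i l))))) ⟩
      x * (sign (suc l) * u * g + sign (i ℕ.+ k) * v * g′) +
      y * (sign i * sign i * sign (suc k) * v * g′ + sign i * sign l * u * g)
        ≈⟨ +-congʳ (*-congˡ (+-congˡ (*-congʳ (*-congʳ (^-homo-* (- 1#) i k))))) ⟩
      x * (sign (suc l) * u * g + sign i * sign k * v * g′) +
      y * (sign i * sign i * sign (suc k) * v * g′ + sign i * sign l * u * g)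
        ≈⟨ solve 9 (λ x y u v g g′ si sk sl →
             x :* (:- :1 :* sl :* u :* g :+ si :* sk :* v :* g′)
               :+ y :* (si :* si :* (:- :1 :* sk) :* v :* g′ :+ si :* sl :* u :* g)
             := (x :+ :- :1 :* si :* y) :* (:- :1 :* sl :* u :* g :+ si :* sk :* v :* g′)) x y u v g g′ (sign i) (sign k) (sign l) ⟩
      (x + sign (suc i) * y) * (sign (suc l) * u * g + sign i * sign k * v * g′)
        ≈⟨ *-congˡ (+-congˡ (*-congʳ (*-congʳ (^-homo-* (- 1#) i k)))) ⟨
      (x + sign (suc i) * y) * (sign (suc l) * u * g + sign (i ℕ.+ k) * v * g′) ∎

  -- E₂, P with γ = ƛ = 0, in terms of k = r - 1 and l = s - 1.
  E⁰ P⁰ : ℕ → ℕ → Fin N → Fin N → PowerSeries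
  E⁰ k l a b n = g̃₂ (suc k) (suc l) a b n
    + (β (suc l) b * g̃ (suc k) a n + βSum k l a b n (k ℕ.+ l))
    + h * ([ k ℕ.≟ 1 ] * g̃′ (suc l) b n - [ k ℕ.≟ 0 ] * g̃′ l b n
           + [ l ℕ.≟ 0 ] * (g̃′ k a n + g̃ (suc k) a n))
  P⁰ k l a b n = (g̃ (suc k) a ⊛ g̃ (suc l) b) n
    + β (suc k) a * g̃ (suc l) b n + β (suc l) b * g̃ (suc k) a n
    + h * ([ k ℕ.≟ 1 ] * g̃′ (suc l) b n + [ l ℕ.≟ 1 ] * g̃′ (suc k) a n)

  E₂≈ : ∀ γ k l a b n → E₂ γ (suc k) (suc l) a b n ≈
    E⁰ k l a b n + h * (fromℕ N * [ k ℕ.≟ 0 ] * [ l ℕ.≟ 0 ] * γ a b n)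
  E₂≈ γ k l a b n = trans (+-congʳ (+-congˡ (β₂≈ k l a b n)))
    (solve 5 (λ g β h e x → g :+ β :+ h :* (e :+ x) := g :+ β :+ h :* e :+ h :* x) _ _ _ _ _)

  -- The g̃′ of index r - 1 and s - 1 occur in the two E⁰ with opposite signs and cancel; the
  -- remaining δ_{s,1} g̃_r^a and δ_{r,1} g̃_s^b are the endpoint terms of `stuffle-product`.
  stuffle⁰ : ∀ k l a b n → P⁰ k l a b n ≈
    E⁰ k l a b n + E⁰ l k b a n + [ a Fin.≟ b ] * g̃ (suc (suc (k ℕ.+ l))) a n
  stuffle⁰ k l a b n = begin
    P⁰ k l a b n
      ≈⟨ +-congʳ (+-congʳ (+-congʳ (trans (stuffle-product k l a b n)
           (+-congˡ (+-congʳ (+-congˡ (sym (βSum-symmetrized k l a b n)))))))) ⟩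
    G + G′ + (δ + (S + S′) + h * (l₀ * gₐ + k₀ * gᵇ)) + βₐ * gᵇ + βᵇ * gₐ + h * (k₁g′ + l₁g′)
      ≈⟨ lemma G G′ δ S S′ l₀ gₐ k₀ gᵇ (βₐ * gᵇ) (βᵇ * gₐ) k₁g′ l₁g′ (g̃′ k a n) (g̃′ l b n) ⟩
    E⁰ k l a b n + E⁰ l k b a n + δ ∎
    where
    G = g̃₂ (suc k) (suc l) a b n
    G′ = g̃₂ (suc l) (suc k) b a n
    δ = [ a Fin.≟ b ] * g̃ (suc (suc (k ℕ.+ l))) a n
    S = βSum k l a b n (k ℕ.+ l)
    S′ = βSum l k b a n (l ℕ.+ k)
    l₀ = [ l ℕ.≟ 0 ]
    k₀ = [ k ℕ.≟ 0 ]
    gₐ = g̃ (suc k) a n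
    gᵇ = g̃ (suc l) b n
    βₐ = β (suc k) a
    βᵇ = β (suc l) b
    k₁g′ = [ k ℕ.≟ 1 ] * g̃′ (suc l) b n
    l₁g′ = [ l ℕ.≟ 1 ] * g̃′ (suc k) a n

    lemma : ∀ G G′ δ S S′ l₀ gₐ k₀ gᵇ x y p q g′ₐ g′ᵇ →
      G + G′ + (δ + (S + S′) + h * (l₀ * gₐ + k₀ * gᵇ)) + x + y + h * (p + q) ≈
      (G + (y + S) + h * (p - k₀ * g′ᵇ + l₀ * (g′ₐ + gₐ))) +
      (G′ + (x + S′) + h * (q - l₀ * g′ₐ + k₀ * (g′ᵇ + gᵇ))) + δ
    lemma G G′ δ S S′ l₀ gₐ k₀ gᵇ x y p q g′ₐ g′ᵇ = trans
      (+-cong (solve 8 (λ G G′ δ S S′ r x y →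
         G :+ G′ :+ (δ :+ (S :+ S′) :+ r) :+ x :+ y := G :+ (y :+ S) :+ (G′ :+ (x :+ S′)) :+ δ :+ r) G G′ δ S S′ (h * (l₀ * gₐ + k₀ * gᵇ)) x y) refl)
      (trans (solve 5 (λ A B δ r s → A :+ B :+ δ :+ r :+ s := A :+ B :+ δ :+ (r :+ s)) (G + (y + S)) (G′ + (x + S′)) δ (h * (l₀ * gₐ + k₀ * gᵇ)) (h * (p + q)))
      (trans (+-congˡ (solve 9 (λ h l₀ gₐ k₀ gᵇ p q g′ₐ g′ᵇ →
         h :* (l₀ :* gₐ :+ k₀ :* gᵇ) :+ h :* (p :+ q)
         := h :* (p :- k₀ :* g′ᵇ :+ l₀ :* (g′ₐ :+ gₐ)) :+ h :* (q :- l₀ :* g′ₐ :+ k₀ :* (g′ᵇ :+ gᵇ))) h l₀ gₐ k₀ gᵇ p q g′ₐ g′ᵇ))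
      (solve 5 (λ A B δ r s → A :+ B :+ δ :+ (r :+ s) := A :+ r :+ (B :+ s) :+ δ) (G + (y + S)) (G′ + (x + S′)) δ (h * (p - k₀ * g′ᵇ + l₀ * (g′ₐ + gₐ)))
           (h * (q - l₀ * g′ₐ + k₀ * (g′ᵇ + gᵇ))))))

  private
    -- Separates the double series, the β and the ε. Along the outer sum i + j is always m, so every
    -- inner β-sum has the same degree, as `β-shuffle` requires; d stands for the class that (a + b)
    -- - b or (a + b) - a reduces to.
    shuffle-half : ∀ k m a b d n → ω (a -ₙ b) ≈ ω d →
      ∑∇ m (λ i j → bin i k * E⁰ i j a b n) ≈
      ∑∇ m (λ i j → bin i k * g̃₂ (suc i) (suc j) a b n) +
      ∑∇ m (λ i j → bin i k * (β (suc j) b * g̃ (suc i) a n + ∑∇ m (λ s t → β (suc s) d *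
        (sign (suc j) * bin s j * g̃ (suc t) a n + sign (s ℕ.+ i) * bin s i * g̃ (suc t) b n)))) +
      h * ∑∇ m (λ i j → bin i k * ([ i ℕ.≟ 1 ] * g̃′ (suc j) b n - [ i ℕ.≟ 0 ] * g̃′ j b n
           + [ j ℕ.≟ 0 ] * (g̃′ i a n + g̃ (suc i) a n)))
    shuffle-half k m a b d n ωeq = begin
      ∑∇ m (λ i j → bin i k * E⁰ i j a b n)
        ≈⟨ ∑∇-cong m (λ i j i+j≡m → trans
             (*-congˡ (+-congʳ (+-congˡ (+-congˡ (trans (reflexive (≡.cong (βSum i j a b n) i+j≡m))
               (∑∇-cong m λ s t _ → *-congʳ (β-cong s {a -ₙ b} {d} ωeq)))))))
             (solve 5 (λ b g β h e → b :* (g :+ β :+ h :* e) := b :* g :+ b :* β :+ h :* (b :* e)) _ _ _ _ _)) ⟩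
      ∑∇ m (λ i j → bin i k * g̃₂ (suc i) (suc j) a b n +
        bin i k * (β (suc j) b * g̃ (suc i) a n + ∑∇ m (λ s t → β (suc s) d *
          (sign (suc j) * bin s j * g̃ (suc t) a n + sign (s ℕ.+ i) * bin s i * g̃ (suc t) b n))) +
        h * (bin i k * ([ i ℕ.≟ 1 ] * g̃′ (suc j) b n - [ i ℕ.≟ 0 ] * g̃′ j b n
           + [ j ℕ.≟ 0 ] * (g̃′ i a n + g̃ (suc i) a n))))
        ≈⟨ trans (∑∇-+ m _ _) (+-cong (∑∇-+ m _ _) (sym (∑∇-*ˡ m _ _))) ⟩
      _ ∎

  -- Each half contributes h C(m, k) q m from its term with j = 0; together they are the diagonal of
  -- `shuffle-product`, whose factor is written h + h for this purpose.
  shuffle⁰ : ∀ k l a b n →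
    ∑∇ (k ℕ.+ l) (λ i j → bin i k * E⁰ i j (a +ₙ b) b n) +
    ∑∇ (k ℕ.+ l) (λ i j → bin i l * E⁰ i j (a +ₙ b) a n) ≈
    P⁰ k l a b n - h * ([ k ℕ.≟ 0 ] * [ l ℕ.≟ 0 ] * (g̃′ 0 a n + g̃′ 0 b n))
  shuffle⁰ k l a b n = begin
    ∑∇ m (λ i j → bin i k * E⁰ i j (a +ₙ b) b n) + ∑∇ m (λ i j → bin i l * E⁰ i j (a +ₙ b) a n)
      ≈⟨ +-cong (shuffle-half k m (a +ₙ b) b a n (ω-+-cancelʳ a b))
                (shuffle-half l m (a +ₙ b) a b n (ω-+-cancelˡ a b)) ⟩
    (A₁ + A₂ + h * A₃) + (B₁ + B₂ + h * B₃)
      ≈⟨ solve 7 (λ a₁ a₂ h a₃ b₁ b₂ b₃ →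
           (a₁ :+ a₂ :+ h :* a₃) :+ (b₁ :+ b₂ :+ h :* b₃)
           := a₁ :+ b₁ :+ (a₂ :+ b₂) :+ h :* (a₃ :+ b₃)) A₁ A₂ h A₃ B₁ B₂ B₃ ⟩
    A₁ + B₁ + (A₂ + B₂) + h * (A₃ + B₃)
      ≈⟨ +-cong (+-congˡ (β-shuffle k l (λ i → β (suc i) a) (λ i → β (suc i) b)
             (λ i → g̃ (suc i) a n) (λ i → g̃ (suc i) b n) (λ i → g̃ (suc i) (a +ₙ b) n)))
           (*-congˡ (+-cong (ε-shuffle k l (λ i → g̃′ i b n) q) B₃≈)) ⟩
    A₁ + B₁ + (β (suc k) a * g̃ (suc l) b n + β (suc l) b * g̃ (suc k) a n)
      + h * ((k₁g′ - k₀ * l₀ * g̃′ 0 b n + bin m k * q m) + (l₁g′ - k₀ * l₀ * g̃′ 0 a n + bin m k * q m))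
      ≈⟨ lemma A₁ B₁ (β (suc k) a * g̃ (suc l) b n) (β (suc l) b * g̃ (suc k) a n)
           k₁g′ l₁g′ (k₀ * l₀) (g̃′ 0 a n) (g̃′ 0 b n) (bin m k) (q m) ⟩
    A₁ + B₁ + bin m k * ((h + h) * q m) + β (suc k) a * g̃ (suc l) b n + β (suc l) b * g̃ (suc k) a n
      + h * (k₁g′ + l₁g′) - h * (k₀ * l₀ * (g̃′ 0 a n + g̃′ 0 b n))
      ≈⟨ +-congʳ (+-congʳ (+-congʳ (+-congʳ (shuffle-product k l a b n)))) ⟨
    P⁰ k l a b n - h * (k₀ * l₀ * (g̃′ 0 a n + g̃′ 0 b n)) ∎
    where
    m = k ℕ.+ l
    k₀ = [ k ℕ.≟ 0 ]
    l₀ = [ l ℕ.≟ 0 ]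
    k₁g′ = [ k ℕ.≟ 1 ] * g̃′ (suc l) b n
    l₁g′ = [ l ℕ.≟ 1 ] * g̃′ (suc k) a n
    q : ℕ → Carrier
    q i = g̃′ i (a +ₙ b) n + g̃ (suc i) (a +ₙ b) n
    A₁ = ∑∇ m (λ i j → bin i k * g̃₂ (suc i) (suc j) (a +ₙ b) b n)
    B₁ = ∑∇ m (λ i j → bin i l * g̃₂ (suc i) (suc j) (a +ₙ b) a n)
    A₂ = ∑∇ m (λ i j → bin i k * (β (suc j) b * g̃ (suc i) (a +ₙ b) n + ∑∇ m (λ s t → β (suc s) a *
        (sign (suc j) * bin s j * g̃ (suc t) (a +ₙ b) n + sign (s ℕ.+ i) * bin s i * g̃ (suc t) b n))))
    B₂ = ∑∇ m (λ i j → bin i l * (β (suc j) a * g̃ (suc i) (a +ₙ b) n + ∑∇ m (λ s t → β (suc s) b *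
        (sign (suc j) * bin s j * g̃ (suc t) (a +ₙ b) n + sign (s ℕ.+ i) * bin s i * g̃ (suc t) a n))))
    εs : ℕ → Fin N → ℕ → Carrier
    εs k b m = ∑∇ m (λ i j → bin i k * ([ i ℕ.≟ 1 ] * g̃′ (suc j) b n - [ i ℕ.≟ 0 ] * g̃′ j b n + [ j ℕ.≟ 0 ] * q i))
    A₃ = εs k b m
    B₃ = εs l a m

    B₃≈ : B₃ ≈ l₁g′ - k₀ * l₀ * g̃′ 0 a n + bin m k * q m
    B₃≈ = begin
      εs l a (k ℕ.+ l)
        ≡⟨ ≡.cong (εs l a) (ℕ.+-comm k l) ⟩
      εs l a (l ℕ.+ k)
        ≈⟨ ε-shuffle l k (λ i → g̃′ i a n) q ⟩
      l₁g′ - l₀ * k₀ * g̃′ 0 a n + bin (l ℕ.+ k) l * q (l ℕ.+ k)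
        ≈⟨ +-cong (+-congˡ (-‿cong (*-congʳ (*-comm _ _)))) (trans
             (reflexive (≡.cong (λ m → bin m l * q m) (ℕ.+-comm l k))) (*-congʳ (sym (bin-sym k l)))) ⟩
      l₁g′ - k₀ * l₀ * g̃′ 0 a n + bin m k * q m ∎

    lemma : ∀ A B x y p p′ d f f′ b q →
      A + B + (x + y) + h * ((p - d * f′ + b * q) + (p′ - d * f + b * q)) ≈
      A + B + b * ((h + h) * q) + x + y + h * (p + p′) - h * (d * (f + f′))
    lemma A B x y p p′ d f f′ b q = solve 12 (λ h A B x y p p′ d f f′ b q →
      A :+ B :+ (x :+ y) :+ h :* ((p :- d :* f′ :+ b :* q) :+ (p′ :- d :* f :+ b :* q))
      := A :+ B :+ b :* ((h :+ h) :* q) :+ x :+ y :+ h :* (p :+ p′) :- h :* (d :* (f :+ f′))) h A B x y p p′ d f f′ b q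

  -- The corner r = s = 1 and the linear system

  private
    hN≈½ : h * fromℕ N ≈ 1/ 2
    hN≈½ = trans (*-assoc _ _ _) (trans (*-congˡ (trans (*-comm _ _) (fromℕ*1/ N))) (*-identityʳ _))

    2hN≈1 : fromℕ 2 * (h * fromℕ N) ≈ 1#
    2hN≈1 = trans (*-congˡ hN≈½) (fromℕ*1/ 2)

    _at-11_ : ℕ → ℕ → Carrier
    k at-11 l = [ k ℕ.≟ 0 ] * [ l ℕ.≟ 0 ]

    -- The stuffle product yields g̃_{r+s} in every weight, whereas E_k is cut off at weight 2. The
    -- missing g̃_2 is what the diagonal equation of the system makes up for.
    truncate : ∀ k l (x : Carrier) a n →
      x * g̃ (suc (suc (k ℕ.+ l))) a n ≈ x * E₁ (suc k ℕ.+ suc l) a n + (k at-11 l) * (x * g̃ 2 a n)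
    truncate zero    zero    x a n = solve 2 (λ x g → x :* g := x :* (:0 :* g) :+ :1 :* :1 :* (x :* g)) x (g̃ 2 a n)
    truncate zero    (suc l) x a n = begin
      x * g̃ (3 ℕ.+ l) a n
        ≈⟨ solve 3 (λ x g y → x :* g := x :* (:1 :* g) :+ :1 :* :0 :* y) _ _ _ ⟩
      x * (1# * g̃ (3 ℕ.+ l) a n) + 1# * 0# * (x * g̃ 2 a n)
        ≈⟨ +-congʳ (*-congˡ (*-congʳ ([]-yes (2 ℕ.<? 3 ℕ.+ l) (ℕ.s≤s (ℕ.s≤s (ℕ.s≤s ℕ.z≤n)))))) ⟨
      x * E₁ (3 ℕ.+ l) a n + 1# * 0# * (x * g̃ 2 a n) ∎
    truncate (suc k) l       x a n = begin
      x * g̃ (3 ℕ.+ (k ℕ.+ l)) a n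
        ≈⟨ solve 4 (λ x g y z → x :* g := x :* (:1 :* g) :+ :0 :* z :* y) _ _ _ [ l ℕ.≟ 0 ] ⟩
      x * (1# * g̃ (3 ℕ.+ (k ℕ.+ l)) a n) + 0# * [ l ℕ.≟ 0 ] * (x * g̃ 2 a n)
        ≈⟨ +-congʳ (*-congˡ (*-congʳ ([]-yes (2 ℕ.<? 3 ℕ.+ (k ℕ.+ l)) (ℕ.s≤s (ℕ.s≤s (ℕ.s≤s ℕ.z≤n)))))) ⟨
      x * E₁ (3 ℕ.+ (k ℕ.+ l)) a n + 0# * [ l ℕ.≟ 0 ] * (x * g̃ 2 a n)
        ≡⟨ ≡.cong (λ m → x * E₁ (2 ℕ.+ m) a n + 0# * [ l ℕ.≟ 0 ] * (x * g̃ 2 a n)) (ℕ.+-suc k l) ⟨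
      x * E₁ (suc (suc k) ℕ.+ suc l) a n + 0# * [ l ℕ.≟ 0 ] * (x * g̃ 2 a n) ∎

    ∑∇-at-11 : ∀ k l x → ∑∇ (k ℕ.+ l) (λ i j → bin i k * (h * (fromℕ N * [ i ℕ.≟ 0 ] * [ j ℕ.≟ 0 ] * x))) ≈
      h * fromℕ N * ((k at-11 l) * x)
    ∑∇-at-11 zero    zero    x = trans (∑∇-zero _) (trans (*-congʳ (+-identityʳ 1#))
      (solve 3 (λ h n x → :1 :* (h :* (n :* :1 :* :1 :* x)) := h :* n :* (:1 :* :1 :* x)) _ _ _))
    ∑∇-at-11 zero    (suc l) x = trans (∑∇-0 (suc l) (vanish l x (λ i → bin i 0))) (sym (trans (*-congˡ
      (trans (*-congʳ (zeroʳ _)) (zeroˡ _))) (zeroʳ _)))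
      where
      vanish : ∀ m x (b : ℕ → Carrier) i j → i ℕ.+ j ≡ suc m →
        b i * (h * (fromℕ N * [ i ℕ.≟ 0 ] * [ j ℕ.≟ 0 ] * x)) ≈ 0#
      vanish m x b zero    (suc j) _ = solve 5 (λ b h n d x → b :* (h :* (n :* d :* :0 :* x)) := :0) _ _ _ _ _
      vanish m x b (suc i) j       _ = solve 5 (λ b h n d x → b :* (h :* (n :* :0 :* d :* x)) := :0) _ _ _ _ _
    ∑∇-at-11 (suc k) l       x = trans (∑∇-0 (suc (k ℕ.+ l)) vanish) (sym (trans (*-congˡ
      (trans (*-congʳ (zeroˡ _)) (zeroˡ _))) (zeroʳ _)))
      where
      vanish : ∀ i j → i ℕ.+ j ≡ suc (k ℕ.+ l) →
        bin i (suc k) * (h * (fromℕ N * [ i ℕ.≟ 0 ] * [ j ℕ.≟ 0 ] * x)) ≈ 0#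
      vanish zero    _ _ = zeroˡ _
      vanish (suc i) j _ = solve 5 (λ b h n d x → b :* (h :* (n :* :0 :* d :* x)) := :0) _ _ _ _ _

  module _ {γ ƛ : Fin N → Fin N → PowerSeries} (suitable : IsSuitable γ ƛ) where
    open IsSuitable suitable using (diagonal) renaming (stuffle to off-diagonal; shuffle to shuffle-11)

    -- The first two families of the system in one formula; the diagonal equation is doubled to
    -- match the other.
    stuffle-11 : ∀ a b n → γ a b n + γ b a n ≈ fromℕ 2 * (ƛ a b n + [ a Fin.≟ b ] * g̃ 2 a n)
    stuffle-11 a b n with a Fin.≟ b
    ... | yes ≡.refl = begin
      γ a a n + γ a a n
        ≈⟨ solve 2 (λ g l → g :+ g := (:1 :+ (:1 :+ :0)) :* (l :+ (g :- l))) (γ a a n) (ƛ a a n) ⟩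
      fromℕ 2 * (ƛ a a n + (γ a a n - ƛ a a n))
        ≈⟨ *-congˡ (+-congˡ (trans (diagonal a n) (sym (*-identityˡ _)))) ⟩
      fromℕ 2 * (ƛ a a n + 1# * g̃ 2 a n) ∎
    ... | no a≢b = begin
      γ a b n + γ b a n
        ≈⟨ solve 2 (λ x y → x := x :- y :+ y) _ (fromℕ 2 * ƛ a b n) ⟩
      γ a b n + γ b a n - fromℕ 2 * ƛ a b n + fromℕ 2 * ƛ a b n
        ≈⟨ +-congʳ (off-diagonal a b a≢b n) ⟩
      0# + fromℕ 2 * ƛ a b n
        ≈⟨ solve 3 (λ t l g → :0 :+ t :* l := t :* (l :+ :0 :* g)) _ _ _ ⟩
      fromℕ 2 * (ƛ a b n + 0# * g̃ 2 a n) ∎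

    stuffle-relation : ∀ k l a b n → P ƛ (suc k) (suc l) a b n ≈
      E₂ γ (suc k) (suc l) a b n + E₂ γ (suc l) (suc k) b a n
      + [ a Fin.≟ b ] * E₁ (suc k ℕ.+ suc l) a n
    stuffle-relation k l a b n = begin
      P⁰ k l a b n + d * ƛ a b n
        ≈⟨ +-congʳ (trans (stuffle⁰ k l a b n) (+-congˡ (truncate k l [ a Fin.≟ b ] a n))) ⟩
      X + Y + (Z + d * δ) + d * ƛ a b n
        -- The inserted `1#` is about to become 2hN, so that the factor 2 turns λ plus the g̃_2 term
        -- into the sum of the two γ.
        ≈⟨ solve 6 (λ X Y Z d δ l → X :+ Y :+ (Z :+ d :* δ) :+ d :* l := X :+ Y :+ Z :+ d :* (:1 :* (l :+ δ))) X Y Z d δ (ƛ a b n) ⟩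
      X + Y + Z + d * (1# * (ƛ a b n + δ))
        ≈⟨ +-congˡ (*-congˡ (trans (*-congʳ (trans (sym 2hN≈1) (*-comm _ _))) (trans (*-assoc _ _ _)
             (*-congˡ (sym (stuffle-11 a b n)))))) ⟩
      X + Y + Z + d * (h * fromℕ N * (γ a b n + γ b a n))
        ≈⟨ solve 9 (λ X Y Z k l h m g g′ →
             X :+ Y :+ Z :+ k :* l :* (h :* m :* (g :+ g′))
             := X :+ h :* (m :* k :* l :* g) :+ (Y :+ h :* (m :* l :* k :* g′)) :+ Z) X Y Z [ k ℕ.≟ 0 ] [ l ℕ.≟ 0 ] h (fromℕ N) (γ a b n) (γ b a n) ⟩
      X + h * (fromℕ N * [ k ℕ.≟ 0 ] * [ l ℕ.≟ 0 ] * γ a b n) +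
      (Y + h * (fromℕ N * [ l ℕ.≟ 0 ] * [ k ℕ.≟ 0 ] * γ b a n)) + Z
        ≈⟨ +-congʳ (+-cong (E₂≈ γ k l a b n) (E₂≈ γ l k b a n)) ⟨
      E₂ γ (suc k) (suc l) a b n + E₂ γ (suc l) (suc k) b a n + Z ∎
      where
      d = k at-11 l
      X = E⁰ k l a b n
      Y = E⁰ l k b a n
      Z = [ a Fin.≟ b ] * E₁ (suc k ℕ.+ suc l) a n
      δ = [ a Fin.≟ b ] * g̃ 2 a n

    private
      half : ∀ k l a b n → ∑∇ (k ℕ.+ l) (λ i j → bin i k * E₂ γ (suc i) (suc j) a b n) ≈
        ∑∇ (k ℕ.+ l) (λ i j → bin i k * E⁰ i j a b n) + h * fromℕ N * ((k at-11 l) * γ a b n)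
      half k l a b n = trans (∑∇-cong (k ℕ.+ l) λ i j _ → trans (*-congˡ (E₂≈ γ i j a b n)) (distribˡ _ _ _))
        (trans (∑∇-+ (k ℕ.+ l) _ _) (+-congˡ (∑∇-at-11 k l (γ a b n))))

    shuffle-relation : ∀ k l a b n → P ƛ (suc k) (suc l) a b n ≈
      ∑∇ (k ℕ.+ l) (λ i j → bin i k * E₂ γ (suc i) (suc j) (a +ₙ b) b n +
                            bin i l * E₂ γ (suc i) (suc j) (a +ₙ b) a n)
    shuffle-relation k l a b n = sym (begin
      ∑∇ (k ℕ.+ l) (λ i j → bin i k * E₂ γ (suc i) (suc j) (a +ₙ b) b n +
                            bin i l * E₂ γ (suc i) (suc j) (a +ₙ b) a n)
        ≈⟨ trans (∑∇-+ (k ℕ.+ l) _ _) (+-cong (half k l (a +ₙ b) b n) second) ⟩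
      X + hN * (d * γᵇ) + (Y + hN * (d * γᵃ))
        ≈⟨ solve 6 (λ X Y h d g g′ → X :+ h :* (d :* g) :+ (Y :+ h :* (d :* g′)) := X :+ Y :+ h :* (d :* (g′ :+ g))) X Y hN d γᵇ γᵃ ⟩
      X + Y + hN * (d * (γᵃ + γᵇ))
        -- At r = s = 1 the third family of the system restores the deficit hN times the sum of the
        -- two f₂, and adds 2hN λ, which is λ.
        ≈⟨ +-cong (trans (shuffle⁰ k l a b n) (+-congˡ (-‿cong (*-congˡ (*-congˡ (+-cong (g̃′₀≈Nf₂ a n) (g̃′₀≈Nf₂ b n)))))))
             (*-congˡ (*-congˡ γ≈)) ⟩
      P⁰ k l a b n - h * (d * (fromℕ N * f₂ a n + fromℕ N * f₂ b n)) + hN * (d * (f₂ a n + f₂ b n + fromℕ 2 * ƛ a b n))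
        ≈⟨ solve 8 (λ p h d m f f′ t l →
             p :- h :* (d :* (m :* f :+ m :* f′)) :+ h :* m :* (d :* (f :+ f′ :+ t :* l))
             := p :+ d :* (t :* (h :* m) :* l)) (P⁰ k l a b n) h d (fromℕ N) (f₂ a n) (f₂ b n) (fromℕ 2) (ƛ a b n) ⟩
      P⁰ k l a b n + d * (fromℕ 2 * hN * ƛ a b n)
        ≈⟨ +-congˡ (*-congˡ (trans (*-congʳ 2hN≈1) (*-identityˡ _))) ⟩
      P⁰ k l a b n + d * ƛ a b n ∎)
      where
      d = k at-11 l
      hN = h * fromℕ N
      γᵃ = γ (a +ₙ b) a n
      γᵇ = γ (a +ₙ b) b n
      X = ∑∇ (k ℕ.+ l) (λ i j → bin i k * E⁰ i j (a +ₙ b) b n)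
      Y = ∑∇ (k ℕ.+ l) (λ i j → bin i l * E⁰ i j (a +ₙ b) a n)

      γ≈ : γᵃ + γᵇ ≈ f₂ a n + f₂ b n + fromℕ 2 * ƛ a b n
      γ≈ = trans (solve 2 (λ x y → x := x :- y :+ y) _ (fromℕ 2 * ƛ a b n)) (+-congʳ (shuffle-11 a b n))

      second : ∑∇ (k ℕ.+ l) (λ i j → bin i l * E₂ γ (suc i) (suc j) (a +ₙ b) a n) ≈ Y + hN * (d * γᵃ)
      second = begin
        ∑∇ (k ℕ.+ l) (λ i j → bin i l * E₂ γ (suc i) (suc j) (a +ₙ b) a n)
          ≡⟨ ≡.cong (λ m → ∑∇ m (λ i j → bin i l * E₂ γ (suc i) (suc j) (a +ₙ b) a n)) (ℕ.+-comm k l) ⟩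
        ∑∇ (l ℕ.+ k) (λ i j → bin i l * E₂ γ (suc i) (suc j) (a +ₙ b) a n)
          ≈⟨ half l k (a +ₙ b) a n ⟩
        ∑∇ (l ℕ.+ k) (λ i j → bin i l * E⁰ i j (a +ₙ b) a n) + hN * ((l at-11 k) * γᵃ)
          ≈⟨ +-cong (reflexive (≡.cong (λ m → ∑∇ m (λ i j → bin i l * E⁰ i j (a +ₙ b) a n)) (ℕ.+-comm l k)))
               (*-congˡ (*-congʳ (*-comm _ _))) ⟩
        Y + hN * (d * γᵃ) ∎

  -- The choice of γ for which the corner series E₂ γ 1 1 vanish; the stuffle
  -- relation then forces ƛ.
  γ⁰ ƛ⁰ : Fin N → Fin N → PowerSeries
  γ⁰ a b n = - (E⁰ 0 0 a b n + E⁰ 0 0 a b n)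
  ƛ⁰ a b n = 1/ 2 * (γ⁰ a b n + γ⁰ b a n) - [ a Fin.≟ b ] * g̃ 2 a n

  private
    2ƛ⁰ : ∀ a b n → fromℕ 2 * ƛ⁰ a b n ≈ γ⁰ a b n + γ⁰ b a n - fromℕ 2 * ([ a Fin.≟ b ] * g̃ 2 a n)
    2ƛ⁰ a b n = trans (solve 4 (λ t s g x → t :* (s :* g :- x) := t :* s :* g :- t :* x) _ _ _ _)
      (+-congʳ (trans (*-congʳ (fromℕ*1/ 2)) (*-identityˡ _)))

    ƛ⁰-symmetric : ∀ a b n → ƛ⁰ a b n ≈ ƛ⁰ b a n
    ƛ⁰-symmetric a b n = +-cong (*-congˡ (+-comm _ _)) (-‿cong swapped)
      where
      swapped : [ a Fin.≟ b ] * g̃ 2 a n ≈ [ b Fin.≟ a ] * g̃ 2 b n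
      swapped = trans ([]*-cong (a Fin.≟ b) λ a≡b → reflexive (≡.cong (λ c → g̃ 2 c n) a≡b))
        (*-congʳ ([]-cong (a Fin.≟ b) (b Fin.≟ a) ≡.sym ≡.sym))

    ƛ⁰-diagonal : ∀ a n → γ⁰ a a n - ƛ⁰ a a n ≈ g̃ 2 a n
    ƛ⁰-diagonal a n = begin
      γ⁰ a a n - (1/ 2 * (γ⁰ a a n + γ⁰ a a n) - [ a Fin.≟ a ] * g̃ 2 a n)
        ≈⟨ +-congˡ (-‿cong (+-cong (trans
             (solve 2 (λ s g → s :* (g :+ g) := (:1 :+ (:1 :+ :0)) :* s :* g) _ _)
             (trans (*-congʳ (fromℕ*1/ 2)) (*-identityˡ _)))
             (-‿cong (yes*≈ (a Fin.≟ a) ≡.refl)))) ⟩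
      γ⁰ a a n - (γ⁰ a a n - g̃ 2 a n)
        ≈⟨ solve 2 (λ x y → x :- (x :- y) := y) _ _ ⟩
      g̃ 2 a n ∎

    ƛ⁰-stuffle : ∀ a b → a ≢ b → ∀ n → γ⁰ a b n + γ⁰ b a n - fromℕ 2 * ƛ⁰ a b n ≈ 0#
    ƛ⁰-stuffle a b a≢b n = begin
      γ⁰ a b n + γ⁰ b a n - fromℕ 2 * ƛ⁰ a b n
        ≈⟨ +-congˡ (-‿cong (trans (2ƛ⁰ a b n) (+-congˡ (-‿cong (*-congˡ (no*≈0 (a Fin.≟ b) a≢b)))))) ⟩
      γ⁰ a b n + γ⁰ b a n - (γ⁰ a b n + γ⁰ b a n - fromℕ 2 * 0#)
        ≈⟨ solve 2 (λ x t → x :- (x :- t :* :0) := :0) _ _ ⟩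
      0# ∎

    -- The left side is twice the difference between the stuffle and the shuffle expression at r = s
    -- = 1 for γ = ƛ = 0. The first equals P⁰ and the second P⁰ minus the defect, so only the defect
    -- remains.
    ƛ⁰-shuffle : ∀ a b n → γ⁰ (a +ₙ b) a n + γ⁰ (a +ₙ b) b n - fromℕ 2 * ƛ⁰ a b n ≈ f₂ a n + f₂ b n
    ƛ⁰-shuffle a b n = begin
      γ⁰ (a +ₙ b) a n + γ⁰ (a +ₙ b) b n - fromℕ 2 * ƛ⁰ a b n
        ≈⟨ +-congˡ (-‿cong (2ƛ⁰ a b n)) ⟩
      - (Eₐ + Eₐ) - (Eᵇ + Eᵇ) - (- (X + X) - (Y + Y) - fromℕ 2 * δ)
        ≈⟨ solve 5 (λ e e′ x y d →
             :- (e :+ e) :- (e′ :+ e′) :- (:- (x :+ x) :- (y :+ y) :- (:1 :+ (:1 :+ :0)) :* d)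
             := (:1 :+ (:1 :+ :0)) :* (x :+ y :+ d :- (e′ :+ e))) Eₐ Eᵇ X Y δ ⟩
      fromℕ 2 * (X + Y + δ - (Eᵇ + Eₐ))
        ≈⟨ *-congˡ (+-cong (stuffle⁰ 0 0 a b n) (-‿cong (trans (sym (shuffle⁰ 0 0 a b n)) corner))) ⟨
      fromℕ 2 * (Π - (Π - h * (1# * 1# * (g̃′ 0 a n + g̃′ 0 b n))))
        ≈⟨ *-congˡ (+-congˡ (-‿cong (+-congˡ (-‿cong (*-congˡ (*-congˡ (+-cong (g̃′₀≈Nf₂ a n) (g̃′₀≈Nf₂ b n)))))))) ⟩
      fromℕ 2 * (Π - (Π - h * (1# * 1# * (fromℕ N * f₂ a n + fromℕ N * f₂ b n))))
        ≈⟨ solve 6 (λ t p h m f f′ → t :* (p :- (p :- h :* (:1 :* :1 :* (m :* f :+ m :* f′))))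
             := t :* (h :* m) :* (f :+ f′)) (fromℕ 2) Π h (fromℕ N) (f₂ a n) (f₂ b n) ⟩
      fromℕ 2 * (h * fromℕ N) * (f₂ a n + f₂ b n)
        ≈⟨ trans (*-congʳ 2hN≈1) (*-identityˡ _) ⟩
      f₂ a n + f₂ b n ∎
      where
      Eₐ = E⁰ 0 0 (a +ₙ b) a n
      Eᵇ = E⁰ 0 0 (a +ₙ b) b n
      X = E⁰ 0 0 a b n
      Y = E⁰ 0 0 b a n
      Π = P⁰ 0 0 a b n
      δ = [ a Fin.≟ b ] * g̃ 2 a n

      corner : ∑∇ 0 (λ i j → bin i 0 * E⁰ i j (a +ₙ b) b n) + ∑∇ 0 (λ i j → bin i 0 * E⁰ i j (a +ₙ b) a n) ≈ Eᵇ + Eₐ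
      corner = +-cong (trans (∑∇-zero _) (trans (*-congʳ (+-identityʳ 1#)) (*-identityˡ _)))
                      (trans (∑∇-zero _) (trans (*-congʳ (+-identityʳ 1#)) (*-identityˡ _)))

  suitable⁰ : IsSuitable γ⁰ ƛ⁰
  suitable⁰ = record
    { symmetric = ƛ⁰-symmetric ; diagonal = ƛ⁰-diagonal ; stuffle = ƛ⁰-stuffle ; shuffle = ƛ⁰-shuffle }

  double-shuffle : ∀ γ ƛ → IsSuitable γ ƛ →
    ∀ (r s : ℕ) .{{_ : NonZero r}} .{{_ : NonZero s}} (a b : Fin N) →
    (P ƛ r s a b ≋ E₂ γ r s a b ⊕ E₂ γ s r b a ⊕ [ a Fin.≟ b ] · E₁ (r ℕ.+ s) a)
    ×
    (E₂ γ r s a b ⊕ E₂ γ s r b a ⊕ [ a Fin.≟ b ] · E₁ (r ℕ.+ s) a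
      ≋ ∑₊ (r ℕ.+ s) (λ i j →
          fromℕ ((i ∸ 1) C (r ∸ 1)) · E₂ γ i j (a +ₙ b) b
          ⊕ fromℕ ((i ∸ 1) C (s ∸ 1)) · E₂ γ i j (a +ₙ b) a))
  double-shuffle γ ƛ suitable zero    s       a b = contradiction ≡.refl (ℕ.≢-nonZero⁻¹ 0)
  double-shuffle γ ƛ suitable (suc k) zero    a b = contradiction ≡.refl (ℕ.≢-nonZero⁻¹ 0)
  double-shuffle γ ƛ suitable (suc k) (suc l) a b =
    stuffle-relation suitable k l a b ,
    λ n → trans (sym (stuffle-relation suitable k l a b n))
      (trans (shuffle-relation suitable k l a b n) (sym (∑₊≈∑∇ k l (λ i j →
        fromℕ ((i ∸ 1) C k) · E₂ γ i j (a +ₙ b) b ⊕ fromℕ ((i ∸ 1) C l) · E₂ γ i j (a +ₙ b) a) n)))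

open import Data.Fin.Properties using (_≟_)
open import Data.Nat.Base using (_+_)
open import Data.Product.Base using (_×_; ∃₂)

theorem6p3 : ∀ {c ℓ₁ ℓ₂} (K : HeytingField c ℓ₁ ℓ₂) (char0 : CharacteristicZero K)
    (N : ℕ) .{{_ : NonZero N}}
    (η : HeytingField.Carrier K) → IsPrimitiveRoot K N η →
    let open DoubleEisenstein K char0 N η in
    (∃₂ λ γ ƛ → IsSuitable γ ƛ)
    ×
    (∀ γ ƛ → IsSuitable γ ƛ →
    ∀ (r s : ℕ) .{{_ : NonZero r}} .{{_ : NonZero s}} (a b : Fin N) →
    (P ƛ r s a b ≋ E₂ γ r s a b ⊕ E₂ γ s r b a ⊕ [ a ≟ b ] · E₁ (r + s) a)
    ×
    (E₂ γ r s a b ⊕ E₂ γ s r b a ⊕ [ a ≟ b ] · E₁ (r + s) a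
    ≋ ∑₊ (r + s) (λ i j →
    fromℕ ((i ∸ 1) C (r ∸ 1)) · E₂ γ i j (a +ₙ b) b
    ⊕ fromℕ ((i ∸ 1) C (s ∸ 1)) · E₂ γ i j (a +ₙ b) a)))
theorem6p3 K char0 N η root = (γ⁰ , ƛ⁰ , suitable⁰) , double-shuffle
  where open DoubleShuffle K char0 N η root
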